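{- Let $F(X,Y)$ be a given Boolean relational specification. If $Y_i\in Y$ is uniquely defined in terms of $(X,Y^{1:i-1})$ by a circuit of size $s$, then a Skolem function for $Y_i$ can be learned, with high probability, using a number of NP oracle calls polynomial in $|F|$ and $s$.
   Context: $F(X,Y)$ is a Boolean formula over input variables $X=\{X_1,\dots,X_n\}$ and output variables $Y=\{Y_1,\dots,Y_m\}$; $|F|$ is its size; $Y^{1:i-1}=\{Y_1,\dots,Y_{i-1}\}$. The learner is a randomized algorithm that is given $F$ and has access to an NP oracle; "with high probability" is over its internal randomness. For $Z\subseteq (X\cup Y)\setminus\{Y_i\}$, the variable $Y_i$ is uniquely defined in terms of $Z$ if $F(X,Y)\wedge F(\hat X,\hat Y)\wedge (Z=\hat Z)\implies Y_i=\hat Y_i$ holds, where $\hat X,\hat Y$ are fresh copies of $X,Y$ and $\hat Z$ is the corresponding copy of $Z$. It is uniquely defined in terms of $(X,Y^{1:i-1})$ by a circuit of size $s$ if there is a circuit of size $s$ computing $Y_i$ from $(X,Y^{1:i-1})$ on all satisfying assignments of $F$. Skolem functions for $F$ are Boolean functions $\Psi=\langle\psi_1,\dots,\psi_m\rangle$ such that $\exists Y\,F(X,Y)\equiv F(X,\Psi(X))$; $\psi_i$ may be written in terms of other $Y$ variables provided there are no cyclic dependencies. For $Y_i$ uniquely defined in terms of $(X,Y^{1:i-1})$, a Skolem function for $Y_i$ is a circuit $h$ on $(X,Y^{1:i-1})$ such that $h(\vec x,\vec y^{1:i-1})=\vec y_i$ for every $(\vec x,\vec y)$ with $F(\vec x,\vec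 y)=1$. -}

module Defs where

open import Data.Bool.Base using (Bool; true; false; not; _∧_; _∨_; if_then_else_)
open import Data.Fin.Base using (Fin; zero; suc; toℕ; inject; Fin′)
open import Data.List.Base using (List; []; _∷_)
open import Data.Nat.Base using (ℕ; zero; suc; _+_; _*_; _^_; _≤_)
open import Data.Product.Base using (Σ; ∃; ∃-syntax; _×_; _,_)
open import Data.Vec.Base using (Vec; []; _∷_; _++_; lookup; tabulate; toList)
open import Function.Base using (_∘_)
open import Function.Bundles using (_⇔_)
open import Relation.Binary.PropositionalEquality using (_≡_)

data Formula (n m : ℕ) : Set where
  X     : Fin n → Formula n m
  Y     : Fin m → Formula n m
  const : Bool → Formula n m
  neg   : Formula n m → Formula n m
  and   : Formula n m → Formula n m → Formula n m
  or    : Formula n m → Formula n m → Formula n m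

⟦_⟧ : ∀ {n m} → Formula n m → Vec Bool n → Vec Bool m → Bool
⟦ X j ⟧     x y = lookup x j
⟦ Y j ⟧     x y = lookup y j
⟦ const b ⟧ x y = b
⟦ neg F ⟧   x y = not (⟦ F ⟧ x y)
⟦ and F G ⟧ x y = ⟦ F ⟧ x y ∧ ⟦ G ⟧ x y
⟦ or F G ⟧  x y = ⟦ F ⟧ x y ∨ ⟦ G ⟧ x y

nodes : ∀ {n m} → Formula n m → ℕ
nodes (X j)     = 1
nodes (Y j)     = 1
nodes (const b) = 1
nodes (neg F)   = 1 + nodes F
nodes (and F G) = 1 + (nodes F + nodes G)
nodes (or F G)  = 1 + (nodes F + nodes G)

-- The declared variables are part of the specification and count towards
-- its size, whether or not they occur in the formula.
∣_∣ : ∀ {n m} → Formula n m → ℕ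
∣_∣ {n} {m} F = n + m + nodes F

-- A circuit with k inputs is a straight-line program.  Each gate reads
-- earlier wires; its own wire becomes wire zero, shifting the others by one.

data Gate (k : ℕ) : Set where
  const : Bool → Gate k
  neg   : Fin k → Gate k
  and   : Fin k → Fin k → Gate k
  or    : Fin k → Fin k → Gate k

data Circuit (k : ℕ) : Set where
  output : Fin k → Circuit k
  gate   : Gate k → Circuit (suc k) → Circuit k

gates : ∀ {k} → Circuit k → ℕ
gates (output j) = 0
gates (gate g h) = suc (gates h)

evalGate : ∀ {k} → Gate k → Vec Bool k → Bool
evalGate (const b) w = b
evalGate (neg a)   w = not (lookup w a)
evalGate (and a b) w = lookup w a ∧ lookup w b
evalGate (or a b)  w = lookup w a ∨ lookup w b

eval : ∀ {k} → Circuit k → Vec Bool k → Bool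
eval (output j) w = lookup w j
eval (gate g h) w = eval h (evalGate g w ∷ w)

-- With i counted from 0, the outputs preceding Y i are those indexed by Fin′ i.
before : ∀ {m} (i : Fin m) → Vec Bool m → Vec Bool (toℕ i)
before i y = tabulate {n = toℕ i} (λ (j : Fin′ i) → lookup y (inject j))

CircuitFor : ∀ {m} → ℕ → Fin m → Set
CircuitFor n i = Circuit (n + toℕ i)

Computes : ∀ {n m} (F : Formula n m) (i : Fin m) → CircuitFor n i → Set
Computes {n} {m} F i h =
  (x : Vec Bool n) (y : Vec Bool m) → ⟦ F ⟧ x y ≡ true →
  eval h (x ++ before i y) ≡ lookup y i

UniquelyDefinedByCircuitOfSize : ∀ {n m} → Formula n m → Fin m → ℕ → Set
UniquelyDefinedByCircuitOfSize {n} F i s =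
  Σ (CircuitFor n i) λ h → gates h ≡ s × Computes F i h

-- For a uniquely defined Y i, being a Skolem function means computing Y i
-- on all satisfying assignments.
IsSkolemFunction : ∀ {n m} (F : Formula n m) (i : Fin m) → CircuitFor n i → Set
IsSkolemFunction = Computes

data Poly (k : ℕ) : Set where
  con     : ℕ → Poly k
  var     : Fin k → Poly k
  _⊕_ _⊗_ : Poly k → Poly k → Poly k

_⟨_⟩ : ∀ {k} → Poly k → Vec ℕ k → ℕ
con a   ⟨ v ⟩ = a
var j   ⟨ v ⟩ = lookup v j
(p ⊕ q) ⟨ v ⟩ = p ⟨ v ⟩ + q ⟨ v ⟩
(p ⊗ q) ⟨ v ⟩ = p ⟨ v ⟩ * q ⟨ v ⟩

-- The machine model is a WHILE language over binary trees in the style of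
-- Jones, extended by coin flips and oracle queries.

data Tree : Set where
  leaf : Tree
  _·_  : Tree → Tree → Tree

size : Tree → ℕ
size leaf    = 1
size (l · r) = 1 + (size l + size r)

bit : Bool → Tree
bit false = leaf
bit true  = leaf · leaf

Oracle : Set
Oracle = Tree → Bool

-- Prog k : programs with k free variables.  `while c b` repeatedly replaces
-- the value of variable zero by that of b, until c is a leaf, and returns it.
data Prog : ℕ → Set where
  var   : ∀ {k} → Fin k → Prog k
  leaf  : ∀ {k} → Prog k
  _·_   : ∀ {k} → Prog k → Prog k → Prog k
  bind  : ∀ {k} → Prog k → Prog (suc k) → Prog k
  match : ∀ {k} → Prog k → Prog k → Prog (suc (suc k)) → Prog k
  while : ∀ {k} → Prog (suc k) → Prog (suc k) → Prog (suc k)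
  flip  : ∀ {k} → Prog k
  ask   : ∀ {k} → Prog k → Prog k

-- O ∣ ρ ⊢ e , ω ⇓ v , ω′ : with oracle O and environment ρ, program e
-- evaluates to v, leaving ω′ of the coin tosses ω unused.
data _∣_⊢_,_⇓_,_ (O : Oracle) :
  ∀ {k} → Vec Tree k → Prog k → List Bool → Tree → List Bool → Set where

  var : ∀ {k} {ρ : Vec Tree k} {j ω} →
    O ∣ ρ ⊢ var j , ω ⇓ lookup ρ j , ω

  leaf : ∀ {k} {ρ : Vec Tree k} {ω} →
    O ∣ ρ ⊢ leaf , ω ⇓ leaf , ω

  _·_ : ∀ {k} {ρ : Vec Tree k} {a b u v ω ω′ ω″} →
    O ∣ ρ ⊢ a , ω ⇓ u , ω′ →
    O ∣ ρ ⊢ b , ω′ ⇓ v , ω″ →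
    O ∣ ρ ⊢ a · b , ω ⇓ u · v , ω″

  bind : ∀ {k} {ρ : Vec Tree k} {a b u v ω ω′ ω″} →
    O ∣ ρ ⊢ a , ω ⇓ u , ω′ →
    O ∣ u ∷ ρ ⊢ b , ω′ ⇓ v , ω″ →
    O ∣ ρ ⊢ bind a b , ω ⇓ v , ω″

  match-leaf : ∀ {k} {ρ : Vec Tree k} {a b c v ω ω′ ω″} →
    O ∣ ρ ⊢ a , ω ⇓ leaf , ω′ →
    O ∣ ρ ⊢ b , ω′ ⇓ v , ω″ →
    O ∣ ρ ⊢ match a b c , ω ⇓ v , ω″

  match-node : ∀ {k} {ρ : Vec Tree k} {a b c l r v ω ω′ ω″} →
    O ∣ ρ ⊢ a , ω ⇓ l · r , ω′ →
    O ∣ l ∷ r ∷ ρ ⊢ c , ω′ ⇓ v , ω″ →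
    O ∣ ρ ⊢ match a b c , ω ⇓ v , ω″

  while-stop : ∀ {k} {ρ : Vec Tree k} {c b u ω ω′} →
    O ∣ u ∷ ρ ⊢ c , ω ⇓ leaf , ω′ →
    O ∣ u ∷ ρ ⊢ while c b , ω ⇓ u , ω′

  while-step : ∀ {k} {ρ : Vec Tree k} {c b l r u u′ v ω ω′ ω″ ω‴} →
    O ∣ u ∷ ρ ⊢ c , ω ⇓ l · r , ω′ →
    O ∣ u ∷ ρ ⊢ b , ω′ ⇓ u′ , ω″ →
    O ∣ u′ ∷ ρ ⊢ while c b , ω″ ⇓ v , ω‴ →
    O ∣ u ∷ ρ ⊢ while c b , ω ⇓ v , ω‴

  flip : ∀ {k} {ρ : Vec Tree k} {b ω} →
    O ∣ ρ ⊢ flip , b ∷ ω ⇓ bit b , ω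

  ask : ∀ {k} {ρ : Vec Tree k} {a q ω ω′} →
    O ∣ ρ ⊢ a , ω ⇓ q , ω′ →
    O ∣ ρ ⊢ ask a , ω ⇓ bit (O q) , ω′

-- A step is a bounded number of pointer operations, hence has unit cost.
-- Trees built with sharing may be exponentially large, so queries are charged
-- for their size.
steps : ∀ {O k} {ρ : Vec Tree k} {e ω v ω′} → O ∣ ρ ⊢ e , ω ⇓ v , ω′ → ℕ
steps var                = 1
steps leaf               = 1
steps (d₁ · d₂)          = 1 + (steps d₁ + steps d₂)
steps (bind d₁ d₂)       = 1 + (steps d₁ + steps d₂)
steps (match-leaf d₁ d₂) = 1 + (steps d₁ + steps d₂)
steps (match-node d₁ d₂) = 1 + (steps d₁ + steps d₂)
steps (while-stop d)     = 1 + steps d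
steps (while-step d₁ d₂ d₃) = 1 + (steps d₁ + (steps d₂ + steps d₃))
steps flip               = 1
steps (ask {q = q} d)    = 1 + (size q + steps d)

-- The result, too, has to be written out.
time : ∀ {O k} {ρ : Vec Tree k} {e ω v ω′} → O ∣ ρ ⊢ e , ω ⇓ v , ω′ → ℕ
time {v = v} d = steps d + size v

calls : ∀ {O k} {ρ : Vec Tree k} {e ω v ω′} → O ∣ ρ ⊢ e , ω ⇓ v , ω′ → ℕ
calls var                = 0
calls leaf               = 0
calls (d₁ · d₂)          = calls d₁ + calls d₂
calls (bind d₁ d₂)       = calls d₁ + calls d₂
calls (match-leaf d₁ d₂) = calls d₁ + calls d₂
calls (match-node d₁ d₂) = calls d₁ + calls d₂
calls (while-stop d)     = calls d
calls (while-step d₁ d₂ d₃) = calls d₁ + (calls d₂ + calls d₃)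
calls flip               = 0
calls (ask d)            = 1 + calls d

∅ : Oracle
∅ _ = false

-- Without oracle and coins, evaluation is ordinary deterministic computation.
AcceptsWithin : ℕ → Prog 2 → Tree → Tree → Set
AcceptsWithin t V q w =
  ∃[ l ] ∃[ r ] Σ (∅ ∣ q ∷ w ∷ [] ⊢ V , [] ⇓ l · r , []) λ d → time d ≤ t

InNP : Oracle → Set
InNP O =
  Σ (Prog 2) λ V → Σ (Poly 1) λ p → (q : Tree) →
    O q ≡ true ⇔
    (∃[ w ] size w ≤ p ⟨ size q ∷ [] ⟩ ×
            AcceptsWithin (p ⟨ size q ∷ [] ⟩) V q w)

encodeℕ : ℕ → Tree
encodeℕ zero    = leaf
encodeℕ (suc a) = leaf · encodeℕ a

encodeFin : ∀ {k} → Fin k → Tree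
encodeFin = encodeℕ ∘ toℕ

encodeFormula : ∀ {n m} → Formula n m → Tree
encodeFormula (X j)     = encodeℕ 0 · encodeFin j
encodeFormula (Y j)     = encodeℕ 1 · encodeFin j
encodeFormula (const b) = encodeℕ 2 · bit b
encodeFormula (neg F)   = encodeℕ 3 · encodeFormula F
encodeFormula (and F G) = encodeℕ 4 · (encodeFormula F · encodeFormula G)
encodeFormula (or F G)  = encodeℕ 5 · (encodeFormula F · encodeFormula G)

encodeGate : ∀ {k} → Gate k → Tree
encodeGate (const b) = encodeℕ 0 · bit b
encodeGate (neg a)   = encodeℕ 1 · encodeFin a
encodeGate (and a b) = encodeℕ 2 · (encodeFin a · encodeFin b)
encodeGate (or a b)  = encodeℕ 3 · (encodeFin a · encodeFin b)

-- Gates are never encoded by a leaf, so a leaf can mark the output.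
encodeCircuit : ∀ {k} → Circuit k → Tree
encodeCircuit (output j) = leaf · encodeFin j
encodeCircuit (gate g h) = encodeGate g · encodeCircuit h

input : ∀ {n m} → Formula n m → Fin m → Vec Tree 4
input {n} {m} F i =
  encodeℕ n ∷ encodeℕ m ∷ encodeFin i ∷ encodeFormula F ∷ []

-- On coin tosses ω the learner outputs a Skolem function for Y i, with at
-- most C oracle calls and in time at most T.
Succeeds : ∀ {n m} → Oracle → Prog 4 → Formula n m → Fin m →
           (C T : ℕ) → List Bool → Set
Succeeds {n} O L F i C T ω =
  Σ (CircuitFor n i) λ h → IsSkolemFunction F i h ×
  ∃ λ ω′ → Σ (O ∣ input F i ⊢ L , ω ⇓ encodeCircuit h , ω′) λ d →
    calls d ≤ C × time d ≤ T

count : ∀ {r} → (Vec Bool r → Bool) → ℕ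
count {zero}  E = if E [] then 1 else 0
count {suc r} E = count (E ∘ (false ∷_)) + count (E ∘ (true ∷_))

-- Pr[P] ≥ 1 − 1/N: P contains a decidable event E whose complement has
-- probability at most 1/N.
HoldsWithError1/ : ℕ → ∀ {r} → (Vec Bool r → Set) → Set
HoldsWithError1/ N {r} P =
  Σ (Vec Bool r → Bool) λ E →
    (∀ ω → E ω ≡ true → P ω) × count (not ∘ E) * N ≤ 2 ^ r

-- A run of time T tosses at most T coins, so sequences of length T suffice.
LearnsSkolemFunction : ∀ {n m} → Oracle → Prog 4 → Formula n m → Fin m →
                       (N C T : ℕ) → Set
LearnsSkolemFunction O L F i N C T =
  HoldsWithError1/ N {T} λ ω → Succeeds O L F i C T (toList ω)

{-# OPTIONS --safe #-}
-- The learner maintains examples and considers the set V of hypotheses (NOR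
-- programs given by bit strings) consistent with them.  An NP oracle finds, bit
-- by bit, the element of V whose image under a random affine map over GF(2) is
-- lexicographically largest.  By pairwise independence and the second moment
-- method, for every input on which only a small fraction of V is wrong, so is
-- this choice only with small probability; hence an OR of ANDs of B × B
-- independent choices is, with probability exponentially close to 1, right on
-- all such inputs at once.  If the oracle finds an input in F on which the OR of
-- ANDs is wrong, then a fixed fraction of V is wrong there, so that adding it as
-- an example shrinks V; if it finds none, the OR of ANDs is a Skolem function.
-- As V always contains the circuit promised to exist, few examples suffice once
-- the number of rows is large enough, and this number is increased level by
-- level until a Skolem function is found.

module Submission where

open import Defs
open import Data.Bool.Base using (Bool; true; false; not; _∧_; _∨_; _xor_; if_then_else_; T)
open import Data.Bool.Properties using (T-≡; ∧-identityʳ; ∨-identityʳ; ∨-comm; ∧-assoc; ∨-assoc; xor-identityʳ)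
open import Data.Empty using (⊥-elim)
open import Data.Fin.Base as Fin using (Fin; zero; suc; toℕ)
open import Data.Fin.Properties using (toℕ<n)
open import Data.List.Base as List using (List; []; _∷_; map; _++_; length)
open import Data.List.Membership.Propositional using (_∈_; lose)
open import Data.List.Membership.Propositional.Properties using (∈-map⁺; ∈-concatMap⁺; ∈-++⁺ˡ; ∈-++⁺ʳ)
open import Data.List.Relation.Unary.All as All using (All; []; _∷_)
open import Data.List.Relation.Unary.All.Properties using (tabulate⁺)
open import Data.List.Relation.Unary.Any using (here; there)
open import Data.Nat.Base hiding (equal; less; greater)
open import Data.Nat.GeneralisedArithmetic using (iterate)
open import Data.Nat.Properties
open import Data.Nat.Tactic.RingSolver using (solve-∀)
open import Data.Product.Base using (Σ; ∃; _×_; _,_; proj₁; proj₂)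
open import Data.Maybe.Base using (Maybe; just; nothing; maybe′)
open import Data.List.Properties using (length-++; length-map; length-reverse; reverse-involutive; ++-assoc; ʳ++-defn; length-replicate; length-drop; reverse-++; unfold-reverse; ++-identityʳ; ∷-injectiveˡ; ∷-injectiveʳ; map-tabulate; length-tabulate; drop-all)
open import Data.Unit.Base using (tt)
open import Function.Bundles using (Equivalence; mk⇔)
open import Data.Sum.Base using (_⊎_; inj₁; inj₂)
open import Data.Vec.Base as Vec using (Vec; []; _∷_; lookup; toList)
open import Data.Vec.Properties using (length-toList; lookup∘tabulate; tabulate∘lookup; tabulate-∘; take++drop≡id; lookup-map; toList-++)
open import Function.Base using (_∘_; id)
open import Relation.Binary.PropositionalEquality
open import Relation.Nullary using (¬_; yes; no)

-- The size of V is unknown, and with it the number of rows that a choice should be required to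
-- pass: too few let wrong hypotheses through, too many let nothing through. The lexicographic
-- maximum is good at all these scales at once, which spares an estimate of the size of V. The
-- oracle picks its refutation after the coins have been tossed, so the vote must be safe on all
-- 2^(k+1) labelled inputs of k bits together. A single choice is only known to err with probability
-- at most 1/(2B), too much for a union bound; the vote lowers this to 2^-B. With y rows, B = y²
-- outweighs k, the number of rounds and the error exponent c; the fraction 1/(d+1) with d + 1 = y⁵
-- ≥ 32B² separates light from heavy errors; and R = y⁸ is at least (d+1)(ℓ+1), the number of
-- shrinkings that would use up all 2^ℓ hypotheses. Every bit string is a program, so V starts as a
-- full cube. Correctness of the output involves no probability, as a circuit is output only when
-- the oracle has certified it. Luck is therefore needed only at the last level, which has its own
-- block of coins.

*-exchange : ∀ a b c → a * b * c ≡ a * c * b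
*-exchange = solve-∀

+-rotate : ∀ a b c → a + (b + c) ≡ b + a + c
+-rotate = solve-∀

-- Finite sums and uniform sample spaces

∑ : {A : Set} → List A → (A → ℕ) → ℕ
∑ []       f = 0
∑ (a ∷ as) f = f a + ∑ as f

χ : Bool → ℕ
χ b = if b then 1 else 0

χ≤1 : ∀ b → χ b ≤ 1
χ≤1 true  = ≤-refl
χ≤1 false = z≤n

χ-∧ : ∀ a b → χ (a ∧ b) ≡ χ a * χ b
χ-∧ true  b = sym (+-identityʳ (χ b))
χ-∧ false b = refl

χ-∨ : ∀ a b → χ (a ∨ b) ≤ χ a + χ b
χ-∨ true  b = m≤m+n 1 _
χ-∨ false b = ≤-refl

module _ {A : Set} where

  ∑-cong : ∀ as {f g : A → ℕ} → (∀ a → f a ≡ g a) → ∑ as f ≡ ∑ as g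
  ∑-cong []       e = refl
  ∑-cong (a ∷ as) e = cong₂ _+_ (e a) (∑-cong as e)

  ∑-mono : ∀ as {f g : A → ℕ} → (∀ a → f a ≤ g a) → ∑ as f ≤ ∑ as g
  ∑-mono []       e = z≤n
  ∑-mono (a ∷ as) e = +-mono-≤ (e a) (∑-mono as e)

  ∑-const : ∀ (as : List A) c → ∑ as (λ _ → c) ≡ length as * c
  ∑-const []       c = refl
  ∑-const (a ∷ as) c = cong (c +_) (∑-const as c)

  ∑-one : ∀ (as : List A) → ∑ as (λ _ → 1) ≡ length as
  ∑-one as = trans (∑-const as 1) (*-identityʳ (length as))

  ∑-+ : ∀ as (f g : A → ℕ) → ∑ as (λ a → f a + g a) ≡ ∑ as f + ∑ as g
  ∑-+ []       f g = refl
  ∑-+ (a ∷ as) f g = trans (cong (f a + g a +_) (∑-+ as f g)) (lemma (f a) (g a) _ _)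
    where
    lemma : ∀ x y u v → x + y + (u + v) ≡ x + u + (y + v)
    lemma = solve-∀

  ∑-*ˡ : ∀ as c (f : A → ℕ) → ∑ as (λ a → c * f a) ≡ c * ∑ as f
  ∑-*ˡ []       c f = sym (*-zeroʳ c)
  ∑-*ˡ (a ∷ as) c f = trans (cong (c * f a +_) (∑-*ˡ as c f)) (sym (*-distribˡ-+ c (f a) _))

  ∑-*ʳ : ∀ as c (f : A → ℕ) → ∑ as (λ a → f a * c) ≡ ∑ as f * c
  ∑-*ʳ []       c f = refl
  ∑-*ʳ (a ∷ as) c f = trans (cong (f a * c +_) (∑-*ʳ as c f)) (sym (*-distribʳ-+ c (f a) _))

  ∑-++ : ∀ as bs (f : A → ℕ) → ∑ (as ++ bs) f ≡ ∑ as f + ∑ bs f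
  ∑-++ []       bs f = refl
  ∑-++ (a ∷ as) bs f = trans (cong (f a +_) (∑-++ as bs f)) (sym (+-assoc (f a) _ _))

  ∑-member : ∀ {as} (f : A → ℕ) {a} → a ∈ as → f a ≤ ∑ as f
  ∑-member {b ∷ as} f (here refl) = m≤m+n (f b) _
  ∑-member {b ∷ as} f (there i)   = ≤-trans (∑-member f i) (m≤n+m _ (f b))

  ∑-positive : ∀ as (f : A → ℕ) → 1 ≤ ∑ as f → ∃ λ a → 1 ≤ f a
  ∑-positive (a ∷ as) f p with f a in eq
  ... | suc _ = a , subst (1 ≤_) (sym eq) (s≤s z≤n)
  ... | zero  = ∑-positive as f p

module _ {A B : Set} where

  ∑-map : ∀ as (g : A → B) f → ∑ (map g as) f ≡ ∑ as (f ∘ g)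
  ∑-map []       g f = refl
  ∑-map (a ∷ as) g f = cong (f (g a) +_) (∑-map as g f)

  ∑-concatMap : ∀ as (g : A → List B) f → ∑ (List.concatMap g as) f ≡ ∑ as (λ a → ∑ (g a) f)
  ∑-concatMap []       g f = refl
  ∑-concatMap (a ∷ as) g f = trans (∑-++ (g a) _ f) (cong (∑ (g a) f +_) (∑-concatMap as g f))

  ∑-swap : ∀ (as : List A) (bs : List B) (f : A → B → ℕ) →
    ∑ as (λ a → ∑ bs (f a)) ≡ ∑ bs (λ b → ∑ as (λ a → f a b))
  ∑-swap []       bs f = sym (trans (∑-const bs 0) (*-zeroʳ (length bs)))
  ∑-swap (a ∷ as) bs f = trans (cong (∑ bs (f a) +_) (∑-swap as bs f)) (sym (∑-+ bs (f a) _))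

-- The sample space of n independent uniform draws from `as`. Probabilities appear with denominators
-- cleared: a bound K / w on an event says that the number of its outcomes times w is at most K
-- times the length of the space.
vecs : {A : Set} → List A → ∀ n → List (Vec A n)
vecs as zero    = [] ∷ []
vecs as (suc n) = List.concatMap (λ a → map (a ∷_) (vecs as n)) as

bools : List Bool
bools = false ∷ true ∷ []

cube : ∀ n → List (Vec Bool n)
cube = vecs bools

module _ {A : Set} (as : List A) where

  ∑-vecs : ∀ n (f : Vec A (suc n) → ℕ) →
    ∑ (vecs as (suc n)) f ≡ ∑ as (λ a → ∑ (vecs as n) (λ v → f (a ∷ v)))
  ∑-vecs n f = trans (∑-concatMap as _ f) (∑-cong as λ a → ∑-map (vecs as n) (a ∷_) f)

  -- Independence of the first draw from the later ones.
  ∑-vecs-* : ∀ n (f : A → ℕ) (g : Vec A n → ℕ) →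
    ∑ (vecs as (suc n)) (λ v → f (Vec.head v) * g (Vec.tail v)) ≡ ∑ as f * ∑ (vecs as n) g
  ∑-vecs-* n f g = trans (∑-vecs n _)
    (trans (∑-cong as λ a → ∑-*ˡ (vecs as n) (f a) g) (∑-*ʳ as (∑ (vecs as n) g) f))

  length-vecs : ∀ n → length (vecs as n) ≡ length as ^ n
  length-vecs zero    = refl
  length-vecs (suc n) = begin
    length (vecs as (suc n))          ≡⟨ ∑-one (vecs as (suc n)) ⟨
    ∑ (vecs as (suc n)) (λ _ → 1)     ≡⟨ ∑-vecs n _ ⟩
    ∑ as (λ _ → ∑ (vecs as n) (λ _ → 1)) ≡⟨ ∑-const as _ ⟩
    length as * ∑ (vecs as n) (λ _ → 1)  ≡⟨ cong (length as *_) (trans (∑-one (vecs as n)) (length-vecs n)) ⟩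
    length as * length as ^ n         ∎
    where open ≡-Reasoning

count-cube : ∀ {r} (E : Vec Bool r → Bool) → count E ≡ ∑ (cube r) (χ ∘ E)
count-cube {zero}  E = sym (+-identityʳ _)
count-cube {suc r} E = trans (cong₂ _+_ (count-cube (E ∘ (false ∷_))) (count-cube (E ∘ (true ∷_))))
  (trans (cong (∑ (cube r) (χ ∘ E ∘ (false ∷_)) +_) (sym (+-identityʳ _))) (sym (∑-vecs bools r (χ ∘ E))))

-- Pairwise independence of the random linear functions C ↦ ⟨row, (true, C)⟩.

dot : ∀ {n} → Vec Bool n → Vec Bool n → Bool
dot []       []       = false
dot (a ∷ as) (b ∷ bs) = (a ∧ b) xor dot as bs

-- The leading `true` turns the first bit of the row into a random offset. Without it the hash of
-- the zero string would be constant.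
pass₁ : ∀ {ℓ} → Vec Bool ℓ → Vec Bool (suc ℓ) → Bool
pass₁ C row = dot row (true ∷ C)

same : Bool → Bool → Bool
same a b = not (a xor b)

sameᵛ : ∀ {n} → Vec Bool n → Vec Bool n → Bool
sameᵛ []       []       = true
sameᵛ (a ∷ as) (b ∷ bs) = same a b ∧ sameᵛ as bs

same-refl : ∀ a → same a a ≡ true
same-refl false = refl
same-refl true  = refl

same-sound : ∀ a b → same a b ≡ true → a ≡ b
same-sound false false e = refl
same-sound true  true  e = refl

∑-sameᵛ : ∀ {n} (C : Vec Bool n) → ∑ (cube n) (χ ∘ sameᵛ C) ≡ 1
∑-sameᵛ []              = refl
∑-sameᵛ {suc n} (c ∷ C) = trans (∑-vecs bools n _) (lemma c)
  where
  zero-sum : ∑ (cube n) (λ _ → 0) ≡ 0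
  zero-sum = trans (∑-const (cube n) 0) (*-zeroʳ (length (cube n)))
  lemma : ∀ c → ∑ bools (λ a → ∑ (cube n) (λ v → χ (same c a ∧ sameᵛ C v))) ≡ 1
  lemma false = trans (cong (∑ (cube n) (χ ∘ sameᵛ C) +_) (cong (_+ 0) zero-sum))
    (trans (+-identityʳ _) (∑-sameᵛ C))
  lemma true = trans (cong₂ (λ u w → u + (w + 0)) zero-sum (∑-sameᵛ C)) refl

length-cube : ∀ n → length (cube n) ≡ 2 ^ n
length-cube = length-vecs bools

-- For every linear part of the row, exactly one of the two offsets lets `C` pass.
pass₁-half : ∀ {ℓ} (C : Vec Bool ℓ) → ∑ (cube (suc ℓ)) (χ ∘ pass₁ C) * 2 ≡ 2 ^ suc ℓ
pass₁-half {ℓ} C = begin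
  ∑ (cube (suc ℓ)) (χ ∘ pass₁ C) * 2           ≡⟨ cong (_* 2) (∑-vecs bools ℓ _) ⟩
  (∑ (cube ℓ) (λ a → χ (dot a C)) + (∑ (cube ℓ) (λ a → χ (not (dot a C))) + 0)) * 2
    ≡⟨ cong (λ u → (∑ (cube ℓ) (λ a → χ (dot a C)) + u) * 2) (+-identityʳ _) ⟩
  (∑ (cube ℓ) (λ a → χ (dot a C)) + ∑ (cube ℓ) (λ a → χ (not (dot a C)))) * 2
    ≡⟨ cong (_* 2) (∑-+ (cube ℓ) _ _) ⟨
  ∑ (cube ℓ) (λ a → χ (dot a C) + χ (not (dot a C))) * 2
    ≡⟨ cong (_* 2) (∑-cong (cube ℓ) λ a → χ+χ (dot a C)) ⟩
  ∑ (cube ℓ) (λ _ → 1) * 2  ≡⟨ cong (_* 2) (∑-one (cube ℓ)) ⟩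
  length (cube ℓ) * 2       ≡⟨ cong (_* 2) (length-cube ℓ) ⟩
  2 ^ ℓ * 2                 ≡⟨ *-comm (2 ^ ℓ) 2 ⟩
  2 ^ suc ℓ                 ∎
  where
  open ≡-Reasoning
  χ+χ : ∀ b → χ b + χ (not b) ≡ 1
  χ+χ true  = refl
  χ+χ false = refl

-- The bit of the row at a position where the strings differ decides whether the two products agree.
-- Equal leading bits do not affect the comparison, whatever the row bit is (`equal`); at the first
-- difference the two values of the row bit give complementary outcomes (`differ`).
agree-half : ∀ {ℓ} (C C′ : Vec Bool ℓ) → sameᵛ C C′ ≡ false →
  ∑ (cube ℓ) (λ a → χ (same (dot a C) (dot a C′))) * 2 ≡ 2 ^ ℓ
agree-half {zero}  []      []        ()
agree-half {suc ℓ} (c ∷ C) (c′ ∷ C′) ne = trans (cong (_* 2) (∑-vecs bools ℓ _)) (split c c′ ne)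
  where
  open ≡-Reasoning
  f : Bool → Vec Bool ℓ → ℕ
  f b a = χ (same (b xor dot a C) (b xor dot a C′))
  g : Bool → Bool → Vec Bool ℓ → ℕ
  g b b′ a = χ (same (b xor dot a C) (b′ xor dot a C′))
  flipped : ∀ a b → χ (same a b) ≡ χ (same (not a) (not b))
  flipped false false = refl
  flipped false true  = refl
  flipped true  false = refl
  flipped true  true  = refl
  opposite : ∀ a b → χ (same a b) + χ (same (not a) b) ≡ 1
  opposite false false = refl
  opposite false true  = refl
  opposite true  false = refl
  opposite true  true  = refl
  oppositeʳ : ∀ a b → χ (same a b) + χ (same a (not b)) ≡ 1
  oppositeʳ false false = refl
  oppositeʳ false true  = refl
  oppositeʳ true  false = refl
  oppositeʳ true  true  = refl
  equal : ∀ (h : Vec Bool ℓ → ℕ) → (∀ a → g false false a ≡ h a) → sameᵛ C C′ ≡ false →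
    (∑ (cube ℓ) (g false false) + (∑ (cube ℓ) h + 0)) * 2 ≡ 2 ^ suc ℓ
  equal h e ne = begin
    (∑ (cube ℓ) (g false false) + (∑ (cube ℓ) h + 0)) * 2
      ≡⟨ cong (λ u → (∑ (cube ℓ) (g false false) + (u + 0)) * 2) (∑-cong (cube ℓ) e) ⟨
    (∑ (cube ℓ) (g false false) + (∑ (cube ℓ) (g false false) + 0)) * 2
      ≡⟨ double (∑ (cube ℓ) (g false false)) ⟩
    2 * (∑ (cube ℓ) (g false false) * 2) ≡⟨ cong (2 *_) (agree-half C C′ ne) ⟩
    2 ^ suc ℓ ∎
    where
    double : ∀ u → (u + (u + 0)) * 2 ≡ 2 * (u * 2)
    double = solve-∀
  differ : ∀ (h : Vec Bool ℓ → ℕ) → (∀ a → g false false a + h a ≡ 1) →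
    (∑ (cube ℓ) (g false false) + (∑ (cube ℓ) h + 0)) * 2 ≡ 2 ^ suc ℓ
  differ h e = begin
    (∑ (cube ℓ) (g false false) + (∑ (cube ℓ) h + 0)) * 2
      ≡⟨ cong (λ u → (∑ (cube ℓ) (g false false) + u) * 2) (+-identityʳ _) ⟩
    (∑ (cube ℓ) (g false false) + ∑ (cube ℓ) h) * 2
      ≡⟨ cong (_* 2) (∑-+ (cube ℓ) _ _) ⟨
    ∑ (cube ℓ) (λ a → g false false a + h a) * 2 ≡⟨ cong (_* 2) (∑-cong (cube ℓ) e) ⟩
    ∑ (cube ℓ) (λ _ → 1) * 2  ≡⟨ cong (_* 2) (∑-one (cube ℓ)) ⟩
    length (cube ℓ) * 2       ≡⟨ cong (_* 2) (length-cube ℓ) ⟩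
    2 ^ ℓ * 2                 ≡⟨ *-comm (2 ^ ℓ) 2 ⟩
    2 ^ suc ℓ ∎
  split : ∀ c c′ → same c c′ ∧ sameᵛ C C′ ≡ false →
    (∑ (cube ℓ) (g false false) + (∑ (cube ℓ) (g c c′) + 0)) * 2 ≡ 2 ^ suc ℓ
  split false false ne = equal _ (λ a → refl) ne
  split true  true  ne = equal _ (λ a → flipped (dot a C) (dot a C′)) ne
  split false true  ne = differ _ (λ a → oppositeʳ (dot a C) (dot a C′))
  split true  false ne = differ _ (λ a → opposite (dot a C) (dot a C′))

-- If the linear parts of the two hashes agree, exactly one offset lets both strings pass; if they
-- disagree, none does. Half of the linear parts times half of the offsets makes a quarter.
pass₁-pair : ∀ {ℓ} (C C′ : Vec Bool ℓ) → sameᵛ C C′ ≡ false →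
  ∑ (cube (suc ℓ)) (λ r → χ (pass₁ C r) * χ (pass₁ C′ r)) * 4 ≡ 2 ^ suc ℓ
pass₁-pair {ℓ} C C′ ne = begin
  ∑ (cube (suc ℓ)) (λ r → χ (pass₁ C r) * χ (pass₁ C′ r)) * 4  ≡⟨ cong (_* 4) (∑-vecs bools ℓ _) ⟩
  (∑ (cube ℓ) p + (∑ (cube ℓ) q + 0)) * 4   ≡⟨ cong (λ u → (∑ (cube ℓ) p + u) * 4) (+-identityʳ _) ⟩
  (∑ (cube ℓ) p + ∑ (cube ℓ) q) * 4         ≡⟨ cong (_* 4) (∑-+ (cube ℓ) p q) ⟨
  ∑ (cube ℓ) (λ a → p a + q a) * 4          ≡⟨ cong (_* 4) (∑-cong (cube ℓ) λ a → both (dot a C) (dot a C′)) ⟩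
  ∑ (cube ℓ) (λ a → χ (same (dot a C) (dot a C′))) * 4  ≡⟨ quad (∑ (cube ℓ) (λ a → χ (same (dot a C) (dot a C′)))) ⟩
  2 * (∑ (cube ℓ) (λ a → χ (same (dot a C) (dot a C′))) * 2) ≡⟨ cong (2 *_) (agree-half C C′ ne) ⟩
  2 ^ suc ℓ ∎
  where
  open ≡-Reasoning
  p q : Vec Bool ℓ → ℕ
  p a = χ (dot a C) * χ (dot a C′)
  q a = χ (not (dot a C)) * χ (not (dot a C′))
  both : ∀ a b → χ a * χ b + χ (not a) * χ (not b) ≡ χ (same a b)
  both false false = refl
  both false true  = refl
  both true  false = refl
  both true  true  = refl
  quad : ∀ u → u * 4 ≡ 2 * (u * 2)
  quad = solve-∀

passes : ∀ {ℓ n} → ℕ → Vec Bool ℓ → Vec (Vec Bool (suc ℓ)) n → Bool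
passes zero    C rows       = true
passes (suc k) C []         = true
passes (suc k) C (r ∷ rows) = pass₁ C r ∧ passes k C rows

module _ {ℓ : ℕ} where

  private
    rows : List (Vec Bool (suc ℓ))
    rows = cube (suc ℓ)
    W : ℕ → ℕ
    W n = length (vecs rows n)
    W-suc : ∀ n → W (suc n) ≡ 2 ^ suc ℓ * W n
    W-suc n = trans (length-vecs rows (suc n))
      (cong₂ _*_ (length-cube (suc ℓ)) (sym (length-vecs rows n)))

  passes-once : ∀ {n} k → k ≤ n → (C : Vec Bool ℓ) →
    ∑ (vecs rows n) (χ ∘ passes k C) * 2 ^ k ≡ W n
  passes-once {n} zero _ C =
    trans (*-identityʳ _) (∑-one (vecs rows n))
  passes-once {suc n} (suc k) (s≤s k≤n) C = begin
    ∑ (vecs rows (suc n)) (χ ∘ passes (suc k) C) * 2 ^ suc k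
      ≡⟨ cong (_* 2 ^ suc k) (trans (∑-cong (vecs rows (suc n)) λ { (r ∷ rs) → χ-∧ (pass₁ C r) _ })
           (∑-vecs-* rows n (χ ∘ pass₁ C) (χ ∘ passes k C))) ⟩
    (∑ rows (χ ∘ pass₁ C) * ∑ (vecs rows n) (χ ∘ passes k C)) * (2 * 2 ^ k)
      ≡⟨ [m*n]*[o*p]≡[m*o]*[n*p] (∑ rows (χ ∘ pass₁ C)) _ 2 (2 ^ k) ⟩
    (∑ rows (χ ∘ pass₁ C) * 2) * (∑ (vecs rows n) (χ ∘ passes k C) * 2 ^ k)
      ≡⟨ cong₂ _*_ (pass₁-half C) (passes-once k k≤n C) ⟩
    2 ^ suc ℓ * W n ≡⟨ W-suc n ⟨
    W (suc n) ∎
    where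
    open ≡-Reasoning

  passes-twice : ∀ {n} k → k ≤ n → (C C′ : Vec Bool ℓ) → sameᵛ C C′ ≡ false →
    ∑ (vecs rows n) (λ r → χ (passes k C r) * χ (passes k C′ r)) * (2 ^ k * 2 ^ k) ≡ W n
  passes-twice {n} zero _ C C′ ne =
    trans (*-identityʳ _) (∑-one (vecs rows n))
  passes-twice {suc n} (suc k) (s≤s k≤n) C C′ ne = begin
    ∑ (vecs rows (suc n)) (λ r → χ (passes (suc k) C r) * χ (passes (suc k) C′ r)) * (2 ^ suc k * 2 ^ suc k)
      ≡⟨ cong (_* (2 ^ suc k * 2 ^ suc k)) (trans (∑-cong (vecs rows (suc n)) factor)
           (∑-vecs-* rows n (λ r → χ (pass₁ C r) * χ (pass₁ C′ r)) (λ r → χ (passes k C r) * χ (passes k C′ r)))) ⟩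
    (P * Q) * (2 * 2 ^ k * (2 * 2 ^ k)) ≡⟨ regroup P Q (2 ^ k) ⟩
    (P * 4) * (Q * (2 ^ k * 2 ^ k)) ≡⟨ cong₂ _*_ (pass₁-pair C C′ ne) (passes-twice k k≤n C C′ ne) ⟩
    2 ^ suc ℓ * W n ≡⟨ W-suc n ⟨
    W (suc n) ∎
    where
    open ≡-Reasoning
    P = ∑ rows (λ r → χ (pass₁ C r) * χ (pass₁ C′ r))
    Q = ∑ (vecs rows n) (λ r → χ (passes k C r) * χ (passes k C′ r))
    regroup : ∀ a b d → a * b * (2 * d * (2 * d)) ≡ a * 4 * (b * (d * d))
    regroup = solve-∀
    factor : ∀ r → χ (passes (suc k) C r) * χ (passes (suc k) C′ r) ≡
      χ (pass₁ C (Vec.head r)) * χ (pass₁ C′ (Vec.head r)) *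
      (χ (passes k C (Vec.tail r)) * χ (passes k C′ (Vec.tail r)))
    factor (r ∷ rs) = trans (cong₂ _*_ (χ-∧ (pass₁ C r) _) (χ-∧ (pass₁ C′ r) _))
      ([m*n]*[o*p]≡[m*o]*[n*p] (χ (pass₁ C r)) _ _ _)

-- The second moment method

private
  2ab≤a²+b² : ∀ a b → 2 * (a * b) ≤ a * a + b * b
  2ab≤a²+b² a b with ≤-total a b
  ... | inj₁ a≤b = subst (λ b → 2 * (a * b) ≤ a * a + b * b) (m+[n∸m]≡n a≤b) (lemma a (b ∸ a))
    where
    expand : ∀ a d → 2 * (a * (a + d)) + d * d ≡ a * a + (a + d) * (a + d)
    expand = solve-∀
    lemma : ∀ a d → 2 * (a * (a + d)) ≤ a * a + (a + d) * (a + d)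
    lemma a d = subst (2 * (a * (a + d)) ≤_) (expand a d) (m≤m+n _ (d * d))
  ... | inj₂ b≤a = subst (λ a → 2 * (a * b) ≤ a * a + b * b) (m+[n∸m]≡n b≤a) (lemma b (a ∸ b))
    where
    expand : ∀ b d → 2 * ((b + d) * b) + d * d ≡ (b + d) * (b + d) + b * b
    expand = solve-∀
    lemma : ∀ b d → 2 * ((b + d) * b) ≤ (b + d) * (b + d) + b * b
    lemma b d = subst (2 * ((b + d) * b) ≤_) (expand b d) (m≤m+n _ (d * d))

∑-product : {A B : Set} (as : List A) (bs : List B) (f : A → ℕ) (g : B → ℕ) →
  ∑ as f * ∑ bs g ≡ ∑ as (λ a → ∑ bs (λ b → f a * g b))
∑-product as bs f g = trans (sym (∑-*ʳ as (∑ bs g) f)) (∑-cong as λ a → sym (∑-*ˡ bs (f a) g))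

isZero : ℕ → Bool
isZero zero    = true
isZero (suc _) = false

module SecondMoment {ℓ n k : ℕ} (k≤n : k ≤ n) (v : Vec Bool ℓ → Bool) where

  κ : ℕ
  κ = 2 ^ k

  matrices : List (Vec (Vec Bool (suc ℓ)) n)
  matrices = vecs (cube (suc ℓ)) n

  W N : ℕ
  W = length matrices
  N = ∑ (cube ℓ) (χ ∘ v)

  hit : Vec Bool ℓ → Vec (Vec Bool (suc ℓ)) n → ℕ
  hit C ω = χ (v C) * χ (passes k C ω)

  hits : Vec (Vec Bool (suc ℓ)) n → ℕ
  hits ω = ∑ (cube ℓ) (λ C → hit C ω)

  -- Linearity of expectation: each string passes `k` rows with probability 1 / κ.
  weighted-once : (u : Vec Bool ℓ → Bool) →
    ∑ matrices (λ ω → ∑ (cube ℓ) (λ C → χ (u C) * χ (passes k C ω))) * κ ≡ W * ∑ (cube ℓ) (χ ∘ u)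
  weighted-once u = begin
    ∑ matrices (λ ω → ∑ (cube ℓ) (λ C → χ (u C) * χ (passes k C ω))) * κ
      ≡⟨ cong (_* κ) (∑-swap matrices (cube ℓ) _) ⟩
    ∑ (cube ℓ) (λ C → ∑ matrices (λ ω → χ (u C) * χ (passes k C ω))) * κ
      ≡⟨ ∑-*ʳ (cube ℓ) κ _ ⟨
    ∑ (cube ℓ) (λ C → ∑ matrices (λ ω → χ (u C) * χ (passes k C ω)) * κ)
      ≡⟨ ∑-cong (cube ℓ) (λ C → trans (cong (_* κ) (∑-*ˡ matrices (χ (u C)) _))
           (trans (*-assoc (χ (u C)) _ κ) (trans (cong (χ (u C) *_) (passes-once k k≤n C)) (*-comm (χ (u C)) W)))) ⟩
    ∑ (cube ℓ) (λ C → W * χ (u C)) ≡⟨ ∑-*ˡ (cube ℓ) W _ ⟩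
    W * ∑ (cube ℓ) (χ ∘ u) ∎
    where open ≡-Reasoning

  -- Distinct strings pass independently. On the diagonal the square of an indicator is the
  -- indicator itself, which costs a factor κ.
  pair : ∀ C C′ → ∑ matrices (λ ω → χ (passes k C ω) * χ (passes k C′ ω)) * (κ * κ)
                  ≤ W + W * κ * χ (sameᵛ C C′)
  pair C C′ with sameᵛ C C′ in eq
  ... | false = ≤-trans (≤-reflexive (passes-twice k k≤n C C′ eq)) (m≤m+n W _)
  ... | true  = begin
    ∑ matrices (λ ω → χ (passes k C ω) * χ (passes k C′ ω)) * (κ * κ)
      ≤⟨ *-monoˡ-≤ (κ * κ) (∑-mono matrices λ ω →
           ≤-trans (*-monoʳ-≤ (χ (passes k C ω)) (χ≤1 (passes k C′ ω))) (≤-reflexive (*-identityʳ _))) ⟩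
    ∑ matrices (χ ∘ passes k C) * (κ * κ) ≡⟨ *-assoc (∑ matrices (χ ∘ passes k C)) κ κ ⟨
    ∑ matrices (χ ∘ passes k C) * κ * κ   ≡⟨ cong (_* κ) (passes-once k k≤n C) ⟩
    W * κ                                 ≡⟨ *-identityʳ _ ⟨
    W * κ * 1                             ≤⟨ m≤n+m _ W ⟩
    W + W * κ * 1                         ∎
    where open ≤-Reasoning

  second-moment : ∑ matrices (λ ω → hits ω * hits ω) * (κ * κ) ≤ W * (N * N) + W * κ * N
  second-moment = begin
    ∑ matrices (λ ω → hits ω * hits ω) * (κ * κ)
      ≡⟨ cong (_* (κ * κ)) (trans (∑-cong matrices λ ω → ∑-product (cube ℓ) (cube ℓ) _ _)
           (trans (∑-swap matrices (cube ℓ) _) (∑-cong (cube ℓ) λ C → ∑-swap matrices (cube ℓ) _))) ⟩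
    ∑ (cube ℓ) (λ C → ∑ (cube ℓ) (λ C′ → ∑ matrices (λ ω → hit C ω * hit C′ ω))) * (κ * κ)
      ≡⟨ trans (sym (∑-*ʳ (cube ℓ) (κ * κ) _)) (∑-cong (cube ℓ) λ C → sym (∑-*ʳ (cube ℓ) (κ * κ) _)) ⟩
    ∑ (cube ℓ) (λ C → ∑ (cube ℓ) (λ C′ → ∑ matrices (λ ω → hit C ω * hit C′ ω) * (κ * κ)))
      ≤⟨ ∑-mono (cube ℓ) (λ C → ∑-mono (cube ℓ) (entry C)) ⟩
    ∑ (cube ℓ) (λ C → ∑ (cube ℓ) (λ C′ → W * (χ (v C) * χ (v C′)) + W * κ * χ (v C) * χ (sameᵛ C C′)))
      ≡⟨ ∑-cong (cube ℓ) (λ C → ∑-+ (cube ℓ) _ _) ⟩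
    ∑ (cube ℓ) (λ C → ∑ (cube ℓ) (λ C′ → W * (χ (v C) * χ (v C′))) + ∑ (cube ℓ) (λ C′ → W * κ * χ (v C) * χ (sameᵛ C C′)))
      ≡⟨ ∑-+ (cube ℓ) _ _ ⟩
    ∑ (cube ℓ) (λ C → ∑ (cube ℓ) (λ C′ → W * (χ (v C) * χ (v C′)))) + ∑ (cube ℓ) (λ C → ∑ (cube ℓ) (λ C′ → W * κ * χ (v C) * χ (sameᵛ C C′)))
      ≡⟨ cong₂ _+_
           (trans (∑-cong (cube ℓ) λ C → ∑-*ˡ (cube ℓ) W _)
             (trans (∑-*ˡ (cube ℓ) W _) (cong (W *_) (sym (∑-product (cube ℓ) (cube ℓ) _ _)))))
           (trans (∑-cong (cube ℓ) λ C → trans (∑-*ˡ (cube ℓ) (W * κ * χ (v C)) _)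
               (trans (cong (W * κ * χ (v C) *_) (∑-sameᵛ C)) (*-identityʳ _)))
             (∑-*ˡ (cube ℓ) (W * κ) _)) ⟩
    W * (N * N) + W * κ * N ∎
    where
    open ≤-Reasoning
    entry : ∀ C C′ → ∑ matrices (λ ω → hit C ω * hit C′ ω) * (κ * κ) ≤
      W * (χ (v C) * χ (v C′)) + W * κ * χ (v C) * χ (sameᵛ C C′)
    entry C C′ = begin
      ∑ matrices (λ ω → hit C ω * hit C′ ω) * (κ * κ)
        ≡⟨ cong (_* (κ * κ)) (trans (∑-cong matrices λ ω → [m*n]*[o*p]≡[m*o]*[n*p] (χ (v C)) (χ (passes k C ω)) _ _)
             (∑-*ˡ matrices (χ (v C) * χ (v C′)) _)) ⟩
      χ (v C) * χ (v C′) * ∑ matrices (λ ω → χ (passes k C ω) * χ (passes k C′ ω)) * (κ * κ)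
        ≡⟨ *-assoc (χ (v C) * χ (v C′)) _ (κ * κ) ⟩
      χ (v C) * χ (v C′) * (∑ matrices (λ ω → χ (passes k C ω) * χ (passes k C′ ω)) * (κ * κ))
        ≤⟨ *-monoʳ-≤ (χ (v C) * χ (v C′)) (pair C C′) ⟩
      χ (v C) * χ (v C′) * (W + W * κ * χ (sameᵛ C C′))
        ≡⟨ expand (χ (v C)) (χ (v C′)) W κ (χ (sameᵛ C C′)) ⟩
      W * (χ (v C) * χ (v C′)) + χ (v C′) * (W * κ * χ (v C) * χ (sameᵛ C C′))
        ≤⟨ +-monoʳ-≤ _ (≤-trans (*-monoˡ-≤ _ (χ≤1 (v C′))) (≤-reflexive (+-identityʳ _))) ⟩
      W * (χ (v C) * χ (v C′)) + W * κ * χ (v C) * χ (sameᵛ C C′) ∎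
      where
      expand : ∀ a b W κ s → a * b * (W + W * κ * s) ≡ W * (a * b) + b * (W * κ * a * s)
      expand = solve-∀

  -- Chebyshev's inequality: `hits` has mean N / κ and variance at most N / κ, so it vanishes with
  -- probability at most κ / N. Subtraction is avoided by summing 2Nκh ≤ (κh)² + N², where an
  -- outcome with h = 0 has N² to spare.
  empty-bound : ∑ matrices (λ ω → χ (isZero (hits ω))) * N ≤ W * κ
  empty-bound = cancel N (∑ matrices (λ ω → χ (isZero (hits ω)))) refl (+-cancelʳ-≤ (2 * (W * (N * N))) _ _ (begin
    N * N * ∑ matrices (λ ω → χ (isZero (hits ω))) + 2 * (W * (N * N))
      ≡⟨ cong (λ u → N * N * ∑ matrices (λ ω → χ (isZero (hits ω))) + u)
           (trans (first W N) (cong (λ u → 2 * N * u) (sym (weighted-once v)))) ⟩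
    N * N * ∑ matrices (λ ω → χ (isZero (hits ω))) + 2 * N * (∑ matrices hits * κ)
      ≡⟨ cong₂ _+_ (sym (∑-*ˡ matrices (N * N) _)) (trans (second N (∑ matrices hits) κ) (sym (∑-*ˡ matrices (2 * N * κ) hits))) ⟩
    ∑ matrices (λ ω → N * N * χ (isZero (hits ω))) + ∑ matrices (λ ω → 2 * N * κ * hits ω)
      ≡⟨ ∑-+ matrices _ _ ⟨
    ∑ matrices (λ ω → N * N * χ (isZero (hits ω)) + 2 * N * κ * hits ω)
      ≤⟨ ∑-mono matrices (λ ω → pointwise (hits ω)) ⟩
    ∑ matrices (λ ω → hits ω * hits ω * (κ * κ) + N * N)
      ≡⟨ ∑-+ matrices _ _ ⟩
    ∑ matrices (λ ω → hits ω * hits ω * (κ * κ)) + ∑ matrices (λ _ → N * N)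
      ≡⟨ cong₂ _+_ (∑-*ʳ matrices (κ * κ) _) (∑-const matrices (N * N)) ⟩
    ∑ matrices (λ ω → hits ω * hits ω) * (κ * κ) + W * (N * N)
      ≤⟨ +-monoˡ-≤ (W * (N * N)) second-moment ⟩
    W * (N * N) + W * κ * N + W * (N * N) ≡⟨ third W N κ ⟩
    W * κ * N + 2 * (W * (N * N)) ∎))
    where
    open ≤-Reasoning
    first : ∀ W N → 2 * (W * (N * N)) ≡ 2 * N * (W * N)
    first = solve-∀
    second : ∀ N h κ → 2 * N * (h * κ) ≡ 2 * N * κ * h
    second = solve-∀
    third : ∀ W N κ → W * (N * N) + W * κ * N + W * (N * N) ≡ W * κ * N + 2 * (W * (N * N))
    third = solve-∀
    square : ∀ h κ → κ * h * (κ * h) ≡ h * h * (κ * κ)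
    square = solve-∀
    product : ∀ N κ h → 2 * N * κ * h ≡ 2 * (κ * h * N)
    product = solve-∀
    zeros : ∀ N κ → N * N * 1 + 2 * N * κ * 0 ≡ N * N
    zeros = solve-∀
    pointwise : ∀ h → N * N * χ (isZero h) + 2 * N * κ * h ≤ h * h * (κ * κ) + N * N
    pointwise zero    = ≤-reflexive (zeros N κ)
    pointwise h@(suc _) = begin
      N * N * 0 + 2 * N * κ * h ≡⟨ cong (_+ 2 * N * κ * h) (*-zeroʳ (N * N)) ⟩
      2 * N * κ * h             ≡⟨ product N κ h ⟩
      2 * (κ * h * N)           ≤⟨ 2ab≤a²+b² (κ * h) N ⟩
      κ * h * (κ * h) + N * N   ≡⟨ cong (_+ N * N) (square h κ) ⟩
      h * h * (κ * κ) + N * N   ∎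
    cancel : ∀ M e → M ≡ N → M * M * e ≤ W * κ * M → e * M ≤ W * κ
    cancel zero    e _ _ = ≤-trans (≤-reflexive (*-zeroʳ e)) z≤n
    cancel (suc M) e _ p = *-cancelʳ-≤ (e * suc M) (W * κ) (suc M) (≤-trans (≤-reflexive (shape (suc M) e)) p)
      where
      shape : ∀ M e → e * M * M ≡ M * M * e
      shape = solve-∀

-- Errors of a selected hypothesis

vecs-complete : {A : Set} {as : List A} → (∀ a → a ∈ as) → ∀ {n} (v : Vec A n) → v ∈ vecs as n
vecs-complete all []      = here refl
vecs-complete {as = as} all {suc n} (a ∷ v) = ∈-concatMap⁺ (λ a → map (a ∷_) (vecs as n)) (lose (all a) (∈-map⁺ (a ∷_) (vecs-complete all v)))

bools-complete : ∀ b → b ∈ bools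
bools-complete false = here refl
bools-complete true  = there (here refl)

-- A selection rule that prefers many leading passed rows errs rarely: it
-- only errs if no element of v passes the first k rows, or an element of u does.
module Selection {ℓ n : ℕ} (v : Vec Bool ℓ → Bool) (u : Vec Bool ℓ → Bool)
  (pick : Vec (Vec Bool (suc ℓ)) n → Vec Bool ℓ)
  (prefers : ∀ k ω C → k ≤ n → v C ≡ true → passes k C ω ≡ true →
     v (pick ω) ≡ true × passes k (pick ω) ω ≡ true) where

  module _ {k : ℕ} (k≤n : k ≤ n) where
    open SecondMoment k≤n v

    private
      light : Vec Bool ℓ → Bool
      light C = v C ∧ u C

    -- Once some element of `v` passes `k` rows, `prefers` makes the picked one pass them as well;
    -- if the picked one errs, it is itself a term of the second sum.
    mistakes : ∑ matrices (χ ∘ u ∘ pick) ≤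
      ∑ matrices (λ ω → χ (isZero (hits ω))) +
      ∑ matrices (λ ω → ∑ (cube ℓ) (λ C → χ (light C) * χ (passes k C ω)))
    mistakes = ≤-trans (∑-mono matrices pointwise) (≤-reflexive (∑-+ matrices _ _))
      where
      χ-positive : ∀ {b} → 1 ≤ χ b → b ≡ true
      χ-positive {true} _ = refl
      pointwise : ∀ ω → χ (u (pick ω)) ≤
        χ (isZero (hits ω)) + ∑ (cube ℓ) (λ C → χ (light C) * χ (passes k C ω))
      pointwise ω with hits ω in eq
      ... | zero  = ≤-trans (χ≤1 (u (pick ω))) (s≤s z≤n)
      ... | suc _ with ∑-positive (cube ℓ) (λ C → hit C ω) (subst (1 ≤_) (sym eq) (s≤s z≤n))
      ... | C , h = ≤-trans (≤-reflexive (sym term)) (∑-member _ (vecs-complete bools-complete (pick ω)))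
        where
        good : v (pick ω) ≡ true × passes k (pick ω) ω ≡ true
        good = prefers k ω C k≤n
          (χ-positive (m*n≢0⇒m>0 (χ (v C)) _ h)) (χ-positive (m*n≢0⇒n>0 (χ (v C)) _ h))
          where
          m*n≢0⇒m>0 : ∀ a b → 1 ≤ a * b → 1 ≤ a
          m*n≢0⇒m>0 (suc a) b _ = s≤s z≤n
          m*n≢0⇒n>0 : ∀ a b → 1 ≤ a * b → 1 ≤ b
          m*n≢0⇒n>0 a (suc b) _ = s≤s z≤n
          m*n≢0⇒n>0 a zero h rewrite *-zeroʳ a = h
        term : χ (light (pick ω)) * χ (passes k (pick ω) ω) ≡ χ (u (pick ω))
        term rewrite proj₁ good | proj₂ good = *-identityʳ _

    -- The scale k is chosen such that the expected number of elements of v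
    -- passing k rows is about B.
    rarely : ∀ {B} → 4 * B * κ ≤ N → ∑ (cube ℓ) (χ ∘ light) * (4 * B) ≤ κ →
      ∑ matrices (χ ∘ u ∘ pick) * (2 * B) ≤ W
    rarely {B} big small = *-cancelʳ-≤ _ W (2 * κ) ⦃ >-nonZero (*-mono-≤ {1} {2} (s≤s z≤n) (m^n>0 2 k)) ⦄ (begin
      ∑ matrices (χ ∘ u ∘ pick) * (2 * B) * (2 * κ)
        ≤⟨ *-monoˡ-≤ (2 * κ) (*-monoˡ-≤ (2 * B) mistakes) ⟩
      -- Either source of error is granted probability 1 / (4B): `E` by Chebyshev's inequality, `Q`
      -- by the expected number of erring elements that pass.
      (E + Q) * (2 * B) * (2 * κ) ≡⟨ distribute E Q B κ ⟩
      E * (4 * B * κ) + Q * κ * (4 * B)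
        ≤⟨ +-mono-≤ (≤-trans (*-monoʳ-≤ E big) empty-bound) (begin
             Q * κ * (4 * B) ≡⟨ cong (_* (4 * B)) (weighted-once light) ⟩
             W * ∑ (cube ℓ) (χ ∘ light) * (4 * B) ≡⟨ *-assoc W _ (4 * B) ⟩
             W * (∑ (cube ℓ) (χ ∘ light) * (4 * B)) ≤⟨ *-monoʳ-≤ W small ⟩
             W * κ ∎) ⟩
      W * κ + W * κ ≡⟨ double W κ ⟩
      W * (2 * κ) ∎)
      where
      open ≤-Reasoning
      E Q : ℕ
      E = ∑ matrices (λ ω → χ (isZero (hits ω)))
      Q = ∑ matrices (λ ω → ∑ (cube ℓ) (λ C → χ (light C) * χ (passes k C ω)))
      distribute : ∀ E Q B κ → (E + Q) * (2 * B) * (2 * κ) ≡ E * (4 * B * κ) + Q * κ * (4 * B)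
      distribute = solve-∀
      double : ∀ W κ → W * κ + W * κ ≡ W * (2 * κ)
      double = solve-∀

  -- Zero rows suffice for this: every element of `v` passes them, so the pick lies in `v`, where
  -- nothing errs. It covers the version spaces that are too small for the second moment.
  never : 1 ≤ ∑ (cube ℓ) (χ ∘ v) → ∑ (cube ℓ) (λ C → χ (v C ∧ u C)) ≡ 0 →
    ∀ ω → u (pick ω) ≡ false
  never nonempty none ω with u (pick ω) in eq
  ... | false = refl
  ... | true  with ∑-positive (cube ℓ) (χ ∘ v) nonempty
  ... | C , h = ⊥-elim (contradict (subst (1 ≤_) none (≤-trans (≤-reflexive (sym (term (v C) refl h)))
          (∑-member (λ C → χ (v C ∧ u C)) (vecs-complete bools-complete (pick ω))))))
    where
    contradict : ¬ (1 ≤ 0)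
    contradict ()
    term : ∀ b → v C ≡ b → 1 ≤ χ b → χ (v (pick ω) ∧ u (pick ω)) ≡ 1
    term true vC _ rewrite proj₁ (prefers 0 ω C z≤n vC refl) | eq = refl

  scale : ∀ b N n → b ≤ N → N < b * 2 ^ suc n →
    ∃ λ k → k ≤ n × b * 2 ^ k ≤ N × N < b * 2 ^ suc k
  scale b N zero    b≤N N< = 0 , z≤n , ≤-trans (≤-reflexive (*-identityʳ b)) b≤N , N<
  scale b N (suc n) b≤N N< with b * 2 ^ suc n ≤? N
  ... | yes le = suc n , ≤-refl , le , N<
  ... | no ¬le with scale b N n b≤N (≰⇒> ¬le)
  ... | k , k≤n , le , lt = k , m≤n⇒m≤1+n k≤n , le , lt

  -- The scale k satisfies 4B 2^k ≤ |V| < 8B 2^k, and ℓ ≤ n provides the rows for it. As at most |V|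
  -- / (32B²) elements err, at most 8B / (32B²) = 1 / (4B) of them are expected to pass k rows; this
  -- is the origin of the constant 32. If |V| < 4B, the assumed fraction leaves room for no erring
  -- element at all.
  errs-rarely : ∀ {B} → 1 ≤ B → ℓ ≤ n → 1 ≤ ∑ (cube ℓ) (χ ∘ v) →
    ∑ (cube ℓ) (λ C → χ (v C ∧ u C)) * (32 * (B * B)) ≤ ∑ (cube ℓ) (χ ∘ v) →
    ∑ (vecs (cube (suc ℓ)) n) (χ ∘ u ∘ pick) * (2 * B) ≤ length (vecs (cube (suc ℓ)) n)
  errs-rarely {B} 1≤B ℓ≤n nonempty light with 4 * B ≤? ∑ (cube ℓ) (χ ∘ v)
  ... | yes big with scale (4 * B) _ n big bound
    where
    open ≤-Reasoning
    bound : ∑ (cube ℓ) (χ ∘ v) < 4 * B * 2 ^ suc n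
    bound = begin-strict
      ∑ (cube ℓ) (χ ∘ v) ≤⟨ ∑-mono (cube ℓ) (λ C → χ≤1 (v C)) ⟩
      ∑ (cube ℓ) (λ _ → 1) ≡⟨ trans (∑-one (cube ℓ)) (length-cube ℓ) ⟩
      2 ^ ℓ ≤⟨ ^-monoʳ-≤ 2 ℓ≤n ⟩
      2 ^ n <⟨ ^-monoʳ-< 2 (s≤s (s≤s z≤n)) (n<1+n n) ⟩
      2 ^ suc n ≡⟨ +-identityʳ _ ⟨
      1 * 2 ^ suc n ≤⟨ *-monoˡ-≤ (2 ^ suc n) (*-mono-≤ {1} {4} (s≤s z≤n) 1≤B) ⟩
      4 * B * 2 ^ suc n ∎
  ... | k , k≤n , le , lt = rarely k≤n {B} le (*-cancelʳ-≤ _ (2 ^ k) (8 * B) ⦃ >-nonZero (*-mono-≤ {1} {8} (s≤s z≤n) 1≤B) ⦄ (begin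
    U * (4 * B) * (8 * B) ≡⟨ regroup U B ⟩
    U * (32 * (B * B))    ≤⟨ light ⟩
    ∑ (cube ℓ) (χ ∘ v)    ≤⟨ <⇒≤ lt ⟩
    4 * B * (2 * 2 ^ k)   ≡⟨ regroup′ B (2 ^ k) ⟩
    2 ^ k * (8 * B) ∎))
    where
    open ≤-Reasoning
    U = ∑ (cube ℓ) (λ C → χ (v C ∧ u C))
    regroup : ∀ U B → U * (4 * B) * (8 * B) ≡ U * (32 * (B * B))
    regroup = solve-∀
    regroup′ : ∀ B κ → 4 * B * (2 * κ) ≡ κ * (8 * B)
    regroup′ = solve-∀
  errs-rarely {B} 1≤B ℓ≤n nonempty light | no small =
    ≤-trans (≤-reflexive (cong (_* (2 * B)) (trans (∑-cong (vecs (cube (suc ℓ)) n) λ ω → cong χ (never nonempty none ω)) zeros))) z≤n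
    where
    zeros : ∑ (vecs (cube (suc ℓ)) n) (λ _ → 0) ≡ 0
    zeros = trans (∑-const (vecs (cube (suc ℓ)) n) 0) (*-zeroʳ (length (vecs (cube (suc ℓ)) n)))
    none : ∑ (cube ℓ) (λ C → χ (v C ∧ u C)) ≡ 0
    none with ∑ (cube ℓ) (λ C → χ (v C ∧ u C))
    ... | zero  = refl
    ... | suc U = ⊥-elim (small (≤-trans (begin
      4 * B               ≤⟨ *-mono-≤ {4} {32} (s≤s (s≤s (s≤s (s≤s z≤n)))) (≤-trans (≤-reflexive (sym (*-identityʳ B))) (*-monoʳ-≤ B 1≤B)) ⟩
      32 * (B * B)        ≤⟨ m≤m+n _ (U * (32 * (B * B))) ⟩
      suc U * (32 * (B * B)) ∎) light))
      where open ≤-Reasoning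

-- Adaptive union bounds and amplification by a vote

module _ {A S : Set} (next : S → A → S) (bad : S → A → Bool) where

  trouble : ∀ {r} → S → Vec A r → Bool
  trouble s []       = false
  trouble s (a ∷ as) = bad s a ∨ trouble (next s a) as

  -- The state of a round depends on the earlier draws, but `each` holds for all states. So every
  -- round contributes at most K / w, whatever has happened before.
  ∑-trouble : ∀ (as : List A) K w → (∀ s → ∑ as (χ ∘ bad s) * w ≤ K * length as) →
    ∀ r s → ∑ (vecs as r) (χ ∘ trouble s) * w ≤ r * K * length (vecs as r)
  ∑-trouble as K w each zero    s = z≤n
  ∑-trouble as K w each (suc r) s = begin
    ∑ (vecs as (suc r)) (χ ∘ trouble s) * w ≡⟨ cong (_* w) (∑-vecs as r _) ⟩
    ∑ as (λ a → ∑ (vecs as r) (λ v → χ (bad s a ∨ trouble (next s a) v))) * w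
      ≤⟨ *-monoˡ-≤ w (∑-mono as λ a → ∑-mono (vecs as r) λ v → χ-∨ (bad s a) _) ⟩
    ∑ as (λ a → ∑ (vecs as r) (λ v → χ (bad s a) + χ (trouble (next s a) v))) * w
      ≡⟨ cong (_* w) (trans (∑-cong as λ a → trans (∑-+ (vecs as r) (λ _ → χ (bad s a)) _)
           (cong (_+ ∑ (vecs as r) (χ ∘ trouble (next s a))) (trans (∑-const (vecs as r) (χ (bad s a))) (*-comm V _)))) (∑-+ as _ _)) ⟩
    (∑ as (λ a → χ (bad s a) * V) + ∑ as (λ a → ∑ (vecs as r) (χ ∘ trouble (next s a)))) * w
      ≡⟨ *-distribʳ-+ w (∑ as (λ a → χ (bad s a) * V)) _ ⟩
    ∑ as (λ a → χ (bad s a) * V) * w + ∑ as (λ a → ∑ (vecs as r) (χ ∘ trouble (next s a))) * w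
      ≡⟨ cong₂ _+_ (trans (cong (_* w) (∑-*ʳ as V _)) (*-exchange (∑ as (χ ∘ bad s)) V w)) (sym (∑-*ʳ as w _)) ⟩
    ∑ as (χ ∘ bad s) * w * V + ∑ as (λ a → ∑ (vecs as r) (χ ∘ trouble (next s a)) * w)
      ≤⟨ +-mono-≤ (*-monoˡ-≤ V (each s)) (∑-mono as λ a → ∑-trouble as K w each r (next s a)) ⟩
    K * length as * V + ∑ as (λ _ → r * K * V) ≡⟨ cong (K * length as * V +_) (∑-const as _) ⟩
    K * length as * V + length as * (r * K * V) ≡⟨ collect K (length as) V r ⟩
    suc r * K * (length as * V) ≡⟨ cong (suc r * K *_) V-suc ⟨
    suc r * K * length (vecs as (suc r)) ∎
    where
    open ≤-Reasoning
    V = length (vecs as r)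
    V-suc : length (vecs as (suc r)) ≡ length as * V
    V-suc = trans (length-vecs as (suc r)) (cong (length as *_) (sym (length-vecs as r)))
    collect : ∀ K a V r → K * a * V + a * (r * K * V) ≡ (1 + r) * K * (a * V)
    collect = solve-∀

anyV allV : ∀ {A : Set} {n} → (A → Bool) → Vec A n → Bool
anyV p = trouble (λ _ _ → tt) (λ _ → p) tt
allV p []       = true
allV p (a ∷ as) = p a ∧ allV p as

∑-allV : ∀ {A : Set} (as : List A) (p : A → Bool) w → ∑ as (χ ∘ p) * w ≤ length as →
  ∀ n → ∑ (vecs as n) (χ ∘ allV p) * w ^ n ≤ length (vecs as n)
∑-allV as p w each zero    = ≤-refl
∑-allV as p w each (suc n) = begin
  ∑ (vecs as (suc n)) (χ ∘ allV p) * w ^ suc n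
    ≡⟨ cong (_* w ^ suc n) (trans (∑-cong (vecs as (suc n)) λ { (a ∷ v) → χ-∧ (p a) _ })
         (∑-vecs-* as n (χ ∘ p) (χ ∘ allV p))) ⟩
  ∑ as (χ ∘ p) * ∑ (vecs as n) (χ ∘ allV p) * (w * w ^ n) ≡⟨ [m*n]*[o*p]≡[m*o]*[n*p] (∑ as (χ ∘ p)) _ w (w ^ n) ⟩
  ∑ as (χ ∘ p) * w * (∑ (vecs as n) (χ ∘ allV p) * w ^ n) ≤⟨ *-mono-≤ each (∑-allV as p w each n) ⟩
  length as * length (vecs as n)
    ≡⟨ trans (length-vecs as (suc n)) (cong (length as *_) (sym (length-vecs as n))) ⟨
  length (vecs as (suc n)) ∎
  where
  open ≤-Reasoning

orAnd : ∀ {A : Set} {a b} → (A → Bool) → Vec (Vec A b) a → Bool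
orAnd p = anyV (allV p)

not-allV : ∀ {A : Set} {n} (p : A → Bool) (v : Vec A n) → not (allV p v) ≡ anyV (not ∘ p) v
not-allV p []      = refl
not-allV p (a ∷ v) with p a
... | true  = not-allV p v
... | false = refl

not-orAnd : ∀ {A : Set} {a b} (p : A → Bool) (v : Vec (Vec A b) a) →
  not (orAnd p v) ≡ allV (anyV (not ∘ p)) v
not-orAnd p []      = refl
not-orAnd p (g ∷ v) with not-allV p g
... | e with allV p g
... | true  = cong (_∧ _) e
... | false = trans (not-orAnd p v) (cong (_∧ _) e)

^-distribʳ-* : ∀ n a b → (a * b) ^ n ≡ a ^ n * b ^ n
^-distribʳ-* zero    a b = refl
^-distribʳ-* (suc n) a b = trans (cong (a * b *_) (^-distribʳ-* n a b)) ([m*n]*[o*p]≡[m*o]*[n*p] a b (a ^ n) (b ^ n))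

n≤2^n : ∀ n → n ≤ 2 ^ n
n≤2^n zero    = z≤n
n≤2^n (suc n) = begin
  suc n             ≤⟨ +-mono-≤ (m^n>0 2 n) (n≤2^n n) ⟩
  2 ^ n + 2 ^ n     ≡⟨ cong (2 ^ n +_) (+-identityʳ _) ⟨
  2 ^ suc n         ∎
  where open ≤-Reasoning

-- If the right value is true, an AND of B choices fails with probability at most B / (2B) = 1/2,
-- and all B of the ANDs have to fail. If it is false, an AND is wrong only if all its members are,
-- with probability (2B)^-B, and a union bound over the ANDs costs a factor B ≤ B^B. Either way 2^-B
-- remains.
∑-orAnd : ∀ {A : Set} (as : List A) (p : A → Bool) v {B} → 1 ≤ B →
  ∑ as (λ a → χ (p a xor v)) * (2 * B) ≤ length as →
  ∑ (vecs (vecs as B) B) (λ g → χ (orAnd p g xor v)) * 2 ^ B ≤ length (vecs (vecs as B) B)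
∑-orAnd as p true {B} 1≤B each = begin
  ∑ (vecs (vecs as B) B) (λ g → χ (orAnd p g xor true)) * 2 ^ B
    ≡⟨ cong (_* 2 ^ B) (∑-cong (vecs (vecs as B) B) λ g → cong χ (trans (xor-true _) (not-orAnd p g))) ⟩
  ∑ (vecs (vecs as B) B) (χ ∘ allV (anyV (not ∘ p))) * 2 ^ B
    ≤⟨ ∑-allV (vecs as B) (anyV (not ∘ p)) 2 group B ⟩
  length (vecs (vecs as B) B) ∎
  where
  open ≤-Reasoning
  xor-true : ∀ b → b xor true ≡ not b
  xor-true true  = refl
  xor-true false = refl
  instance
    B≢0 : NonZero B
    B≢0 = >-nonZero 1≤B
  group : ∑ (vecs as B) (χ ∘ anyV (not ∘ p)) * 2 ≤ length (vecs as B)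
  group = *-cancelʳ-≤ _ _ B (begin
    ∑ (vecs as B) (χ ∘ anyV (not ∘ p)) * 2 * B   ≡⟨ *-assoc (∑ (vecs as B) (χ ∘ anyV (not ∘ p))) 2 B ⟩
    ∑ (vecs as B) (χ ∘ anyV (not ∘ p)) * (2 * B)
      ≤⟨ ∑-trouble _ _ as 1 (2 * B) (λ _ → ≤-trans (≤-reflexive (cong (_* (2 * B))
           (∑-cong as λ a → cong χ (sym (xor-true (p a))))))
           (≤-trans each (≤-reflexive (sym (*-identityˡ (length as)))))) B tt ⟩
    B * 1 * length (vecs as B) ≡⟨ trans (cong (_* length (vecs as B)) (*-identityʳ B)) (*-comm B (length (vecs as B))) ⟩
    length (vecs as B) * B ∎)
∑-orAnd as p false {B} 1≤B each = *-cancelʳ-≤ _ _ B ⦃ >-nonZero 1≤B ⦄ (begin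
  ∑ (vecs (vecs as B) B) (λ g → χ (orAnd p g xor false)) * 2 ^ B * B
    ≡⟨ trans (*-assoc (∑ (vecs (vecs as B) B) (λ g → χ (orAnd p g xor false))) (2 ^ B) B)
         (cong (_* (2 ^ B * B)) (∑-cong (vecs (vecs as B) B) λ g → cong χ (xor-false _))) ⟩
  ∑ (vecs (vecs as B) B) (χ ∘ orAnd p) * (2 ^ B * B)
    ≤⟨ *-monoʳ-≤ (∑ (vecs (vecs as B) B) (χ ∘ orAnd p)) (begin
         2 ^ B * B     ≤⟨ *-monoʳ-≤ (2 ^ B) (power B 1≤B) ⟩
         2 ^ B * B ^ B ≡⟨ ^-distribʳ-* B 2 B ⟨
         (2 * B) ^ B   ∎) ⟩
  ∑ (vecs (vecs as B) B) (χ ∘ orAnd p) * (2 * B) ^ B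
    ≤⟨ ∑-trouble _ _ (vecs as B) 1 ((2 * B) ^ B) (λ _ →
         ≤-trans (∑-allV as p (2 * B) (≤-trans (≤-reflexive (cong (_* (2 * B)) (∑-cong as λ a → cong χ (sym (xor-false (p a)))))) each) B)
           (≤-reflexive (sym (*-identityˡ (length (vecs as B)))))) B tt ⟩
  B * 1 * length (vecs (vecs as B) B)
    ≡⟨ trans (cong (_* length (vecs (vecs as B) B)) (*-identityʳ B)) (*-comm B (length (vecs (vecs as B) B))) ⟩
  length (vecs (vecs as B) B) * B ∎)
  where
  open ≤-Reasoning
  xor-false : ∀ b → b xor false ≡ b
  xor-false true  = refl
  xor-false false = refl
  power : ∀ b → 1 ≤ b → b ≤ b ^ b
  power (suc b) _ = ≤-trans (≤-reflexive (sym (*-identityʳ (suc b)))) (*-monoʳ-≤ (suc b) (m^n>0 (suc b) b))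

anyL : {A : Set} → (A → Bool) → List A → Bool
anyL p []       = false
anyL p (a ∷ as) = p a ∨ anyL p as

anyL-false : ∀ {A : Set} (p : A → Bool) {as a} → a ∈ as → anyL p as ≡ false → p a ≡ false
anyL-false p {b ∷ as} (here refl) e with p b
... | false = refl
anyL-false p {b ∷ as} (there i)   e with p b
... | false = anyL-false p i e

∑-anyL : ∀ {A Z : Set} (as : List A) (p : Z → A → Bool) w V → (∀ z → ∑ as (χ ∘ p z) * w ≤ V) →
  ∀ zs → ∑ as (λ a → χ (anyL (λ z → p z a) zs)) * w ≤ length zs * V
∑-anyL as p w V each []       =
  ≤-trans (≤-reflexive (cong (_* w) (trans (∑-const as 0) (*-zeroʳ (length as))))) z≤n
∑-anyL as p w V each (z ∷ zs) = begin
  ∑ as (λ a → χ (p z a ∨ anyL (λ z → p z a) zs)) * w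
    ≤⟨ *-monoˡ-≤ w (∑-mono as λ a → χ-∨ (p z a) _) ⟩
  ∑ as (λ a → χ (p z a) + χ (anyL (λ z → p z a) zs)) * w
    ≡⟨ trans (cong (_* w) (∑-+ as _ _)) (*-distribʳ-+ w (∑ as (χ ∘ p z)) _) ⟩
  ∑ as (χ ∘ p z) * w + ∑ as (λ a → χ (anyL (λ z → p z a) zs)) * w
    ≤⟨ +-mono-≤ (each z) (∑-anyL as p w V each zs) ⟩
  V + length zs * V ∎
  where open ≤-Reasoning

-- These are the first two terms of the binomial expansion. Multiplying by a + 1 yields the next
-- pair and a surplus.
bernoulli : ∀ a n → a ^ suc n + suc n * a ^ n ≤ suc a ^ suc n
bernoulli a zero    = ≤-reflexive (lemma a)
  where
  lemma : ∀ a → a * 1 + 1 ≡ (1 + a) * 1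
  lemma = solve-∀
bernoulli a (suc n) = begin
  a * a ^ suc n + suc (suc n) * a ^ suc n
    ≤⟨ m≤m+n _ (suc n * a ^ n) ⟩
  a * a ^ suc n + suc (suc n) * (a * a ^ n) + suc n * a ^ n
    ≡⟨ lemma a (a ^ n) n ⟩
  suc a * (a ^ suc n + suc n * a ^ n) ≤⟨ *-monoʳ-≤ (suc a) (bernoulli a n) ⟩
  suc a ^ suc (suc n) ∎
  where
  open ≤-Reasoning
  lemma : ∀ a p n → a * (a * p) + (2 + n) * (a * p) + (1 + n) * p ≡ (1 + a) * (a * p + (1 + n) * p)
  lemma = solve-∀

-- This is (1 + 1/d)^(d+1) ≥ 2, a case of Bernoulli's inequality.
halving : ∀ d → 2 * d ^ suc d ≤ suc d ^ suc d
halving d = ≤-trans (≤-trans (≤-reflexive (cong (d ^ suc d +_) (+-identityʳ _)))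
  (+-monoʳ-≤ (d ^ suc d) (*-monoˡ-≤ (d ^ d) (n≤1+n d)))) (bernoulli d d)

-- Every d + 1 factors d / (d+1) amount to a halving. ℓ + 1 halvings bring 2^ℓ below 1, and the
-- remaining `e` factors do no harm.
decay : ∀ d ℓ {R} → 1 ≤ d → suc d * suc ℓ ≤ R → 2 ^ ℓ * d ^ R < suc d ^ R
decay d ℓ {R} 1≤d le = begin-strict
  2 ^ ℓ * d ^ R <⟨ *-monoˡ-< (d ^ R) ⦃ m^n≢0 d R ⦃ >-nonZero 1≤d ⦄ ⦄ (^-monoʳ-< 2 (s≤s (s≤s z≤n)) (n<1+n ℓ)) ⟩
  2 ^ suc ℓ * d ^ R ≡⟨ cong (λ r → 2 ^ suc ℓ * d ^ r) (m+[n∸m]≡n le) ⟨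
  2 ^ suc ℓ * d ^ (suc d * suc ℓ + e) ≡⟨ cong (2 ^ suc ℓ *_) (^-distribˡ-+-* d (suc d * suc ℓ) e) ⟩
  2 ^ suc ℓ * (d ^ (suc d * suc ℓ) * d ^ e) ≡⟨ cong (λ u → 2 ^ suc ℓ * (u * d ^ e)) (^-*-assoc d (suc d) (suc ℓ)) ⟨
  2 ^ suc ℓ * ((d ^ suc d) ^ suc ℓ * d ^ e) ≡⟨ *-assoc (2 ^ suc ℓ) _ _ ⟨
  2 ^ suc ℓ * (d ^ suc d) ^ suc ℓ * d ^ e ≡⟨ cong (_* d ^ e) (^-distribʳ-* (suc ℓ) 2 (d ^ suc d)) ⟨
  (2 * d ^ suc d) ^ suc ℓ * d ^ e ≤⟨ *-mono-≤ (^-monoˡ-≤ (suc ℓ) (halving d)) (^-monoˡ-≤ e (n≤1+n d)) ⟩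
  (suc d ^ suc d) ^ suc ℓ * suc d ^ e ≡⟨ cong (_* suc d ^ e) (^-*-assoc (suc d) (suc d) (suc ℓ)) ⟩
  suc d ^ (suc d * suc ℓ) * suc d ^ e ≡⟨ ^-distribˡ-+-* (suc d) (suc d * suc ℓ) e ⟨
  suc d ^ (suc d * suc ℓ + e) ≡⟨ cong (suc d ^_) (m+[n∸m]≡n le) ⟩
  suc d ^ R ∎
  where
  open ≤-Reasoning
  e = R ∸ suc d * suc ℓ

agrees : ∀ {H Z : Set} → (H → Z → Bool) → List (Z × Bool) → H → Bool
agrees ev []            C = true
agrees ev ((z , v) ∷ S) C = agrees ev S C ∧ same (ev C z) v

-- The learner abstractly: `pick` chooses a hypothesis consistent with the
-- examples, and `step` refutes the vote of B × B choices by an example.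
module Learning {ℓ k n d B : ℕ} (limit : ℕ)
  (ev : Vec Bool ℓ → Vec Bool k → Bool)
  (pick : List (Vec Bool k × Bool) → Vec (Vec Bool (suc ℓ)) n → Vec Bool ℓ)
  (step : List (Vec Bool k × Bool) → Vec (Vec (Vec (Vec Bool (suc ℓ)) n) B) B → Maybe (Vec Bool k × Bool)) where

  Example = Vec Bool k × Bool
  Matrix = Vec (Vec Bool (suc ℓ)) n

  consistent : List Example → Vec Bool ℓ → Bool
  consistent = agrees ev

  next : List Example → Vec (Vec Matrix B) B → List Example
  next S c = maybe′ (_∷ S) S (step S c)

  vote : List Example → Vec (Vec Matrix B) B → Vec Bool k → Bool
  vote S c z = orAnd (λ ω → ev (pick S ω) z) c

  versions : List Example → ℕ
  versions S = ∑ (cube ℓ) (χ ∘ consistent S)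

  errors : List Example → Example → ℕ
  errors S (z , v) = ∑ (cube ℓ) (λ C → χ (consistent S C ∧ (ev C z xor v)))

  -- The three guards are the conditions under which a wrong vote is improbable: few examples, some
  -- consistent hypothesis, and only a light share of these wrong on the input. If the first two
  -- hold and the vote is wrong without being misled, a heavy share is wrong.
  misled : List Example → Example → Vec (Vec Matrix B) B → Bool
  misled S (z , v) c =
    (length S ≤ᵇ limit) ∧ (1 ≤ᵇ versions S) ∧ (errors S (z , v) * suc d ≤ᵇ versions S) ∧ (vote S c z xor v)

  -- All 2^(k+1) labelled inputs. The union bound ranges over them because the refutation may depend
  -- on the coins in any way.
  examples : List Example
  examples = map (_, false) (cube k) ++ map (_, true) (cube k)

  bad : List Example → Vec (Vec Matrix B) B → Bool
  bad S c = anyL (λ e → misled S e c) examples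

  found : ∀ {r} → List Example → Vec (Vec (Vec Matrix B) B) r → Bool
  found S []       = false
  found S (c ∷ cs) with step S c
  ... | nothing = true
  ... | just e  = found (e ∷ S) cs

  choices : List (Vec (Vec Matrix B) B)
  choices = vecs (vecs (vecs (cube (suc ℓ)) n) B) B

  found-just : ∀ {r} S c {e} (cs : Vec (Vec (Vec Matrix B) B) r) → step S c ≡ just e →
    found S (c ∷ cs) ≡ found (e ∷ S) cs
  found-just S c cs eq with step S c
  found-just S c cs refl | just e = refl

  module _ (C₀ : Vec Bool ℓ)
    (refutes : ∀ S c z v → step S c ≡ just (z , v) → vote S c z xor v ≡ true × ev C₀ z ≡ v) where

    nonempty : ∀ S → consistent S C₀ ≡ true → 1 ≤ versions S
    nonempty S ok₀ = ≤-trans (≤-reflexive (cong χ (sym ok₀)))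
      (∑-member (χ ∘ consistent S) (vecs-complete bools-complete C₀))

    -- As the coins are not bad, at least a fraction 1 / (d+1) of the consistent hypotheses is wrong
    -- on the refuting example, and adding it removes them.
    shrinks : ∀ S c z v → length S ≤ limit → consistent S C₀ ≡ true → bad S c ≡ false → vote S c z xor v ≡ true →
      versions ((z , v) ∷ S) * suc d ≤ versions S * d
    shrinks S c z v short ok₀ good wrong = +-cancelʳ-≤ (versions S) _ _ (begin
      versions ((z , v) ∷ S) * suc d + versions S
        ≤⟨ +-monoʳ-≤ (versions ((z , v) ∷ S) * suc d) heavy ⟩
      versions ((z , v) ∷ S) * suc d + errors S (z , v) * suc d
        ≡⟨ *-distribʳ-+ (suc d) (versions ((z , v) ∷ S)) _ ⟨
      (versions ((z , v) ∷ S) + errors S (z , v)) * suc d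
        ≡⟨ cong (_* suc d) (trans (sym (∑-+ (cube ℓ) _ _))
             (∑-cong (cube ℓ) λ C → split (consistent S C) (ev C z xor v))) ⟩
      versions S * suc d ≡⟨ trans (*-suc (versions S) d) (+-comm (versions S) _) ⟩
      versions S * d + versions S ∎)
      where
      open ≤-Reasoning
      split : ∀ a b → χ (a ∧ not b) + χ (a ∧ b) ≡ χ a
      split true  true  = refl
      split true  false = refl
      split false b     = refl
      listed : ∀ v → (z , v) ∈ examples
      listed false = ∈-++⁺ˡ (∈-map⁺ (_, false) (vecs-complete bools-complete z))
      listed true  = ∈-++⁺ʳ (map (_, false) (cube k)) (∈-map⁺ (_, true) (vecs-complete bools-complete z))
      heavy : versions S ≤ errors S (z , v) * suc d
      ≤ᵇ-true : ∀ {a b} → a ≤ b → (a ≤ᵇ b) ≡ true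
      ≤ᵇ-true le = Equivalence.to T-≡ (≤⇒≤ᵇ le)
      heavy with ≤-total (versions S) (errors S (z , v) * suc d)
      ... | inj₁ le = le
      ... | inj₂ ge = ⊥-elim (clash
        (trans (sym (cong₂ _∧_ (≤ᵇ-true short) (cong₂ _∧_ (≤ᵇ-true (nonempty S ok₀)) (cong₂ _∧_ (≤ᵇ-true ge) wrong))))
          (anyL-false (λ e → misled S e c) (listed v) good)))
        where
        clash : true ≢ false
        clash ()

    -- The last hypothesis is a potential: r further shrinkings by d / (d+1) would leave less than
    -- one hypothesis. Each refutation preserves it, while `C₀` stays consistent, so it is absurd
    -- once r = 0. Hence some round before that finds no refutation.
    finds : ∀ {r} (cs : Vec (Vec (Vec Matrix B) B) r) S → length S + r ≤ limit → consistent S C₀ ≡ true →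
      trouble next bad S cs ≡ false → versions S * d ^ r < suc d ^ r → found S cs ≡ true
    finds []       S short ok₀ ok lt = ⊥-elim (<⇒≱ lt (*-monoˡ-≤ 1 (nonempty S ok₀)))
    finds {suc r} (c ∷ cs) S short ok₀ ok lt with step S c in eq
    ... | nothing = refl
    ... | just (z , v) with bad S c in good
    ... | false = finds cs ((z , v) ∷ S) (≤-trans (≤-reflexive (sym (+-suc _ r))) short)
          (cong₂ _∧_ ok₀ (trans (cong (λ u → same u v) (proj₂ (refutes S c z v eq))) (same-refl v)))
          ok (*-cancelʳ-< _ _ _ (begin-strict
      versions ((z , v) ∷ S) * d ^ r * suc d   ≡⟨ *-exchange (versions ((z , v) ∷ S)) (d ^ r) (suc d) ⟩
      versions ((z , v) ∷ S) * suc d * d ^ r   ≤⟨ *-monoˡ-≤ (d ^ r) (shrinks S c z v (≤-trans (m≤m+n _ (suc r)) short) ok₀ good (proj₁ (refutes S c z v eq))) ⟩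
      versions S * d * d ^ r                   ≡⟨ *-assoc (versions S) d (d ^ r) ⟩
      versions S * d ^ suc r                   <⟨ lt ⟩
      suc d * suc d ^ r                        ≡⟨ *-comm (suc d) (suc d ^ r) ⟩
      suc d ^ r * suc d                        ∎))
      where
      open ≤-Reasoning

  module _ (prefers : ∀ S j ω C → length S ≤ limit → j ≤ n → consistent S C ≡ true → passes j C ω ≡ true →
              consistent S (pick S ω) ≡ true × passes j (pick S ω) ω ≡ true)
    (1≤B : 1 ≤ B) (ℓ≤n : ℓ ≤ n) (D-large : 32 * (B * B) ≤ suc d) where

    never-misled : ∑ choices (λ _ → 0) * 2 ^ B ≤ length choices
    never-misled = ≤-trans (≤-reflexive (cong (_* 2 ^ B)
      (trans (∑-const choices 0) (*-zeroʳ (length choices))))) z≤n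

    rarely-misled : ∀ S e → ∑ choices (χ ∘ misled S e) * 2 ^ B ≤ length choices
    rarely-misled S (z , v) with length S ≤ᵇ limit in short
    ... | false = never-misled
    ... | true with 1 ≤ᵇ versions S in some
    ... | false = never-misled
    ... | true with errors S (z , v) * suc d ≤ᵇ versions S in light
    ... | false = never-misled
    ... | true = ∑-orAnd (vecs (cube (suc ℓ)) n) (λ ω → ev (pick S ω) z) v 1≤B
      (Selection.errs-rarely (consistent S) (λ C → ev C z xor v) (pick S)
        (λ j ω C → prefers S j ω C (≤ᵇ⇒≤ _ limit (Equivalence.from T-≡ short))) 1≤B ℓ≤n
        (≤ᵇ⇒≤ 1 _ (Equivalence.from T-≡ some))
        (≤-trans (*-monoʳ-≤ (errors S (z , v)) D-large) (≤ᵇ⇒≤ _ _ (Equivalence.from T-≡ light))))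

    -- Two nested union bounds: over the labelled inputs within a round, and over the rounds, whose
    -- examples depend on earlier coins.
    rarely-trouble : ∀ r S → ∑ (vecs choices r) (χ ∘ trouble next bad S) * 2 ^ B
      ≤ r * 2 ^ suc k * length (vecs choices r)
    rarely-trouble = ∑-trouble next bad choices (2 ^ suc k) (2 ^ B) λ S →
      ≤-trans (∑-anyL choices (misled S) (2 ^ B) (length choices) (rarely-misled S) examples)
        (≤-reflexive (cong (_* length choices) (begin
          length examples ≡⟨ length-++ (map (_, false) (cube k)) ⟩
          length (map (_, false) (cube k)) + length (map (_, true) (cube k))
            ≡⟨ cong₂ _+_ (length-map (_, false) (cube k)) (length-map (_, true) (cube k)) ⟩
          length (cube k) + length (cube k) ≡⟨ cong₂ _+_ (length-cube k) (length-cube k) ⟩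
          2 ^ k + 2 ^ k ≡⟨ cong (2 ^ k +_) (+-identityʳ _) ⟨
          2 ^ suc k ∎)))
      where open ≡-Reasoning

-- A hypothesis is a list of bits read as a program of NOR gates of unbounded
-- fan-in: every row of bits selects the wires that its gate reads, and the
-- new wire is put in front of the old ones.

norStep : List Bool × Bool → Bool → List Bool × Bool
norStep ([]     , o) w = [] , o
norStep (b ∷ cs , o) w = cs , (b ∧ w) ∨ o

hypStep : List Bool × List Bool → List Bool × List Bool
hypStep (ws , cs) = not (proj₂ r) ∷ ws , proj₁ r
  where r = List.foldl norStep (cs , false) ws

headBit : List Bool → Bool
headBit []      = false
headBit (b ∷ _) = b

hyp : ℕ → List Bool → List Bool → Bool
hyp r ws cs = headBit (proj₁ (iterate hypStep (ws , cs) r))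

hypLength : ℕ → ℕ → ℕ
hypLength zero    e = 0
hypLength (suc r) e = e + hypLength r (suc e)

norStep-++ : ∀ ws cs o vs → length ws ≤ length cs →
  List.foldl norStep (cs ++ vs , o) ws ≡
    (proj₁ (List.foldl norStep (cs , o) ws) ++ vs , proj₂ (List.foldl norStep (cs , o) ws)) ×
  length ws + length (proj₁ (List.foldl norStep (cs , o) ws)) ≡ length cs
norStep-++ []       cs       o vs le       = refl , refl
norStep-++ (w ∷ ws) (b ∷ cs) o vs (s≤s le) =
  proj₁ (norStep-++ ws cs _ vs le) , cong suc (proj₂ (norStep-++ ws cs _ vs le))

-- A string of the exact length is used up by its own program. Search strings append hash values to
-- a hypothesis, and these must not affect it.
hyp-++ : ∀ r ws cs vs → length cs ≡ hypLength r (length ws) → hyp r ws (cs ++ vs) ≡ hyp r ws cs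
hyp-++ zero    ws cs vs e = refl
hyp-++ (suc r) ws cs vs e with norStep-++ ws cs false vs (≤-trans (m≤m+n _ _) (≤-reflexive (sym e)))
... | split , len rewrite split = hyp-++ r _ _ vs
  (+-cancelˡ-≡ (length ws) _ _ (trans len e))

dotOr : ∀ {e} → Vec Bool e → Vec Bool e → Bool
dotOr []       []       = false
dotOr (b ∷ bs) (w ∷ ws) = (b ∧ w) ∨ dotOr bs ws

nor : ∀ {e} → Vec Bool e → Vec Bool e → Bool
nor bs ws = not (dotOr bs ws)

norStep-row : ∀ {e} (bs ws : Vec Bool e) cs o →
  List.foldl norStep (toList bs ++ cs , o) (toList ws) ≡ (cs , dotOr bs ws ∨ o)
norStep-row []       []       cs o = refl
norStep-row (b ∷ bs) (w ∷ ws) cs o = trans (norStep-row bs ws cs _) (cong (cs ,_) (shuffle (b ∧ w) (dotOr bs ws) o))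
  where
  shuffle : ∀ a d o → d ∨ (a ∨ o) ≡ (a ∨ d) ∨ o
  shuffle true  true  o = refl
  shuffle true  false o = refl
  shuffle false d     o = refl

hyp-row : ∀ r {e} (bs ws : Vec Bool e) cs →
  hyp (suc r) (toList ws) (toList bs ++ cs) ≡ hyp r (toList (nor bs ws ∷ ws)) cs
hyp-row r bs ws cs rewrite norStep-row bs ws cs false | ∨-identityʳ (dotOr bs ws) = refl

select : ∀ {e} → List (Fin e) → Vec Bool e
select []       = Vec.replicate _ false
select (a ∷ as) = select as Vec.[ a ]≔ true

dotOr-none : ∀ {e} (ws : Vec Bool e) → dotOr (select []) ws ≡ false
dotOr-none []       = refl
dotOr-none (w ∷ ws) = dotOr-none ws

dotOr-set : ∀ {e} (bs ws : Vec Bool e) a → dotOr (bs Vec.[ a ]≔ true) ws ≡ lookup ws a ∨ dotOr bs ws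
dotOr-set (b ∷ bs) (w ∷ ws) zero    = absorb b w (dotOr bs ws)
  where
  absorb : ∀ b w d → w ∨ d ≡ w ∨ ((b ∧ w) ∨ d)
  absorb b     true  d = refl
  absorb true  false d = refl
  absorb false false d = refl
dotOr-set (b ∷ bs) (w ∷ ws) (suc a) = trans (cong ((b ∧ w) ∨_) (dotOr-set bs ws a)) (swap (b ∧ w) (lookup ws a) _)
  where
  swap : ∀ x y z → x ∨ (y ∨ z) ≡ y ∨ (x ∨ z)
  swap true  true  z = refl
  swap true  false z = refl
  swap false y     z = refl

anyOf : ∀ {e} → List (Fin e) → Vec Bool e → Bool
anyOf as ws = List.foldr (λ a o → lookup ws a ∨ o) false as

dotOr-select : ∀ {e} as (ws : Vec Bool e) → dotOr (select as) ws ≡ anyOf as ws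
dotOr-select []       ws = dotOr-none ws
dotOr-select (a ∷ as) ws = trans (dotOr-set (select as) ws a) (cong (lookup ws a ∨_) (dotOr-select as ws))

-- `τ` locates the wires of the circuit among those of the program, which has auxiliary wires
-- besides.
Realised : ∀ {j e} → Circuit j → (Fin j → Fin e) → ℕ → Set
Realised {e = e} h τ r = Σ (List Bool) λ cs → length cs ≡ hypLength r e ×
  (∀ ws → hyp r (toList ws) cs ≡ eval h (Vec.tabulate (lookup ws ∘ τ)))

-- The value of a program is its newest wire, so a double negation copies the output there, at the
-- price of two rows. Surplus rows come before it, compute idle wires and merely shift `τ`; they pad
-- the program to the prescribed number of rows.
realise-output : ∀ {j e} (a : Fin j) (τ : Fin j → Fin e) r → Realised (output a) τ (2 + r)
realise-output {e = e} a τ zero = cs , len , correct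
  where
  cs : List Bool
  cs = toList (select (τ a ∷ [])) ++ toList (select {suc e} (zero ∷ [])) ++ []
  len : length cs ≡ e + (suc e + 0)
  len = trans (length-++ (toList (select (τ a ∷ [])))) (cong₂ _+_ (length-toList (select (τ a ∷ [])))
    (trans (length-++ (toList (select {suc e} (zero ∷ [])))) (cong (_+ 0) (length-toList (select {suc e} (zero ∷ []))))))
  correct : ∀ ws → hyp 2 (toList ws) cs ≡ lookup (Vec.tabulate (lookup ws ∘ τ)) a
  correct ws = trans (hyp-row 1 (select (τ a ∷ [])) ws _)
    (trans (hyp-row 0 (select (zero ∷ [])) (nor (select (τ a ∷ [])) ws ∷ ws) [])
    (trans (cong not (dotOr-select (zero ∷ []) (nor (select (τ a ∷ [])) ws ∷ ws)))
    (trans (cong (λ b → not (not b ∨ false)) (dotOr-select (τ a ∷ []) ws))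
    (trans (double (lookup ws (τ a))) (sym (lookup∘tabulate (lookup ws ∘ τ) a))))))
    where
    double : ∀ b → not (not (b ∨ false) ∨ false) ≡ b
    double true  = refl
    double false = refl
realise-output a τ (suc r) with realise-output a (suc ∘ τ) r
... | cs , len , correct = toList (select (τ a ∷ [])) ++ cs ,
  trans (length-++ (toList (select (τ a ∷ [])))) (cong₂ _+_ (length-toList (select (τ a ∷ []))) len) ,
  λ ws → trans (hyp-row (2 + r) (select (τ a ∷ [])) ws cs) (correct (nor (select (τ a ∷ [])) ws ∷ ws))

-- Spending three rows on every gate makes the number of rows depend on the number of gates alone. A
-- conjunction needs three, two negations and their NOR; other gates leave some of them idle.
GateRows : ∀ {j e} → Gate j → (Fin j → Fin e) → Set
GateRows {e = e} g τ = Σ (Vec Bool e) λ r₁ → Σ (Vec Bool (1 + e)) λ r₂ → Σ (Vec Bool (2 + e)) λ r₃ →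
  ∀ ws → let ws₁ = nor r₁ ws ∷ ws; ws₂ = nor r₂ ws₁ ∷ ws₁ in
  nor r₃ ws₂ ≡ evalGate g (Vec.tabulate (lookup ws ∘ τ))

selectRows : ∀ {j e} (g : Gate j) (τ : Fin j → Fin e) as₁ as₂ as₃ →
  (∀ ws → let w₁ = not (anyOf as₁ ws); w₂ = not (anyOf as₂ (w₁ ∷ ws)) in
    not (anyOf as₃ (w₂ ∷ w₁ ∷ ws)) ≡ evalGate g (Vec.tabulate (lookup ws ∘ τ))) → GateRows g τ
selectRows g τ as₁ as₂ as₃ correct = select as₁ , select as₂ , select as₃ , λ ws →
  trans (cong not (dotOr-select as₃ (nor (select as₂) (nor (select as₁) ws ∷ ws) ∷ nor (select as₁) ws ∷ ws)))
  (trans (cong (λ w₂ → not (anyOf as₃ (not w₂ ∷ nor (select as₁) ws ∷ ws))) (dotOr-select as₂ (nor (select as₁) ws ∷ ws)))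
  (trans (cong (λ w₁ → not (anyOf as₃ (not (anyOf as₂ (not w₁ ∷ ws)) ∷ not w₁ ∷ ws))) (dotOr-select as₁ ws))
  (correct ws)))

gateRows : ∀ {j e} (g : Gate j) (τ : Fin j → Fin e) → GateRows g τ
gateRows (const true)  τ = selectRows (const true)  τ [] [] []          λ ws → refl
gateRows (const false) τ = selectRows (const false) τ [] [] (zero ∷ []) λ ws → refl
gateRows (neg a) τ = selectRows (neg a) τ [] [] (suc (suc (τ a)) ∷ []) λ ws →
  cong not (trans (∨-identityʳ _) (sym (lookup∘tabulate (lookup ws ∘ τ) a)))
gateRows (and a b) τ = selectRows (and a b) τ (τ a ∷ []) (suc (τ b) ∷ []) (zero ∷ suc zero ∷ []) λ ws →
  trans (deMorgan (lookup ws (τ a)) (lookup ws (τ b)))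
  (sym (cong₂ _∧_ (lookup∘tabulate (lookup ws ∘ τ) a) (lookup∘tabulate (lookup ws ∘ τ) b)))
  where
  deMorgan : ∀ a b → not (not (b ∨ false) ∨ (not (a ∨ false) ∨ false)) ≡ a ∧ b
  deMorgan true  true  = refl
  deMorgan true  false = refl
  deMorgan false true  = refl
  deMorgan false false = refl
gateRows (or a b) τ = selectRows (or a b) τ [] (suc (τ a) ∷ suc (τ b) ∷ []) (zero ∷ []) λ ws →
  trans (double (lookup ws (τ a)) (lookup ws (τ b)))
  (sym (cong₂ _∨_ (lookup∘tabulate (lookup ws ∘ τ) a) (lookup∘tabulate (lookup ws ∘ τ) b)))
  where
  double : ∀ a b → not (not (a ∨ (b ∨ false)) ∨ false) ≡ a ∨ b
  double true  b     = refl
  double false true  = refl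
  double false false = refl

realise : ∀ {j e} (h : Circuit j) (τ : Fin j → Fin e) r → gates h * 3 + 2 ≤ r → Realised h τ r
realise (output a) τ (suc (suc r)) (s≤s (s≤s _)) = realise-output a τ r
realise {e = e} (gate g h) τ (suc (suc (suc r))) (s≤s (s≤s (s≤s le)))
  with gateRows g τ | realise h (λ { zero → zero ; (suc a) → suc (suc (suc (τ a))) }) r le
... | r₁ , r₂ , r₃ , value | cs , len , correct =
  toList r₁ ++ toList r₂ ++ toList r₃ ++ cs ,
  trans (length-++ (toList r₁)) (cong₂ _+_ (length-toList r₁)
    (trans (length-++ (toList r₂)) (cong₂ _+_ (length-toList r₂)
      (trans (length-++ (toList r₃)) (cong₂ _+_ (length-toList r₃) len))))) ,
  λ ws → let ws₁ = nor r₁ ws ∷ ws; ws₂ = nor r₂ ws₁ ∷ ws₁ in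
    trans (hyp-row (2 + r) r₁ ws _) (trans (hyp-row (1 + r) r₂ ws₁ _) (trans (hyp-row r r₃ ws₂ cs)
    (trans (correct (nor r₃ ws₂ ∷ ws₂)) (cong (λ b → eval h (b ∷ Vec.tabulate (lookup ws ∘ τ))) (value ws)))))

-- Loop programs.  A fold runs at most as often as the length N of a clock,
-- so that a polynomial in N read off the program bounds its running time.

spine : Tree → ℕ
spine leaf    = 0
spine (_ · t) = suc (spine t)

onTree : {A : Set} → Tree → A → (Tree → Tree → A) → A
onTree leaf    a f = a
onTree (l · r) a f = f l r

foldT : {A : Set} → ℕ → (Tree → A → A) → A → Tree → A
foldT zero    f a t       = a
foldT (suc N) f a leaf    = a
foldT (suc N) f a (x · t) = foldT N f (f x a) t

data P (k : ℕ) : Set where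
  var   : Fin k → P k
  leaf  : P k
  _·_   : P k → P k → P k
  bind  : P k → P (suc k) → P k
  match : P k → P k → P (suc (suc k)) → P k
  fold  : P k → P k → P (suc (suc k)) → P k
  ren   : ∀ {j} → Vec (Fin k) j → P j → P k

sem : ∀ {k} → ℕ → P k → Vec Tree k → Tree
sem N (var j)       ρ = lookup ρ j
sem N leaf          ρ = leaf
sem N (a · b)       ρ = sem N a ρ · sem N b ρ
sem N (bind a b)    ρ = sem N b (sem N a ρ ∷ ρ)
sem N (match a b c) ρ = onTree (sem N a ρ) (sem N b ρ) (λ l r → sem N c (l ∷ r ∷ ρ))
sem N (fold l a b)  ρ = foldT N (λ x u → sem N b (x ∷ u ∷ ρ)) (sem N a ρ) (sem N l ρ)
sem N (ren σ e)     ρ = sem N e (Vec.map (lookup ρ) σ)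

-- Effects are kept apart from `P`: pure programs have a value under `sem` and can serve inside the
-- NP verifier, which has neither coins nor an oracle.
data E (k : ℕ) : Set where
  pure  : P k → E k
  bind  : E k → E (suc k) → E k
  match : P k → E k → E (suc (suc k)) → E k
  fold  : P k → P k → E (suc (suc k)) → E k
  ren   : ∀ {j} → Vec (Fin k) j → E j → E k
  flip  : E k
  ask   : P k → E k

pattern #0 = zero
pattern #1 = suc #0
pattern #2 = suc #1
pattern #3 = suc #2
pattern #4 = suc #3
pattern #5 = suc #4
pattern #6 = suc #5
pattern #7 = suc #6
pattern #8 = suc #7
pattern #9 = suc #8
pattern #10 = suc #9
pattern #11 = suc #10
pattern #12 = suc #11
pattern #13 = suc #12
pattern #14 = suc #13

-- The loop state is clock · (list · accumulator).
opened : ∀ {k} → Prog (9 + k) → Prog (suc k)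
opened e = match (var #0) leaf (match (var #0) leaf (match (var #3) leaf (match (var #0) leaf e)))

loopCond : ∀ {k} → Prog (suc k)
loopCond = opened (leaf · leaf)

-- Among the variables that `opened` binds, 0 is the entry, 1 the rest of the list, 3 the
-- accumulator and 5 the rest of the clock.
loopStep : ∀ {k} → Prog (9 + k) → Prog (suc k)
loopStep b = opened (var #5 · (var #1 · b))

foldProg : ∀ {k} → Fin k → Prog k → Prog k → Prog (9 + k) → Prog k
foldProg c l a b = bind (bind (var c · (l · a)) (while loopCond (loopStep b)))
  (match (var #0) leaf (match (var #1) leaf (var #1)))

inBody : ∀ {k K} → (Fin k → Fin K) → Fin (suc (suc k)) → Fin (9 + K)
inBody σ #0            = #0
inBody σ #1            = #3
inBody σ (suc (suc j)) = 9 Fin.↑ʳ σ j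

under₁ : ∀ {k K} → (Fin k → Fin K) → Fin (1 + k) → Fin (1 + K)
under₁ σ zero    = zero
under₁ σ (suc j) = suc (σ j)

under₂ : ∀ {k K} → (Fin k → Fin K) → Fin (2 + k) → Fin (2 + K)
under₂ σ = under₁ (under₁ σ)

compile : ∀ {k K} → Fin K → (Fin k → Fin K) → P k → Prog K
compile c σ (var j)       = var (σ j)
compile c σ leaf          = leaf
compile c σ (a · b)       = compile c σ a · compile c σ b
compile c σ (bind a b)    = bind (compile c σ a) (compile (suc c) (under₁ σ) b)
compile c σ (match a b d) = match (compile c σ a) (compile c σ b) (compile (suc (suc c)) (under₂ σ) d)
compile c σ (fold l a b)  = foldProg c (compile c σ l) (compile c σ a) (compile (9 Fin.↑ʳ c) (inBody σ) b)
compile c σ (ren τ e)     = compile c (σ ∘ lookup τ) e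

compileᴱ : ∀ {k K} → Fin K → (Fin k → Fin K) → E k → Prog K
compileᴱ c σ (pure e)      = compile c σ e
compileᴱ c σ (bind a b)    = bind (compileᴱ c σ a) (compileᴱ (suc c) (under₁ σ) b)
compileᴱ c σ (match a b d) = match (compile c σ a) (compileᴱ c σ b) (compileᴱ (suc (suc c)) (under₂ σ) d)
compileᴱ c σ (fold l a b)  = foldProg c (compile c σ l) (compile c σ a) (compileᴱ (9 Fin.↑ʳ c) (inBody σ) b)
compileᴱ c σ (ren τ e)     = compileᴱ c (σ ∘ lookup τ) e
compileᴱ c σ flip          = flip
compileᴱ c σ (ask e)       = ask (compile c σ e)

loopPoly : ∀ {j} → Poly (suc j) → Poly (suc j)
loopPoly p = var zero ⊗ (p ⊕ con 30)

cost : ∀ {j k} → P k → Poly (suc j)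
cost (var j)       = con 1
cost leaf          = con 1
cost (a · b)       = con 1 ⊕ (cost a ⊕ cost b)
cost (bind a b)    = con 1 ⊕ (cost a ⊕ cost b)
cost (match a b c) = con 1 ⊕ (cost a ⊕ (cost b ⊕ cost c))
cost (fold l a b)  = con 40 ⊕ ((cost l ⊕ cost a) ⊕ loopPoly (cost b))
cost (ren σ e)     = cost e

-- The second variable bounds the size of queries.
costᴱ : ∀ {k} → E k → Poly 2
costᴱ (pure e)      = cost e
costᴱ (bind a b)    = con 1 ⊕ (costᴱ a ⊕ costᴱ b)
costᴱ (match a b c) = con 1 ⊕ (cost a ⊕ (costᴱ b ⊕ costᴱ c))
costᴱ (fold l a b)  = con 40 ⊕ ((cost l ⊕ cost a) ⊕ loopPoly (costᴱ b))
costᴱ (ren σ e)     = costᴱ e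
costᴱ flip          = con 1
costᴱ (ask e)       = con 1 ⊕ (var (suc zero) ⊕ cost e)

callsᴱ : ∀ {k} → E k → Poly 1
callsᴱ (pure e)      = con 0
callsᴱ (bind a b)    = callsᴱ a ⊕ callsᴱ b
callsᴱ (match a b c) = callsᴱ b ⊕ callsᴱ c
callsᴱ (fold l a b)  = var zero ⊗ callsᴱ b
callsᴱ (ren σ e)     = callsᴱ e
callsᴱ flip          = con 0
callsᴱ (ask e)       = con 1

record Runs (O : Oracle) {k} (ρ : Vec Tree k) (e : Prog k) (ω : List Bool)
            (v : Tree) (ω′ : List Bool) (C T : ℕ) : Set where
  constructor ran
  field
    derivation : O ∣ ρ ⊢ e , ω ⇓ v , ω′
    calls≤     : calls derivation ≤ C
    steps≤     : steps derivation ≤ T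

module _ {O : Oracle} where

  runs-weaken : ∀ {k} {ρ : Vec Tree k} {e ω v ω′ C C′ T T′} → C ≤ C′ → T ≤ T′ →
    Runs O ρ e ω v ω′ C T → Runs O ρ e ω v ω′ C′ T′
  runs-weaken C≤ T≤ (ran d c s) = ran d (≤-trans c C≤) (≤-trans s T≤)

  runs-bind : ∀ {k} {ρ : Vec Tree k} {a b u v ω ω′ ω″ C₁ C₂ T₁ T₂} →
    Runs O ρ a ω u ω′ C₁ T₁ → Runs O (u ∷ ρ) b ω′ v ω″ C₂ T₂ →
    Runs O ρ (bind a b) ω v ω″ (C₁ + C₂) (1 + (T₁ + T₂))
  runs-bind (ran d₁ c₁ s₁) (ran d₂ c₂ s₂) =
    ran (bind d₁ d₂) (+-mono-≤ c₁ c₂) (s≤s (+-mono-≤ s₁ s₂))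

  runs-· : ∀ {k} {ρ : Vec Tree k} {a b u v ω ω′ ω″ C₁ C₂ T₁ T₂} →
    Runs O ρ a ω u ω′ C₁ T₁ → Runs O ρ b ω′ v ω″ C₂ T₂ →
    Runs O ρ (a · b) ω (u · v) ω″ (C₁ + C₂) (1 + (T₁ + T₂))
  runs-· (ran d₁ c₁ s₁) (ran d₂ c₂ s₂) =
    ran (d₁ · d₂) (+-mono-≤ c₁ c₂) (s≤s (+-mono-≤ s₁ s₂))

  runs-leaf : ∀ {k} {ρ : Vec Tree k} {a b d v ω ω′ ω″ C₁ C₂ T₁ T₂} →
    Runs O ρ a ω leaf ω′ C₁ T₁ → Runs O ρ b ω′ v ω″ C₂ T₂ →
    Runs O ρ (match a b d) ω v ω″ (C₁ + C₂) (1 + (T₁ + T₂))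
  runs-leaf (ran d₁ c₁ s₁) (ran d₂ c₂ s₂) =
    ran (match-leaf d₁ d₂) (+-mono-≤ c₁ c₂) (s≤s (+-mono-≤ s₁ s₂))

  runs-node : ∀ {k} {ρ : Vec Tree k} {a b d l r v ω ω′ ω″ C₁ C₂ T₁ T₂} →
    Runs O ρ a ω (l · r) ω′ C₁ T₁ → Runs O (l ∷ r ∷ ρ) d ω′ v ω″ C₂ T₂ →
    Runs O ρ (match a b d) ω v ω″ (C₁ + C₂) (1 + (T₁ + T₂))
  runs-node (ran d₁ c₁ s₁) (ran d₂ c₂ s₂) =
    ran (match-node d₁ d₂) (+-mono-≤ c₁ c₂) (s≤s (+-mono-≤ s₁ s₂))

  runs-var : ∀ {k} {ρ : Vec Tree k} {j v ω} → lookup ρ j ≡ v → Runs O ρ (var j) ω v ω 0 1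
  runs-var refl = ran var ≤-refl ≤-refl

  data Iterates {k} (ρ : Vec Tree k) (b : Prog (9 + k)) (C T : ℕ) :
      ℕ → Tree → Tree → List Bool → Tree → List Bool → Set where
    timeout : ∀ {t u ω} → Iterates ρ b C T zero t u ω u ω
    end     : ∀ {N u ω} → Iterates ρ b C T (suc N) leaf u ω u ω
    again   : ∀ {N x t u u₁ u₂ ω ω₁ ω₂} →
      (∀ {s₁ s₂ c₁ c₂ c r} → Runs O (x ∷ s₁ ∷ s₂ ∷ u ∷ c₁ ∷ c₂ ∷ c ∷ r ∷ (c · r) ∷ ρ) b ω u₁ ω₁ C T) →
      Iterates ρ b C T N t u₁ ω₁ u₂ ω₂ → Iterates ρ b C T (suc N) (x · t) u ω u₂ ω₂

  runs-while : ∀ {k} {ρ : Vec Tree k} {b C T} c {N t u ω u′ ω′} → spine c ≡ N →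
    Iterates ρ b C T N t u ω u′ ω′ → ∃ λ c′ → ∃ λ t′ →
    Runs O (c · (t · u) ∷ ρ) (while loopCond (loopStep b)) ω (c′ · (t′ · u′)) ω′ (N * C) (N * (T + 30) + 20)
  runs-while leaf    {t = t} refl timeout =
    leaf , t , ran (while-stop (match-node var (match-leaf var leaf))) z≤n (s≤s (s≤s (s≤s (s≤s (s≤s (s≤s z≤n))))))
  runs-while (_ · c) refl end =
    _ , leaf , ran (while-stop (match-node var (match-node var (match-node var (match-leaf var leaf))))) z≤n
      (≤-trans (s≤s (s≤s (s≤s (s≤s (s≤s (s≤s (s≤s (s≤s (s≤s (s≤s z≤n)))))))))) (m≤n+m 20 _))
  runs-while {T = T} (_ · c) {suc N} {x · t} refl (again body rest) with body | runs-while c refl rest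
  ... | ran d c≤ s≤ | c′ , t′ , ran d′ c′≤ s′≤ = c′ , t′ ,
    ran (while-step
      (match-node var (match-node var (match-node var (match-node var (leaf · leaf)))))
      (match-node var (match-node var (match-node var (match-node var (var · (var · d))))))
      d′)
      (+-mono-≤ c≤ c′≤)
      (≤-trans (≤-reflexive (lemma (steps d) (steps d′)))
        (≤-trans (+-mono-≤ (+-mono-≤ s≤ (m≤n+m 24 6)) s′≤)
          (≤-reflexive (sym (+-assoc (T + 30) (N * (T + 30)) 20)))))
    where
    lemma : ∀ a b → 1 + (11 + ((12 + a) + b)) ≡ a + 24 + b
    lemma = solve-∀

  runs-fold : ∀ {k} {ρ : Vec Tree k} {c l a b N t u u′ ω ω′ C T₁ T₂ T} → spine (lookup ρ c) ≡ N →
    Runs O ρ l ω t ω 0 T₁ → Runs O ρ a ω u ω 0 T₂ → Iterates ρ b C T N t u ω u′ ω′ →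
    Runs O ρ (foldProg c l a b) ω u′ ω′ (N * C) (40 + ((T₁ + T₂) + N * (T + 30)))
  runs-fold {N = N} {C = C} {T₁} {T₂} {T} eq list init iter with runs-while _ eq iter
  ... | c′ , t′ , loop = runs-weaken (≤-reflexive (+-identityʳ (N * C)))
    (≤-trans (≤-reflexive (lemma T₁ T₂ (N * (T + 30)))) (+-monoˡ-≤ _ (m≤n+m 30 10)))
    (runs-bind (runs-bind (runs-· (runs-var refl) (runs-· list init)) loop)
      (ran (match-node var (match-node var var)) z≤n ≤-refl))
    where
    lemma : ∀ a b c → 1 + (1 + (1 + (1 + (1 + (a + b))) + (c + 20)) + 5) ≡ 30 + (a + b + c)
    lemma = solve-∀

record Agree {k K} (σ : Fin k → Fin K) (ρ′ : Vec Tree K) (ρ : Vec Tree k) : Set where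
  constructor agree
  field at : ∀ j → lookup ρ′ (σ j) ≡ lookup ρ j

open Agree

agree₁ : ∀ {k K} {σ : Fin k → Fin K} {ρ′ ρ v} → Agree σ ρ′ ρ → Agree (under₁ σ) (v ∷ ρ′) (v ∷ ρ)
agree₁ ag .at zero    = refl
agree₁ ag .at (suc j) = ag .at j

agree-body : ∀ {k K} {σ : Fin k → Fin K} {ρ′ ρ x u s₁ s₂ c₁ c₂ c r s} → Agree σ ρ′ ρ →
  Agree (inBody σ) (x ∷ s₁ ∷ s₂ ∷ u ∷ c₁ ∷ c₂ ∷ c ∷ r ∷ s ∷ ρ′) (x ∷ u ∷ ρ)
agree-body ag .at #0            = refl
agree-body ag .at #1            = refl
agree-body ag .at (suc (suc j)) = ag .at j

agree-ren : ∀ {j k K} {σ : Fin k → Fin K} {ρ′ ρ} (τ : Vec (Fin k) j) → Agree σ ρ′ ρ →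
  Agree (σ ∘ lookup τ) ρ′ (Vec.map (lookup ρ) τ)
agree-ren {ρ = ρ} τ ag .at i = trans (ag .at (lookup τ i)) (sym (lookup-map i (lookup ρ) τ))

module _ {O : Oracle} {N : ℕ} {i} {V : Vec ℕ i} where

  runs-compile : ∀ {k K} (e : P k) {ρ : Vec Tree k} {ρ′ : Vec Tree K} {σ c} → Agree σ ρ′ ρ →
    spine (lookup ρ′ c) ≡ N → ∀ {ω} →
    Runs O ρ′ (compile c σ e) ω (sem N e ρ) ω 0 (cost e ⟨ N ∷ V ⟩)
  runs-compile (var j)       ag cl = runs-var (ag .at j)
  runs-compile leaf          ag cl = ran leaf ≤-refl ≤-refl
  runs-compile (a · b)       ag cl = runs-· (runs-compile a ag cl) (runs-compile b ag cl)
  runs-compile (bind a b)    ag cl = runs-bind (runs-compile a ag cl) (runs-compile b (agree₁ ag) cl)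
  runs-compile (match a b d) {ρ} ag cl {ω} with sem N a ρ | runs-compile a {ρ} ag cl {ω}
  ... | leaf  | ra = runs-weaken ≤-refl (s≤s (+-monoʳ-≤ (cost a ⟨ N ∷ V ⟩) (m≤m+n _ _)))
                       (runs-leaf (ra) (runs-compile b ag cl))
  ... | l · r | ra = runs-weaken ≤-refl (s≤s (+-monoʳ-≤ (cost a ⟨ N ∷ V ⟩) (m≤n+m _ _)))
                       (runs-node (ra) (runs-compile d (agree₁ (agree₁ ag)) cl))
  runs-compile (fold l a b) {ρ} {ρ′} {σ} {c} ag cl {ω} =
    runs-weaken (≤-reflexive (*-zeroʳ N)) ≤-refl
      (runs-fold cl (runs-compile l ag cl) (runs-compile a ag cl) (iterations N (sem N l ρ) (sem N a ρ)))
    where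
    iterations : ∀ M t u → Iterates ρ′ (compile (9 Fin.↑ʳ c) (inBody σ) b) 0 (cost b ⟨ N ∷ V ⟩) M
      t u ω (foldT M (λ x u → sem N b (x ∷ u ∷ ρ)) u t) ω
    iterations zero    t       u = timeout
    iterations (suc M) leaf    u = end
    iterations (suc M) (x · t) u = again (runs-compile b (agree-body ag) cl) (iterations M t _)
  runs-compile (ren τ e)     ag cl = runs-compile e (agree-ren τ ag) cl

  runs-compile-≡ : ∀ {k K} (e : P k) {ρ : Vec Tree k} {ρ′ : Vec Tree K} {σ c v} → sem N e ρ ≡ v → Agree σ ρ′ ρ →
    spine (lookup ρ′ c) ≡ N → ∀ {ω} → Runs O ρ′ (compile c σ e) ω v ω 0 (cost e ⟨ N ∷ V ⟩)
  runs-compile-≡ e refl = runs-compile e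

module _ {O : Oracle} {N Q : ℕ} where

  record RunsE {k} (ρ : Vec Tree k) (e : E k) (ω : List Bool) (v : Tree) (ω′ : List Bool) : Set where
    constructor runsE
    field run : ∀ {K} {ρ′ : Vec Tree K} {σ c} → Agree σ ρ′ ρ → spine (lookup ρ′ c) ≡ N →
                Runs O ρ′ (compileᴱ c σ e) ω v ω′ (callsᴱ e ⟨ N ∷ [] ⟩) (costᴱ e ⟨ N ∷ Q ∷ [] ⟩)

  open RunsE

  module _ {k} {ρ : Vec Tree k} where

    do-pure : ∀ {e v ω} → sem N e ρ ≡ v → RunsE ρ (pure e) ω v ω
    do-pure {e} refl .run ag cl = runs-compile e ag cl

    do-bind : ∀ {a b u v ω ω₁ ω₂} → RunsE ρ a ω u ω₁ → RunsE (u ∷ ρ) b ω₁ v ω₂ → RunsE ρ (bind a b) ω v ω₂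
    do-bind ra rb .run ag cl = runs-bind (ra .run ag cl) (rb .run (agree₁ ag) cl)

    do-leaf : ∀ {a b d v ω ω′} → sem N a ρ ≡ leaf → RunsE ρ b ω v ω′ → RunsE ρ (match a b d) ω v ω′
    do-leaf {a} {b} {d} eq rb .run ag cl = runs-weaken (m≤m+n _ _) (s≤s (+-monoʳ-≤ (cost a ⟨ N ∷ Q ∷ [] ⟩) (m≤m+n _ _)))
      (runs-leaf (runs-compile-≡ a eq ag cl) (rb .run ag cl))

    do-node : ∀ {a b d l r v ω ω′} → sem N a ρ ≡ l · r → RunsE (l ∷ r ∷ ρ) d ω v ω′ → RunsE ρ (match a b d) ω v ω′
    do-node {a} {b} {d} eq rd .run ag cl = runs-weaken (m≤n+m _ _) (s≤s (+-monoʳ-≤ (cost a ⟨ N ∷ Q ∷ [] ⟩) (m≤n+m _ _)))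
      (runs-node (runs-compile-≡ a eq ag cl) (rd .run (agree₁ (agree₁ ag)) cl))

    do-flip : ∀ {b ω} → RunsE ρ flip (b ∷ ω) (bit b) ω
    do-flip .run ag cl = ran flip ≤-refl ≤-refl

    do-ask : ∀ {e q ω} → sem N e ρ ≡ q → size q ≤ Q → RunsE ρ (ask e) ω (bit (O q)) ω
    do-ask {e} refl small .run ag cl with runs-compile e ag cl
    ... | ran d c s = ran (ask d) (s≤s c) (s≤s (+-mono-≤ small s))

    do-ren : ∀ {j} {τ : Vec (Fin k) j} {e v ω ω′} → RunsE (Vec.map (lookup ρ) τ) e ω v ω′ → RunsE ρ (ren τ e) ω v ω′
    do-ren {τ = τ} re .run ag cl = re .run (agree-ren τ ag) cl

    data Chain (b : E (2 + k)) : List Tree → Tree → List Bool → Tree → List Bool → Set where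
      []  : ∀ {u ω} → Chain b [] u ω u ω
      _∷_ : ∀ {x xs u u₁ u₂ ω ω₁ ω₂} → RunsE (x ∷ u ∷ ρ) b ω u₁ ω₁ → Chain b xs u₁ ω₁ u₂ ω₂ →
            Chain b (x ∷ xs) u ω u₂ ω₂

    do-fold : ∀ {l a b xs u u′ ω ω′} → sem N l ρ ≡ List.foldr _·_ leaf xs → length xs ≤ N → sem N a ρ ≡ u →
      Chain b xs u ω u′ ω′ → RunsE ρ (fold l a b) ω u′ ω′
    do-fold {l} {a} {b} eql len eqa chain .run {ρ′ = ρ′} {σ} {c} ag cl = runs-fold cl
      (runs-compile-≡ l eql ag cl)
      (runs-compile-≡ a eqa ag cl)
      (iterations chain len)
      where
      iterations : ∀ {xs u u′ ω ω′ M} → Chain b xs u ω u′ ω′ → length xs ≤ M →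
        Iterates ρ′ (compileᴱ (9 Fin.↑ʳ c) (inBody σ) b) (callsᴱ b ⟨ N ∷ [] ⟩) (costᴱ b ⟨ N ∷ Q ∷ [] ⟩) M
          (List.foldr _·_ leaf xs) u ω u′ ω′
      iterations {M = zero}  []       len       = timeout
      iterations {M = suc M} []       len       = end
      iterations {M = suc M} (r ∷ rs) (s≤s len) = again (r .run (agree-body ag) cl) (iterations rs len)

-- The NP oracle

-- Identifies an arbitrary accepting run with the one that `verifier-runs` constructs, so that
-- acceptance can be read off `verdict`.
runs-deterministic : ∀ {O k} {ρ : Vec Tree k} {e ω u v ω₁ ω₂} →
  O ∣ ρ ⊢ e , ω ⇓ u , ω₁ → O ∣ ρ ⊢ e , ω ⇓ v , ω₂ → u ≡ v × ω₁ ≡ ω₂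
runs-deterministic var var = refl , refl
runs-deterministic leaf leaf = refl , refl
runs-deterministic (a · b) (a′ · b′) with runs-deterministic a a′
... | refl , refl with runs-deterministic b b′
... | refl , refl = refl , refl
runs-deterministic (bind a b) (bind a′ b′) with runs-deterministic a a′
... | refl , refl = runs-deterministic b b′
runs-deterministic (match-leaf a b) (match-leaf a′ b′) with runs-deterministic a a′
... | refl , refl = runs-deterministic b b′
runs-deterministic (match-leaf a b) (match-node a′ b′) with runs-deterministic a a′
... | () , _
runs-deterministic (match-node a b) (match-leaf a′ b′) with runs-deterministic a a′
... | () , _
runs-deterministic (match-node a b) (match-node a′ b′) with runs-deterministic a a′
... | refl , refl = runs-deterministic b b′
runs-deterministic (while-stop a) (while-stop a′) with runs-deterministic a a′
... | refl , refl = refl , refl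
runs-deterministic (while-stop a) (while-step a′ b′ c′) with runs-deterministic a a′
... | () , _
runs-deterministic (while-step a b c) (while-stop a′) with runs-deterministic a a′
... | () , _
runs-deterministic (while-step a b c) (while-step a′ b′ c′) with runs-deterministic a a′
... | refl , refl with runs-deterministic b b′
... | refl , refl = runs-deterministic c c′
runs-deterministic flip flip = refl , refl
runs-deterministic (ask a) (ask a′) with runs-deterministic a a′
... | refl , refl = refl , refl

poly-mono : ∀ {k} (p : Poly k) {v w : Vec ℕ k} → (∀ j → lookup v j ≤ lookup w j) → p ⟨ v ⟩ ≤ p ⟨ w ⟩
poly-mono (con a) le = ≤-refl
poly-mono (var j) le = le j
poly-mono (p ⊕ q) le = +-mono-≤ (poly-mono p le) (poly-mono q le)
poly-mono (p ⊗ q) le = *-mono-≤ (poly-mono p le) (poly-mono q le)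

poly-mono₁ : ∀ (p : Poly 1) {a b} → a ≤ b → p ⟨ a ∷ [] ⟩ ≤ p ⟨ b ∷ [] ⟩
poly-mono₁ p le = poly-mono p λ { zero → le }

opaque
  -- An oracle is a total Boolean function, so it is defined by exhaustive search for a witness. The
  -- list contains all trees of height at most n, among them all trees of size at most n.
  trees : ℕ → List Tree
  trees zero    = []
  trees (suc n) = leaf ∷ List.concatMap (λ l → map (l ·_) (trees n)) (trees n)

  trees-complete : ∀ n w → size w ≤ n → w ∈ trees n
  trees-complete (suc n) leaf    le       = here refl
  trees-complete (suc n) (l · r) (s≤s le) = there (∈-concatMap⁺ (λ l → map (l ·_) (trees n))
    (lose (trees-complete n l (≤-trans (m≤m+n _ _) le)) (∈-map⁺ (l ·_) (trees-complete n r (≤-trans (m≤n+m _ _) le)))))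

anyL-true : ∀ {A : Set} (p : A → Bool) {as a} → a ∈ as → p a ≡ true → anyL p as ≡ true
anyL-true p {as = as} a∈as pa with anyL p as in eq
... | true  = refl
... | false = trans (sym (anyL-false p a∈as eq)) pa

anyL-witness : ∀ {A : Set} (p : A → Bool) as → anyL p as ≡ true → ∃ λ a → p a ≡ true
anyL-witness p (a ∷ as) e with p a in eq
... | true  = a , eq
... | false = anyL-witness p as e

isNode : Tree → Bool
isNode leaf    = false
isNode (_ · _) = true

∧-true : ∀ {a b} → a ∧ b ≡ true → a ≡ true × b ≡ true
∧-true {true} {true} _ = refl , refl

spine≤size : ∀ t → spine t ≤ size t
spine≤size leaf    = z≤n
spine≤size (l · r) = s≤s (≤-trans (spine≤size r) (m≤n+m _ _))

module Verification (e : P 3) where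

  -- A query carries a clock as its first component, which limits the loops of the verifier. The
  -- clock is no longer than the query, so every pure program yields a verifier that runs in
  -- polynomial time.
  verdict : Tree → Tree → Bool
  verdict q w = onTree q false λ c r → isNode (sem (spine c) e (c ∷ r ∷ w ∷ []))

  verifier : Prog 2
  verifier = match (var #0) leaf (match (compile #0 (lookup (#0 ∷ #1 ∷ #3 ∷ [])) e) leaf (leaf · leaf))

  opaque
    bound : Poly 1
    -- The last term admits witnesses up to eight times as large as the query; those built from
    -- missing bits stay below this.
    bound = con 10 ⊕ (cost e ⊕ (con 8 ⊗ var zero))

    verifier-runs : ∀ q w → Σ (∅ ∣ q ∷ w ∷ [] ⊢ verifier , [] ⇓ bit (verdict q w) , []) λ d →
      time d ≤ bound ⟨ size q ∷ [] ⟩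
    verifier-runs leaf w = match-leaf var leaf , s≤s (s≤s (s≤s (s≤s z≤n)))
    verifier-runs q@(c · r) w
      with sem (spine c) e (c ∷ r ∷ w ∷ []) | runs-compile {∅} {spine c} {V = []} e {c ∷ r ∷ w ∷ []} {c ∷ r ∷ q ∷ w ∷ []}
             {lookup (#0 ∷ #1 ∷ #3 ∷ [])} {#0} (agree λ { #0 → refl ; #1 → refl ; #2 → refl }) refl {[]}
    ... | leaf  | ran d _ s≤ = match-node var (match-leaf d leaf) , (begin
        1 + (1 + (1 + (steps d + 1))) + 1 ≡⟨ lemma (steps d) ⟩
        5 + steps d                       ≤⟨ +-mono-≤ {5} {10} (m≤m+n 5 5) (≤-trans s≤ (poly-mono₁ (cost e) c≤q)) ⟩
        10 + cost e ⟨ size q ∷ [] ⟩       ≤⟨ +-monoʳ-≤ 10 (m≤m+n _ _) ⟩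
        bound ⟨ size q ∷ [] ⟩ ∎)
      where
      open ≤-Reasoning
      lemma : ∀ a → 1 + (1 + (1 + (a + 1))) + 1 ≡ 5 + a
      lemma = solve-∀
      c≤q : spine c ≤ size q
      c≤q = ≤-trans (spine≤size c) (≤-trans (m≤m+n _ _) (n≤1+n _))
    ... | _ · _ | ran d _ s≤ = match-node var (match-node d (leaf · leaf)) , (begin
        1 + (1 + (1 + (steps d + 3))) + 3 ≡⟨ lemma (steps d) ⟩
        9 + steps d                       ≤⟨ +-mono-≤ {9} {10} (m≤m+n 9 1) (≤-trans s≤ (poly-mono₁ (cost e) c≤q)) ⟩
        10 + cost e ⟨ size q ∷ [] ⟩       ≤⟨ +-monoʳ-≤ 10 (m≤m+n _ _) ⟩
        bound ⟨ size q ∷ [] ⟩ ∎)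
      where
      open ≤-Reasoning
      lemma : ∀ a → 1 + (1 + (1 + (a + 3))) + 3 ≡ 9 + a
      lemma = solve-∀
      c≤q : spine c ≤ size q
      c≤q = ≤-trans (spine≤size c) (≤-trans (m≤m+n _ _) (n≤1+n _))

    accepts : Tree → Tree → Bool
    accepts q w = (size w ≤ᵇ bound ⟨ size q ∷ [] ⟩) ∧ verdict q w

    oracle : Oracle
    oracle q = anyL (accepts q) (trees (bound ⟨ size q ∷ [] ⟩))

    oracle-sound : ∀ q → oracle q ≡ true → ∃ λ w → size w ≤ bound ⟨ size q ∷ [] ⟩ × verdict q w ≡ true
    oracle-sound q asserted with anyL-witness (accepts q) (trees (bound ⟨ size q ∷ [] ⟩)) asserted
    ... | w , ok with ∧-true ok
    ... | small , good = w , ≤ᵇ⇒≤ _ _ (Equivalence.from T-≡ small) , good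

    oracle-complete′ : ∀ q w → size w ≤ bound ⟨ size q ∷ [] ⟩ → verdict q w ≡ true → oracle q ≡ true
    oracle-complete′ q w small good = anyL-true (accepts q) (trees-complete _ w small)
      (cong₂ _∧_ (Equivalence.to T-≡ (≤⇒≤ᵇ small)) good)

    oracle-complete : ∀ q w → size w ≤ 8 * size q → verdict q w ≡ true → oracle q ≡ true
    oracle-complete q w small = oracle-complete′ q w
      (≤-trans small (≤-trans (m≤n+m _ (cost e ⟨ size q ∷ [] ⟩)) (m≤n+m _ 10)))

    oracle-NP : InNP oracle
    oracle-NP = verifier , bound , λ q → mk⇔
      (λ asserted → let (w , small , good) = oracle-sound q asserted in w , small , accept q w good)
      (λ { (w , small , l , r , d , _) → oracle-complete′ q w small (reject q w d) })
      where
      accept : ∀ q w → verdict q w ≡ true → AcceptsWithin (bound ⟨ size q ∷ [] ⟩) verifier q w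
      accept q w good with verdict q w | verifier-runs q w
      accept q w refl | .true | d = leaf , leaf , d
      reject : ∀ q w {l r} → ∅ ∣ q ∷ w ∷ [] ⊢ verifier , [] ⇓ l · r , [] → verdict q w ≡ true
      reject q w d with verdict q w | verifier-runs q w
      ... | true  | _ = refl
      ... | false | d′ , _ with runs-deterministic d d′
      ... | () , _

-- Programs that evaluate hypotheses, hashes and votes

listOf : {A : Set} → (A → Tree) → List A → Tree
listOf f []       = leaf
listOf f (a ∷ as) = f a · listOf f as

bits : List Bool → Tree
bits = listOf bit

pair : {A B : Set} → (A → Tree) → (B → Tree) → A × B → Tree
pair f g (a , b) = f a · g b

module _ {A : Set} {f : Tree → Tree → Tree} (eA : A → Tree) where

  foldT-listOf : ∀ {X : Set} (eX : X → Tree) (g : A → X → A) →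
    (∀ x a → f (eX x) (eA a) ≡ eA (g a x)) → ∀ {N} a xs → length xs ≤ N →
    foldT N f (eA a) (listOf eX xs) ≡ eA (List.foldl g a xs)
  foldT-listOf eX g sim {zero}  a []       le       = refl
  foldT-listOf eX g sim {suc N} a []       le       = refl
  foldT-listOf eX g sim {suc N} a (x ∷ xs) (s≤s le) =
    trans (cong (λ u → foldT N f u (listOf eX xs)) (sim x a)) (foldT-listOf eX g sim (g a x) xs le)

  foldT-nat : ∀ (g : A → A) → (∀ a → f leaf (eA a) ≡ eA (g a)) → ∀ {N} a n → n ≤ N →
    foldT N f (eA a) (encodeℕ n) ≡ eA (iterate g a n)
  foldT-nat g sim {zero}  a zero    le       = refl
  foldT-nat g sim {suc N} a zero    le       = refl
  foldT-nat g sim {suc N} a (suc n) (s≤s le) =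
    trans (cong (λ u → foldT N f u (encodeℕ n)) (sim a)) (foldT-nat g sim (g a) n le)

v0 : ∀ {k} → P (1 + k)
v0 = var #0
v1 : ∀ {k} → P (2 + k)
v1 = var #1
v2 : ∀ {k} → P (3 + k)
v2 = var #2
v3 : ∀ {k} → P (4 + k)
v3 = var #3
v4 : ∀ {k} → P (5 + k)
v4 = var #4
v5 : ∀ {k} → P (6 + k)
v5 = var #5
v6 : ∀ {k} → P (7 + k)
v6 = var #6
v7 : ∀ {k} → P (8 + k)
v7 = var #7

v8 : ∀ {k} → P (9 + k)
v8 = var #8
v9 : ∀ {k} → P (10 + k)
v9 = var #9
v10 : ∀ {k} → P (11 + k)
v10 = var #10

wk₁ : ∀ {k} → Vec (Fin (1 + k)) k
wk₁ = Vec.tabulate Fin.suc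

wk₂ : ∀ {k} → Vec (Fin (2 + k)) k
wk₂ = Vec.tabulate (2 Fin.↑ʳ_)

trueP : ∀ {k} → P k
trueP = leaf · leaf

ifP : ∀ {k} → P k → P k → P k → P k
ifP c t e = match c e (ren wk₂ t)

app₁ : ∀ {k} → P 1 → P k → P k
app₁ f a = bind a (ren (#0 ∷ []) f)

app₂ : ∀ {k} → P 2 → P k → P k → P k
app₂ f a b = bind a (bind (ren wk₁ b) (ren (#1 ∷ #0 ∷ []) f))

-- `t` is a numeral that selects a branch. Older remainders of the numeral are dropped after each
-- test, so the current one is always variable 1.
switch : ∀ {k} → P k → List (P k) → P k
switch t []       = leaf
switch t (b ∷ bs) = match t b (go bs)
  where
  go : ∀ {k} → List (P k) → P (2 + k)
  go []       = leaf
  go (b ∷ bs) = match (var #1) (ren wk₂ b) (ren (#0 ∷ #1 ∷ Vec.tabulate (4 Fin.↑ʳ_)) (go bs))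


opaque

  reverseP : P 1
  reverseP = fold v0 leaf (v0 · v1)

  reverseP-spec : ∀ {N} {A : Set} (e : A → Tree) xs → length xs ≤ N →
    sem N reverseP (listOf e xs ∷ []) ≡ listOf e (List.reverse xs)
  reverseP-spec {N} e xs le = foldT-listOf (listOf e) e (λ as a → a ∷ as) (λ x a → refl) [] xs le

opaque

  norStepP : P 2
  norStepP = match v1 leaf (match v0 (leaf · v1) (v1 · ifP v0 (ifP v4 trueP v3) v3))

  norStepP-spec : ∀ {N} w s → sem N norStepP (bit w ∷ pair bits bit s ∷ []) ≡ pair bits bit (norStep s w)
  norStepP-spec {N} w     ([]         , o) = refl
  norStepP-spec {N} w     (false ∷ cs , o) = refl
  norStepP-spec {N} false (true ∷ cs  , o) = refl
  norStepP-spec {N} true  (true ∷ cs  , o) = refl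

opaque

  hypStepP : P 1
  hypStepP = match v0 leaf (bind (fold v0 (v1 · leaf) (ren (#0 ∷ #1 ∷ []) norStepP))
    (match v0 leaf ((ifP v1 leaf trueP · v3) · v0)))

  hypStepP-spec : ∀ {N} s → length (proj₁ s) ≤ N → sem N hypStepP (pair bits bits s ∷ []) ≡ pair bits bits (hypStep s)
  hypStepP-spec {N} (ws , cs) le
    rewrite foldT-listOf {f = λ x u → sem N norStepP (x ∷ u ∷ [])} (pair bits bit) bit norStep norStepP-spec {N} (cs , false) ws le
    with List.foldl norStep (cs , false) ws
  ... | cs′ , false = refl
  ... | cs′ , true  = refl

opaque

  hypP : P 3
  hypP = match (fold v0 (v1 · v2) (ren (#1 ∷ []) hypStepP)) leaf (match v0 leaf v0)

  hypP-spec : ∀ {N} r ws cs → length ws + r ≤ N →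
    sem N hypP (encodeℕ r ∷ bits ws ∷ bits cs ∷ []) ≡ bit (hyp r ws cs)
  hypP-spec {N} r ws cs le = trans (cong (λ u → onTree u leaf (λ e _ → onTree e leaf (λ b _ → b)))
    (rows r N (ws , cs) le (≤-trans (m≤n+m r (length ws)) le))) (front (iterate hypStep (ws , cs) r))
    where
    rows : ∀ r M s → length (proj₁ s) + r ≤ N → r ≤ M →
      foldT M (λ x u → sem N hypStepP (u ∷ [])) (pair bits bits s) (encodeℕ r) ≡ pair bits bits (iterate hypStep s r)
    rows zero    zero    s le le′ = refl
    rows zero    (suc M) s le le′ = refl
    rows (suc r) (suc M) s le (s≤s le′) =
      trans (cong (λ u → foldT M _ u (encodeℕ r)) (hypStepP-spec s (≤-trans (m≤m+n _ _) le)))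
        (rows r M (hypStep s) (≤-trans (≤-reflexive (sym (+-suc _ r))) le) le′)
    front : ∀ s → onTree (pair bits bits s) leaf (λ e _ → onTree e leaf (λ b _ → b)) ≡ bit (headBit (proj₁ s))
    front ([]     , cs) = refl
    front (w ∷ ws , cs) = refl

opaque

  sameP : P 2
  sameP = ifP v0 (ifP v1 trueP leaf) (ifP v1 leaf trueP)

  sameP-spec : ∀ {N} a b → sem N sameP (bit a ∷ bit b ∷ []) ≡ bit (same a b)
  sameP-spec {N} true  true  = refl
  sameP-spec {N} true  false = refl
  sameP-spec {N} false true  = refl
  sameP-spec {N} false false = refl

Labelled : ℕ → Set
Labelled k = Vec Bool k × Bool

labelled : ∀ {k} → Labelled k → Tree
labelled = pair (bits ∘ toList) bit

fitStep : ∀ {k} → ℕ → List Bool → Bool → Labelled k → Bool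
fitStep r cs a (z , v) = a ∧ same (hyp r (toList z) cs) v

fits : ∀ {k} → ℕ → List (Labelled k) → List Bool → Bool
fits r S cs = List.foldl (fitStep r cs) true S

dotStep : List Bool × Bool → Bool → List Bool × Bool
dotStep ([]     , o) a = [] , o
dotStep (b ∷ cs , o) a = cs , (a ∧ b) xor o

hashStep : ∀ {λ′} → List Bool → List Bool × List Bool → Vec Bool λ′ → List Bool × List Bool
hashStep rb (hs , _) row = proj₂ r ∷ hs , proj₁ r
  where r = List.foldl dotStep (true ∷ rb , false) (toList row)

-- All rows read the same leading bits of the string, so each leaves the same remainder and the last
-- one can be kept. The hash values come out in the reverse order of the rows.
hashes : ∀ {λ′ n} → Vec (Vec Bool λ′) n → List Bool → List Bool × List Bool
hashes coins rb = List.foldl (hashStep rb) ([] , []) (toList coins)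

cmpStep : List Bool × Bool → Bool → List Bool × Bool
cmpStep ([]    , ok) h = [] , false
cmpStep (b ∷ v , ok) h = v , (ok ∧ same b h)

matrix : ∀ {λ′ n} → Vec (Vec Bool λ′) n → Tree
matrix = listOf (bits ∘ toList) ∘ toList

-- A search string is a hypothesis followed by its claimed hash values in reverse order. The search
-- fixes strings from their end, so the value of the first row is decided first; this makes the
-- maximum prefer many leading passed rows.
chosen : ∀ {k λ′ n} → ℕ → List (Labelled k) → Vec (Vec Bool λ′) n → List Bool → Bool
chosen r S coins rb = fits r S rb ∧
  proj₂ (List.foldl cmpStep (proj₂ (hashes coins rb) , true) (proj₁ (hashes coins rb)))


opaque

  fitStepP : P 4
  fitStepP = ifP v1 (match v0 leaf (app₂ sameP (ren (#4 ∷ #0 ∷ #5 ∷ []) hypP) v1)) leaf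

  fitStepP-spec : ∀ {N k} r cs (e : Labelled k) a → k + r ≤ N →
    sem N fitStepP (labelled e ∷ bit a ∷ encodeℕ r ∷ bits cs ∷ []) ≡ bit (fitStep r cs a e)
  fitStepP-spec     r cs (z , v) false le = refl
  fitStepP-spec {N} r cs (z , v) true  le = trans
    (cong (λ h → sem N sameP (h ∷ bit v ∷ []))
      (hypP-spec r (toList z) cs (≤-trans (≤-reflexive (cong (_+ r) (length-toList z))) le)))
    (sameP-spec (hyp r (toList z) cs) v)

opaque

  fitsP : P 3
  fitsP = fold v1 trueP (ren (#0 ∷ #1 ∷ #2 ∷ #4 ∷ []) fitStepP)

  fitsP-spec : ∀ {N k} r (S : List (Labelled k)) cs → length S ≤ N → k + r ≤ N →
    sem N fitsP (encodeℕ r ∷ listOf labelled S ∷ bits cs ∷ []) ≡ bit (fits r S cs)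
  fitsP-spec r S cs leS le =
    foldT-listOf bit labelled (fitStep r cs) (λ e a → fitStepP-spec r cs e a le) true S leS

opaque

  dotStepP : P 2
  dotStepP = match v1 leaf (match v0 (leaf · v1) (v1 · ifP v4 (ifP v0 (ifP v3 leaf trueP) v3) v3))

  dotStepP-spec : ∀ {N} a s → sem N dotStepP (bit a ∷ pair bits bit s ∷ []) ≡ pair bits bit (dotStep s a)
  dotStepP-spec {N} a     ([]         , o)     = refl
  dotStepP-spec {N} false (b ∷ cs     , o)     = refl
  dotStepP-spec {N} true  (false ∷ cs , o)     = refl
  dotStepP-spec {N} true  (true ∷ cs  , false) = refl
  dotStepP-spec {N} true  (true ∷ cs  , true)  = refl

opaque

  hashStepP : P 3
  hashStepP = bind (fold v0 ((trueP · v2) · leaf) (ren (#0 ∷ #1 ∷ []) dotStepP))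
    (match v0 leaf (match v4 leaf ((v3 · v0) · v2)))

  hashStepP-spec : ∀ {N λ′} rb (row : Vec Bool λ′) s → λ′ ≤ N →
    sem N hashStepP (bits (toList row) ∷ pair bits bits s ∷ bits rb ∷ []) ≡ pair bits bits (hashStep rb s row)
  hashStepP-spec {N} rb row (hs , _) le
    rewrite foldT-listOf {f = λ x u → sem N dotStepP (x ∷ u ∷ [])} (pair bits bit) bit dotStep dotStepP-spec {N}
      (true ∷ rb , false) (toList row) (≤-trans (≤-reflexive (length-toList row)) le) = refl

opaque

  hashP : P 2
  hashP = fold v0 (leaf · leaf) (ren (#0 ∷ #1 ∷ #3 ∷ []) hashStepP)

  hashP-spec : ∀ {N λ′ n} (coins : Vec (Vec Bool λ′) n) rb → λ′ ≤ N → n ≤ N →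
    sem N hashP (matrix coins ∷ bits rb ∷ []) ≡ pair bits bits (hashes coins rb)
  hashP-spec coins rb leλ len = foldT-listOf (pair bits bits) (bits ∘ toList) (hashStep rb)
    (λ row s → hashStepP-spec rb row s leλ) ([] , [])
    (toList coins) (≤-trans (≤-reflexive (length-toList coins)) len)

opaque

  cmpStepP : P 2
  cmpStepP = match v1 leaf (match v0 (leaf · leaf) (v1 · ifP v3 (app₂ sameP v0 v4) leaf))

  cmpStepP-spec : ∀ {N} h s → sem N cmpStepP (bit h ∷ pair bits bit s ∷ []) ≡ pair bits bit (cmpStep s h)
  cmpStepP-spec {N} h ([]    , ok)    = refl
  cmpStepP-spec {N} h (b ∷ v , false) = refl
  cmpStepP-spec {N} h (b ∷ v , true)  = cong (bits v ·_) (sameP-spec b h)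

opaque

  chosenP : P 4
  chosenP = ifP (ren (#0 ∷ #1 ∷ #3 ∷ []) fitsP)
    (match (ren (#2 ∷ #3 ∷ []) hashP) leaf
      (match (fold v0 (v1 · trueP) (ren (#0 ∷ #1 ∷ []) cmpStepP)) leaf v1))
    leaf

  hashes-length : ∀ {λ′ n} (coins : Vec (Vec Bool λ′) n) rb s →
    length (proj₁ (List.foldl (hashStep rb) s (toList coins))) ≡ n + length (proj₁ s)
  hashes-length []            rb s = refl
  hashes-length {n = suc n} (row ∷ coins) rb s =
    trans (hashes-length coins rb (hashStep rb s row)) (+-suc n _)

  chosenP-spec : ∀ {N} {k λ′ n} r (S : List (Labelled k)) (coins : Vec (Vec Bool λ′) n) rb →
    length S ≤ N → k + r ≤ N → λ′ ≤ N → n ≤ N →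
    sem N chosenP (encodeℕ r ∷ listOf labelled S ∷ matrix coins ∷ bits rb ∷ []) ≡ bit (chosen r S coins rb)
  chosenP-spec {N} r S coins rb leS lek leλ len rewrite fitsP-spec r S rb leS lek with fits r S rb
  ... | false = refl
  ... | true rewrite hashP-spec coins rb leλ len
    | foldT-listOf {f = λ x u → sem N cmpStepP (x ∷ u ∷ [])} (pair bits bit) bit cmpStep cmpStepP-spec {N} (proj₂ (hashes coins rb) , true) (proj₁ (hashes coins rb))
        (≤-trans (≤-reflexive (trans (hashes-length coins rb ([] , [])) (+-identityʳ _))) len) = refl

sliceStep : List Bool × List Bool → List Bool × List Bool
sliceStep (e , [])     = e , []
sliceStep (e , b ∷ cs) = b ∷ e , cs

sliced : ∀ {k} (z : Vec Bool k) cs e → iterate sliceStep (e , toList z ++ cs) k ≡ (toList z List.ʳ++ e , cs)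
sliced []      cs e = refl
sliced (b ∷ z) cs e = sliced z cs (b ∷ e)

opaque

  sliceStepP : P 1
  sliceStepP = match v0 leaf (match v1 (v0 · leaf) ((v0 · v2) · v1))

  sliceStepP-spec : ∀ {N} s → sem N sliceStepP (pair bits bits s ∷ []) ≡ pair bits bits (sliceStep s)
  sliceStepP-spec (e , [])     = refl
  sliceStepP-spec (e , b ∷ cs) = refl

opaque

  -- In an assignment written as x followed by y, the inputs of the circuit sought are the first k
  -- bits and the value of the output variable is the bit after them. Slicing thus turns an
  -- assignment into a labelled example.
  sliceP : P 2
  sliceP = match (fold v0 (leaf · v1) (ren (#1 ∷ []) sliceStepP)) leaf (app₁ reverseP v0 · match v1 leaf v0)

  sliceP-spec : ∀ {N k} (z : Vec Bool k) cs → k ≤ N →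
    sem N sliceP (encodeℕ k ∷ bits (toList z ++ cs) ∷ []) ≡ labelled (z , headBit cs)
  sliceP-spec {N} {k} z cs le
    rewrite foldT-nat {f = λ _ u → sem N sliceStepP (u ∷ [])} (pair bits bits) sliceStep sliceStepP-spec
              {N} ([] , toList z ++ cs) k le
          | sliced z cs [] | reverseP-spec {N} bit (List.reverse (toList z))
              (≤-trans (≤-reflexive (trans (length-reverse (toList z)) (length-toList z))) le)
          | reverse-involutive (toList z)
    = cong (bits (toList z) ·_) (front cs)
    where
    front : ∀ cs → onTree (bits cs) leaf (λ l _ → l) ≡ bit (headBit cs)
    front []      = refl
    front (b ∷ _) = refl

Ballots : ℕ → ℕ → Set
Ballots a b = Vec (Vec (List Bool) b) a

ballots : ∀ {a b} → Ballots a b → Tree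
ballots = listOf (listOf bits ∘ toList) ∘ toList

andStep : ℕ → List Bool → Bool → List Bool → Bool
andStep r ws a cs = a ∧ hyp r ws cs

orStep : ∀ {b} → ℕ → List Bool → Bool → Vec (List Bool) b → Bool
orStep r ws o g = o ∨ List.foldl (andStep r ws) true (toList g)

poll : ∀ {a b} → ℕ → List Bool → Ballots a b → Bool
poll r ws = orAnd (hyp r ws)

foldl-andStep : ∀ r ws {b} a (g : Vec (List Bool) b) → List.foldl (andStep r ws) a (toList g) ≡ a ∧ allV (hyp r ws) g
foldl-andStep r ws a []       = sym (∧-identityʳ a)
foldl-andStep r ws a (cs ∷ g) = trans (foldl-andStep r ws _ g) (∧-assoc a _ _)

foldl-orStep : ∀ r ws {a b} o (Ms : Ballots a b) → List.foldl (orStep r ws) o (toList Ms) ≡ o ∨ poll r ws Ms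
foldl-orStep r ws o []       = sym (∨-identityʳ o)
foldl-orStep r ws o (g ∷ Ms) = trans (foldl-orStep r ws _ Ms)
  (trans (cong (λ u → (o ∨ u) ∨ poll r ws Ms) (foldl-andStep r ws true g)) (∨-assoc o _ _))

opaque

  andStepP : P 4
  andStepP = ifP v1 (ren (#2 ∷ #3 ∷ #0 ∷ []) hypP) leaf

  andStepP-spec : ∀ {N} r ws cs a → length ws + r ≤ N →
    sem N andStepP (bits cs ∷ bit a ∷ encodeℕ r ∷ bits ws ∷ []) ≡ bit (andStep r ws a cs)
  andStepP-spec r ws cs true  le = hypP-spec r ws cs le
  andStepP-spec r ws cs false le = refl

opaque

  orStepP : P 4
  orStepP = ifP v1 trueP (fold v0 trueP (ren (#0 ∷ #1 ∷ #4 ∷ #5 ∷ []) andStepP))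

  orStepP-spec : ∀ {N b} r ws (g : Vec (List Bool) b) o → length ws + r ≤ N → b ≤ N →
    sem N orStepP (listOf bits (toList g) ∷ bit o ∷ encodeℕ r ∷ bits ws ∷ []) ≡ bit (orStep r ws o g)
  orStepP-spec r ws g true  le leb = refl
  orStepP-spec r ws g false le leb = foldT-listOf bit bits (andStep r ws) (λ cs a → andStepP-spec r ws cs a le)
    true (toList g) (≤-trans (≤-reflexive (length-toList g)) leb)

opaque

  pollP : P 3
  pollP = fold v2 leaf (ren (#0 ∷ #1 ∷ #2 ∷ #3 ∷ []) orStepP)

  pollP-spec : ∀ {N a b} r ws (Ms : Ballots a b) → length ws + r ≤ N → a ≤ N → b ≤ N →
    sem N pollP (encodeℕ r ∷ bits ws ∷ ballots Ms ∷ []) ≡ bit (poll r ws Ms)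
  pollP-spec {N} r ws Ms le lea leb = trans
    (foldT-listOf bit (listOf bits ∘ toList) (orStep r ws) (λ g o → orStepP-spec r ws g o le leb)
      false (toList Ms) (≤-trans (≤-reflexive (length-toList Ms)) lea))
    (cong bit (foldl-orStep r ws false Ms))

tailBits : List Bool → List Bool
tailBits []       = []
tailBits (_ ∷ cs) = cs

opaque

  dropP : P 2
  dropP = fold v0 v1 (match v1 leaf v1)

  dropP-spec : ∀ {N} j cs → j ≤ N → sem N dropP (encodeℕ j ∷ bits cs ∷ []) ≡ bits (iterate tailBits cs j)
  dropP-spec j cs le = foldT-nat bits tailBits (λ { [] → refl ; (b ∷ cs) → refl }) cs j le

nth : ℕ → List Bool → Bool
nth j cs = headBit (iterate tailBits cs j)

opaque

  nthP : P 2
  nthP = match dropP leaf v0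

  nthP-spec : ∀ {N} j cs → j ≤ N → sem N nthP (encodeℕ j ∷ bits cs ∷ []) ≡ bit (nth j cs)
  nthP-spec {N} j cs le rewrite dropP-spec {N} j cs le with iterate tailBits cs j
  ... | []    = refl
  ... | b ∷ _ = refl

-- A stack machine evaluates formulas; a task marked true is an operator
-- whose operands have been evaluated.

Task : ℕ → ℕ → Set
Task n m = Bool × Formula n m

Machine : ℕ → ℕ → Set
Machine n m = List (Task n m) × List Bool

machine : ∀ {n m} → Machine n m → Tree
machine = pair (listOf (pair bit encodeFormula)) bits

evalStep : ∀ {n m} → List Bool → Machine n m → Machine n m
evalStep         rb ([] , vs)                    = [] , vs
evalStep         rb ((false , X j) ∷ ts , vs)     = ts , nth (toℕ j) rb ∷ vs
evalStep {n = n} rb ((false , Y j) ∷ ts , vs)     = ts , nth (toℕ j) (iterate tailBits rb n) ∷ vs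
evalStep         rb ((false , const b) ∷ ts , vs) = ts , b ∷ vs
evalStep         rb ((false , neg F) ∷ ts , vs)   = (false , F) ∷ (true , neg F) ∷ ts , vs
evalStep         rb ((false , and F G) ∷ ts , vs) = (false , F) ∷ (false , G) ∷ (true , and F G) ∷ ts , vs
evalStep         rb ((false , or F G) ∷ ts , vs)  = (false , F) ∷ (false , G) ∷ (true , or F G) ∷ ts , vs
evalStep         rb ((true , neg F) ∷ ts , v ∷ vs)       = ts , not v ∷ vs
evalStep         rb ((true , and F G) ∷ ts , v ∷ u ∷ vs) = ts , (u ∧ v) ∷ vs
evalStep         rb ((true , or F G) ∷ ts , v ∷ u ∷ vs)  = ts , (u ∨ v) ∷ vs
evalStep         rb ((true , F) ∷ ts , vs)               = ts , vs

opaque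

  evalStepP : P 3
  evalStepP = match v0 leaf (match v0 (leaf · v1) (match v0 leaf (match v1 leaf (ifP v2 applied visited))))
    where
    visited applied binary popped : P 11
    binary = match v1 leaf (((leaf · v0) · ((leaf · v1) · ((trueP · v5) · v7))) · v9)
    popped = v5 · v7
    visited = switch v0
      ( v5 · (app₂ nthP v1 v10 · v7)
      ∷ v5 · (app₂ nthP v1 (app₂ dropP v9 v10) · v7)
      ∷ v5 · (v1 · v7)
      ∷ ((leaf · v1) · ((trueP · v3) · v5)) · v7
      ∷ binary ∷ binary ∷ [])
    applied = switch v0
      ( popped ∷ popped ∷ popped
      ∷ match v7 popped (v7 · (ifP v0 leaf trueP · v1))
      ∷ match v7 popped (match v1 (v7 · v9) (v9 · (ifP v0 v2 leaf · v1)))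
      ∷ match v7 popped (match v1 (v7 · v9) (v9 · (ifP v0 trueP v2 · v1))) ∷ [])

  evalStepP-spec : ∀ {N n m} rb (s : Machine n m) → n ≤ N → m ≤ N →
    sem N evalStepP (machine s ∷ encodeℕ n ∷ bits rb ∷ []) ≡ machine (evalStep rb s)
  evalStepP-spec rb ([] , vs) len lem = refl
  evalStepP-spec rb ((false , X j) ∷ ts , vs) len lem =
    cong (λ v → listOf _ ts · (v · bits vs)) (nthP-spec (toℕ j) rb (≤-trans (<⇒≤ (toℕ<n j)) len))
  evalStepP-spec {N} {n} rb ((false , Y j) ∷ ts , vs) len lem =
    cong (λ v → listOf _ ts · (v · bits vs))
      (trans (cong (λ u → sem N nthP (encodeFin j ∷ u ∷ [])) (dropP-spec n rb len))
        (nthP-spec (toℕ j) (iterate tailBits rb n) (≤-trans (<⇒≤ (toℕ<n j)) lem)))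
  evalStepP-spec rb ((false , const b) ∷ ts , vs) len lem = refl
  evalStepP-spec rb ((false , neg F) ∷ ts , vs)   len lem = refl
  evalStepP-spec rb ((false , and F G) ∷ ts , vs) len lem = refl
  evalStepP-spec rb ((false , or F G) ∷ ts , vs)  len lem = refl
  evalStepP-spec rb ((true , X j) ∷ ts , vs)      len lem = refl
  evalStepP-spec rb ((true , Y j) ∷ ts , vs)      len lem = refl
  evalStepP-spec rb ((true , const b) ∷ ts , vs)  len lem = refl
  evalStepP-spec rb ((true , neg F) ∷ ts , [])    len lem = refl
  evalStepP-spec rb ((true , neg F) ∷ ts , true ∷ vs)  len lem = refl
  evalStepP-spec rb ((true , neg F) ∷ ts , false ∷ vs) len lem = refl
  evalStepP-spec rb ((true , and F G) ∷ ts , [])       len lem = refl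
  evalStepP-spec rb ((true , and F G) ∷ ts , v ∷ [])   len lem = refl
  evalStepP-spec rb ((true , and F G) ∷ ts , v ∷ true ∷ vs)  len lem = refl
  evalStepP-spec rb ((true , and F G) ∷ ts , v ∷ false ∷ vs) len lem = refl
  evalStepP-spec rb ((true , or F G) ∷ ts , [])        len lem = refl
  evalStepP-spec rb ((true , or F G) ∷ ts , v ∷ [])    len lem = refl
  evalStepP-spec rb ((true , or F G) ∷ ts , v ∷ true ∷ vs)  len lem = refl
  evalStepP-spec rb ((true , or F G) ∷ ts , v ∷ false ∷ vs) len lem = refl

iterate-+ : ∀ {A : Set} (f : A → A) a i j → iterate f a (i + j) ≡ iterate f (iterate f a i) j
iterate-+ f a zero    j = refl
iterate-+ f a (suc i) j = iterate-+ f (f a) i j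

nth-lookup : ∀ {k} (z : Vec Bool k) j → nth (toℕ j) (toList z) ≡ lookup z j
nth-lookup (b ∷ z) zero    = refl
nth-lookup (b ∷ z) (suc j) = nth-lookup z j

nth-++ : ∀ {k} (z : Vec Bool k) cs j → nth (toℕ j) (toList z ++ cs) ≡ lookup z j
nth-++ (b ∷ z) cs zero    = refl
nth-++ (b ∷ z) cs (suc j) = nth-++ z cs j

tailBits-++ : ∀ {k} (z : Vec Bool k) cs → iterate tailBits (toList z ++ cs) k ≡ cs
tailBits-++ []      cs = refl
tailBits-++ (b ∷ z) cs = tailBits-++ z cs

duration : ∀ {n m} → Formula n m → ℕ
duration (X j)     = 1
duration (Y j)     = 1
duration (const b) = 1
duration (neg F)   = suc (duration F + 1)
duration (and F G) = suc (duration F + (duration G + 1))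
duration (or F G)  = suc (duration F + (duration G + 1))

duration≤ : ∀ {n m} (F : Formula n m) → duration F ≤ 2 * nodes F
duration≤ (X j)     = s≤s z≤n
duration≤ (Y j)     = s≤s z≤n
duration≤ (const b) = s≤s z≤n
duration≤ (neg F)   = ≤-trans (s≤s (+-monoˡ-≤ 1 (duration≤ F))) (≤-reflexive (lemma (nodes F)))
  where
  lemma : ∀ a → 1 + (2 * a + 1) ≡ 2 * (1 + a)
  lemma = solve-∀
duration≤ (and F G) = ≤-trans (s≤s (+-mono-≤ (duration≤ F) (+-monoˡ-≤ 1 (duration≤ G)))) (≤-reflexive (lemma (nodes F) (nodes G)))
  where
  lemma : ∀ a b → 1 + (2 * a + (2 * b + 1)) ≡ 2 * (1 + (a + b))
  lemma = solve-∀
duration≤ (or F G)  = ≤-trans (s≤s (+-mono-≤ (duration≤ F) (+-monoˡ-≤ 1 (duration≤ G)))) (≤-reflexive (lemma (nodes F) (nodes G)))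
  where
  lemma : ∀ a b → 1 + (2 * a + (2 * b + 1)) ≡ 2 * (1 + (a + b))
  lemma = solve-∀

module _ {n m} (x : Vec Bool n) (y : Vec Bool m) where

  private
    step : Machine n m → Machine n m
    step = evalStep (toList x ++ toList y)

  evaluates : ∀ F ts vs → iterate step ((false , F) ∷ ts , vs) (duration F) ≡ (ts , ⟦ F ⟧ x y ∷ vs)
  evaluates (X j)     ts vs = cong (λ b → ts , b ∷ vs) (nth-++ x (toList y) j)
  evaluates (Y j)     ts vs = cong (λ b → ts , b ∷ vs)
    (trans (cong (nth (toℕ j)) (tailBits-++ x (toList y))) (nth-lookup y j))
  evaluates (const b) ts vs = refl
  evaluates (neg F)   ts vs = trans (iterate-+ step _ (duration F) 1)
    (cong step (evaluates F ((true , neg F) ∷ ts) vs))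
  evaluates (and F G) ts vs = trans (iterate-+ step _ (duration F) _)
    (trans (cong (λ s → iterate step s (duration G + 1)) (evaluates F ((false , G) ∷ (true , and F G) ∷ ts) vs))
    (trans (iterate-+ step _ (duration G) 1)
    (cong step (evaluates G ((true , and F G) ∷ ts) (⟦ F ⟧ x y ∷ vs)))))
  evaluates (or F G) ts vs = trans (iterate-+ step _ (duration F) _)
    (trans (cong (λ s → iterate step s (duration G + 1)) (evaluates F ((false , G) ∷ (true , or F G) ∷ ts) vs))
    (trans (iterate-+ step _ (duration G) 1)
    (cong step (evaluates G ((true , or F G) ∷ ts) (⟦ F ⟧ x y ∷ vs)))))

  final : Formula n m → ℕ → Machine n m
  final F N = iterate step ((false , F) ∷ [] , []) N

  halted : ∀ vs N → iterate step ([] , vs) N ≡ ([] , vs)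
  halted vs zero    = refl
  halted vs (suc N) = halted vs N

  final-after : ∀ F N → duration F ≤ N → final F N ≡ ([] , ⟦ F ⟧ x y ∷ [])
  final-after F N le = begin
    final F N                                    ≡⟨ cong (final F) (m+[n∸m]≡n le) ⟨
    final F (duration F + (N ∸ duration F))      ≡⟨ iterate-+ step _ (duration F) _ ⟩
    iterate step (final F (duration F)) (N ∸ duration F) ≡⟨ cong (λ s → iterate step s (N ∸ duration F)) (evaluates F [] []) ⟩
    iterate step ([] , ⟦ F ⟧ x y ∷ []) (N ∸ duration F)  ≡⟨ halted _ (N ∸ duration F) ⟩
    ([] , ⟦ F ⟧ x y ∷ []) ∎
    where open ≡-Reasoning

  -- A halted machine stays as it is, so its stack is that of a run continued by `duration F`
  -- further steps, which certainly is long enough. Hence a finished evaluation is right for every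
  -- clock.
  final-value : ∀ F N vs → final F N ≡ ([] , vs) → headBit vs ≡ ⟦ F ⟧ x y
  final-value F N vs e = cong (headBit ∘ proj₂) (begin
    ([] , vs)                                 ≡⟨ halted vs (duration F) ⟨
    iterate step ([] , vs) (duration F)       ≡⟨ cong (λ s → iterate step s (duration F)) e ⟨
    iterate step (final F N) (duration F)     ≡⟨ iterate-+ step _ N (duration F) ⟨
    final F (N + duration F)                  ≡⟨ final-after F (N + duration F) (m≤n+m _ N) ⟩
    ([] , ⟦ F ⟧ x y ∷ []) ∎)
    where open ≡-Reasoning

outcome : ∀ {n m} → Machine n m → Bool × Bool
outcome ([]    , vs) = true , headBit vs
outcome (_ ∷ _ , vs) = false , false

foldT-clock : {A : Set} {f : Tree → Tree → Tree} (eA : A → Tree) (g : A → A) → (∀ x a → f x (eA a) ≡ eA (g a)) →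
  ∀ t a → foldT (spine t) f (eA a) t ≡ eA (iterate g a (spine t))
foldT-clock     eA g sim leaf    a = refl
foldT-clock {f = f} eA g sim (x · t) a =
  trans (cong (λ u → foldT (spine t) f u t) (sim x a)) (foldT-clock eA g sim t (g a))

opaque

  formulaP : P 4
  formulaP = bind (fold v0 (((leaf · v1) · leaf) · leaf) (ren (#1 ∷ #4 ∷ #5 ∷ []) evalStepP))
    (match v0 leaf (match v0 (trueP · match v1 leaf v0) (leaf · leaf)))

  formulaP-spec : ∀ clk {n m} (F : Formula n m) rb → n ≤ spine clk → m ≤ spine clk →
    sem (spine clk) formulaP (clk ∷ encodeFormula F ∷ encodeℕ n ∷ bits rb ∷ []) ≡
      pair bit bit (outcome (iterate (evalStep rb) ((false , F) ∷ [] , []) (spine clk)))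
  formulaP-spec clk {n} F rb len lem
    rewrite foldT-clock {f = λ _ u → sem (spine clk) evalStepP (u ∷ encodeℕ n ∷ bits rb ∷ [])} machine (evalStep rb)
      (λ _ s → evalStepP-spec rb s len lem) clk ((false , F) ∷ [] , [])
    with iterate (evalStep rb) ((false , F) ∷ [] , []) (spine clk)
  ... | []    , []    = refl
  ... | []    , _ ∷ _ = refl
  ... | _ ∷ _ , _     = refl

-- An unfinished evaluation counts as a refutation, so that a failed search
-- for refutations certifies correctness however short the clock is.
refuted : Bool × Bool → Bool → Bool
refuted (finished , value) wrong = if finished then value ∧ wrong else true

opaque

  refuteP : P 7
  refuteP = match (ren (#0 ∷ #3 ∷ #1 ∷ #6 ∷ []) formulaP) leaf
    (ifP v0 (ifP v1 (match (ren (#4 ∷ #8 ∷ []) sliceP) leaf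
      (ifP (app₂ sameP (ren (#8 ∷ #0 ∷ #9 ∷ []) pollP) v1) leaf trueP)) leaf) trueP)

  refuteP-spec : ∀ clk {n m k a b} (F : Formula n m) r (Ms : Ballots a b) rb (z : Vec Bool k) cs →
    rb ≡ toList z ++ cs → n ≤ spine clk → m ≤ spine clk → k + r ≤ spine clk → a ≤ spine clk → b ≤ spine clk →
    sem (spine clk) refuteP (clk ∷ encodeℕ n ∷ encodeℕ k ∷ encodeFormula F ∷ encodeℕ r ∷ ballots Ms ∷ bits rb ∷ []) ≡
      bit (refuted (outcome (iterate (evalStep rb) ((false , F) ∷ [] , []) (spine clk)))
                   (poll r (toList z) Ms xor headBit cs))
  refuteP-spec clk {n} {m} {k} F r Ms rb z cs refl len lem lek lea leb
    rewrite formulaP-spec clk F rb len lem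
    with outcome (iterate (evalStep rb) ((false , F) ∷ [] , []) (spine clk))
  ... | false , value = refl
  ... | true  , false = refl
  ... | true  , true
    rewrite sliceP-spec {spine clk} z cs (≤-trans (m≤m+n k r) lek)
          | pollP-spec {spine clk} r (toList z) Ms (≤-trans (≤-reflexive (cong (_+ r) (length-toList z))) lek) lea leb
          | sameP-spec {spine clk} (poll r (toList z) Ms) (headBit cs)
    with poll r (toList z) Ms xor headBit cs
  ... | true  = refl
  ... | false = refl

-- Oracle queries and bitwise search

-- The first component tells the two kinds of query apart, so that a single oracle answers both.
choosing : ∀ {k λ′ n} → ℕ → List (Labelled k) → Vec (Vec Bool λ′) n → Tree
choosing r S coins = leaf · (encodeℕ r · (listOf labelled S · matrix coins))

refuting : ∀ {n m a b} → ℕ → Formula n m → ℕ → Ballots a b → Tree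
refuting {n} k F r Ms = (leaf · leaf) · (encodeℕ n · (encodeℕ k · (encodeFormula F · (encodeℕ r · ballots Ms))))

opaque

  coreP : P 3
  coreP = match v1 leaf (match v0
    (match v1 leaf (match v1 leaf (ren (#2 ∷ #0 ∷ #1 ∷ #8 ∷ []) chosenP)))
    (match v3 leaf (match v1 leaf (match v1 leaf (match v1 leaf
      (ren (#12 ∷ #6 ∷ #4 ∷ #2 ∷ #0 ∷ #1 ∷ #14 ∷ []) refuteP))))))

  coreP-choosing : ∀ {N} clk {k λ′ n} r (S : List (Labelled k)) (coins : Vec (Vec Bool λ′) n) rb →
    length S ≤ N → k + r ≤ N → λ′ ≤ N → n ≤ N →
    sem N coreP (clk ∷ choosing r S coins ∷ bits rb ∷ []) ≡ bit (chosen r S coins rb)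
  coreP-choosing clk = chosenP-spec

  coreP-refuting : ∀ clk {n m k a b} (F : Formula n m) r (Ms : Ballots a b) rb (z : Vec Bool k) cs →
    rb ≡ toList z ++ cs → n ≤ spine clk → m ≤ spine clk → k + r ≤ spine clk → a ≤ spine clk → b ≤ spine clk →
    sem (spine clk) coreP (clk ∷ refuting k F r Ms ∷ bits rb ∷ []) ≡
      bit (refuted (outcome (iterate (evalStep rb) ((false , F) ∷ [] , []) (spine clk)))
                   (poll r (toList z) Ms xor headBit cs))
  coreP-refuting = refuteP-spec

-- Witnesses are arbitrary trees. Reading an entry as true when it is a node, and padding short
-- witnesses with false, makes every tree supply as many bits as are asked for.
extend : List Bool × Tree → List Bool × Tree
extend (p , leaf)  = false ∷ p , leaf
extend (p , b · w) = isNode b ∷ p , w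

-- The question is whether `r` bits can be put in front of `p` so that `coreP` accepts the whole
-- string.
query : Tree → Tree → ℕ → List Bool → Tree
query clk body r p = clk · (body · (encodeℕ r · bits p))

opaque

  extendP : P 1
  extendP = match v0 leaf (match v1 ((leaf · v0) · leaf) ((ifP v0 trueP leaf · v2) · v1))

  extendP-spec : ∀ {N} s → sem N extendP (pair bits id s ∷ []) ≡ pair bits id (extend s)
  extendP-spec (p , leaf)          = refl
  extendP-spec (p , leaf · w)      = refl
  extendP-spec (p , (_ · _) · w)   = refl

opaque

  verifyP : P 3
  verifyP = match v1 leaf (match v1 leaf (match (fold v0 (v1 · v6) (ren (#1 ∷ []) extendP)) leaf
    (ren (#6 ∷ #4 ∷ #0 ∷ []) coreP)))

  verifyP-spec : ∀ {N} clk body r p w → r ≤ N →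
    sem N verifyP (clk ∷ body · (encodeℕ r · bits p) ∷ w ∷ []) ≡
      sem N coreP (clk ∷ body ∷ bits (proj₁ (iterate extend (p , w) r)) ∷ [])
  verifyP-spec {N} clk body r p w le
    rewrite foldT-nat {f = λ _ u → sem N extendP (u ∷ [])} (pair bits id) extend extendP-spec {N} (p , w) r le = refl

extended : ∀ r p w → ∃ λ u → length u ≡ r × proj₁ (iterate extend (p , w) r) ≡ u ++ p
extended zero    p w = [] , refl , refl
extended (suc r) p w = more w
  where
  more : ∀ w → ∃ λ u → length u ≡ suc r × proj₁ (iterate extend (extend (p , w)) r) ≡ u ++ p
  snoc : ∀ b w → ∃ λ u → length u ≡ suc r × proj₁ (iterate extend (b ∷ p , w) r) ≡ u ++ p
  snoc b w with extended r (b ∷ p) w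
  ... | u , len , eq = u List.∷ʳ b , trans (length-++ u) (trans (+-comm (length u) 1) (cong suc len)) ,
    trans eq (sym (++-assoc u (b ∷ []) p))
  more leaf    = snoc false leaf
  more (b · w) = snoc (isNode b) w

extended-bits : ∀ vs p → proj₁ (iterate extend (p , bits vs) (length vs)) ≡ vs List.ʳ++ p
extended-bits []           p = refl
extended-bits (true ∷ vs)  p = extended-bits vs (true ∷ p)
extended-bits (false ∷ vs) p = extended-bits vs (false ∷ p)

size-encodeℕ : ∀ n → size (encodeℕ n) ≡ 2 * n + 1
size-encodeℕ zero    = refl
size-encodeℕ (suc n) = trans (cong (λ u → suc (suc u)) (size-encodeℕ n)) (lemma n)
  where
  lemma : ∀ n → 2 + (2 * n + 1) ≡ 2 * (1 + n) + 1
  lemma = solve-∀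

size-listOf : ∀ {A : Set} (e : A → Tree) w → (∀ a → size (e a) ≤ w) → ∀ as → size (listOf e as) ≤ length as * suc w + 1
size-listOf e w le []       = ≤-refl
size-listOf e w le (a ∷ as) = ≤-trans (s≤s (+-mono-≤ (le a) (size-listOf e w le as)))
  (≤-reflexive (sym (+-assoc (suc w) _ 1)))

size-bits : ∀ bs → size (bits bs) ≤ 4 * length bs + 1
size-bits bs = ≤-trans (size-listOf bit 3 (λ { true → ≤-refl ; false → s≤s z≤n }) bs)
  (≤-reflexive (cong (_+ 1) (*-comm (length bs) 4)))

open Verification verifyP using (oracle; oracle-NP; oracle-sound; oracle-complete)

Accepting : Tree → Tree → List Bool → Set
Accepting clk body rb = isNode (sem (spine clk) coreP (clk ∷ body ∷ bits rb ∷ [])) ≡ true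

query-sound : ∀ clk body r p → r ≤ spine clk → oracle (query clk body r p) ≡ true →
  ∃ λ u → length u ≡ r × Accepting clk body (u ++ p)
query-sound clk body r p le asserted with oracle-sound _ asserted
... | w , _ , good with extended r p w
... | u , len , eq = u , len ,
  trans (cong isNode (trans (cong (λ rb → sem (spine clk) coreP (clk ∷ body ∷ bits rb ∷ [])) (sym eq))
    (sym (verifyP-spec clk body r p w le)))) good

-- The witness lists the missing bits in reverse, because `extend` prepends them one at a time. Its
-- size is linear in `r`, which the query contains in unary.
query-complete : ∀ clk body r p u → r ≤ spine clk → length u ≡ r → Accepting clk body (u ++ p) →
  oracle (query clk body r p) ≡ true
query-complete clk body r p u le len acc = oracle-complete (query clk body r p) (bits (List.reverse u)) small
  (trans (cong isNode (trans (verifyP-spec clk body r p (bits (List.reverse u)) le)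
    (cong (λ rb → sem (spine clk) coreP (clk ∷ body ∷ bits rb ∷ [])) reread))) acc)
  where
  open ≤-Reasoning
  len′ : length (List.reverse u) ≡ r
  len′ = trans (length-reverse u) len
  reread : proj₁ (iterate extend (p , bits (List.reverse u)) r) ≡ u ++ p
  reread = trans (cong (λ j → proj₁ (iterate extend (p , bits (List.reverse u)) j)) (sym len′))
    (trans (extended-bits (List.reverse u) p)
    (trans (ʳ++-defn (List.reverse u)) (cong (_++ p) (reverse-involutive u))))
  small : size (bits (List.reverse u)) ≤ 8 * size (query clk body r p)
  small = begin
    size (bits (List.reverse u))         ≤⟨ size-bits (List.reverse u) ⟩
    4 * length (List.reverse u) + 1      ≡⟨ cong (λ j → 4 * j + 1) len′ ⟩
    4 * r + 1                            ≤⟨ +-monoʳ-≤ (4 * r) (m≤n+m 1 1) ⟩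
    4 * r + 2                            ≡⟨ lemma r ⟩
    2 * (2 * r + 1)                      ≡⟨ cong (2 *_) (size-encodeℕ r) ⟨
    2 * size (encodeℕ r)                 ≤⟨ *-mono-≤ {2} {8} (m≤m+n 2 6) inside ⟩
    8 * size (query clk body r p) ∎
    where
    lemma : ∀ r → 4 * r + 2 ≡ 2 * (2 * r + 1)
    lemma = solve-∀
    inside : size (encodeℕ r) ≤ size (query clk body r p)
    inside = ≤-trans (≤-trans (≤-trans (m≤m+n _ (size (bits p))) (n≤1+n _))
      (≤-trans (m≤n+m _ (size body)) (n≤1+n _))) (≤-trans (m≤n+m _ (size clk)) (n≤1+n _))

trues : ∀ k p → List.replicate (suc k) true ++ p ≡ List.replicate k true ++ true ∷ p
trues zero    p = refl
trues (suc k) p = cong (true ∷_) (trues k p)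

module _ (clk body : Tree) where

  -- The answer of the oracle is itself the next bit: `true` is kept exactly when it can still be
  -- completed.
  find : ℕ → List Bool → List Bool
  find zero    p = p
  find (suc r) p = find r (oracle (query clk body r (true ∷ p)) ∷ p)

  find-suffix : ∀ r p → ∃ λ u → length u ≡ r × find r p ≡ u ++ p
  find-suffix zero    p = [] , refl , refl
  find-suffix (suc r) p with find-suffix r (oracle (query clk body r (true ∷ p)) ∷ p)
  ... | u , len , eq = u List.∷ʳ _ , trans (length-++ u) (trans (+-comm (length u) 1) (cong suc len)) ,
    trans eq (sym (++-assoc u _ p))

  private
    shift : ∀ (u : List Bool) b p → (u List.∷ʳ b) ++ p ≡ u ++ b ∷ p
    shift u b p = ++-assoc u (b ∷ []) p

    length-∷ʳ : ∀ (u : List Bool) b {r} → length (u List.∷ʳ b) ≡ suc r → length u ≡ r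
    length-∷ʳ u b e = suc-injective (trans (+-comm 1 (length u)) (trans (sym (length-++ u)) e))

  -- The invariant is that `p` has an accepted completion. If the oracle denies `true`, the known
  -- completion must end in `false`, since otherwise `query-complete` would contradict the answer.
  find-sound : ∀ r p u → r ≤ spine clk → length u ≡ r → Accepting clk body (u ++ p) → Accepting clk body (find r p)
  find-sound zero    p []      le len acc = acc
  find-sound (suc r) p u le len acc with oracle (query clk body r (true ∷ p)) in eq
  ... | true  with query-sound clk body r (true ∷ p) (≤-trans (n≤1+n r) le) eq
  ... | u′ , len′ , acc′ = find-sound r (true ∷ p) u′ (≤-trans (n≤1+n r) le) len′ acc′
  find-sound (suc r) p u le len acc | false with List.initLast u
  ... | u′ List.∷ʳ′ false = find-sound r (false ∷ p) u′ (≤-trans (n≤1+n r) le) (length-∷ʳ u′ false len)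
    (subst (Accepting clk body) (shift u′ false p) acc)
  ... | u′ List.∷ʳ′ true  = ⊥-elim (clash (trans (sym eq)
    (query-complete clk body r (true ∷ p) u′ (≤-trans (n≤1+n r) le) (length-∷ʳ u′ true len)
      (subst (Accepting clk body) (shift u′ true p) acc))))
    where
    clash : false ≢ true
    clash ()

  -- The search tries true first, hence maximises the last bits lexicographically.
  find-prefers : ∀ k r p u → k + r ≤ spine clk → length u ≡ r → Accepting clk body (u ++ List.replicate k true ++ p) →
    Accepting clk body (find (k + r) p) × (∃ λ u′ → length u′ ≡ r × find (k + r) p ≡ u′ ++ List.replicate k true ++ p)
  find-prefers zero    r p u le len acc = find-sound r p u le len acc , find-suffix r p
  find-prefers (suc k) r p u le len acc
    rewrite query-complete clk body (k + r) (true ∷ p) (u ++ List.replicate k true) (≤-trans (n≤1+n _) le)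
      (trans (length-++ u) (trans (cong₂ _+_ len (length-replicate k)) (+-comm r k)))
      (subst (Accepting clk body) (trans (cong (u ++_) (trues k p)) (sym (++-assoc u _ _))) acc)
    with find-prefers k r (true ∷ p) u (≤-trans (n≤1+n _) le) len
      (subst (Accepting clk body) (cong (u ++_) (trues k p)) acc)
  ... | acc′ , u′ , len′ , eq = acc′ , u′ , len′ , trans eq (cong (u′ ++_) (sym (trues k p)))

-- Choosing a hypothesis by its hash values

takePad : ∀ ℓ → List Bool → Vec Bool ℓ
takePad zero    cs       = []
takePad (suc ℓ) []       = false ∷ takePad ℓ []
takePad (suc ℓ) (b ∷ cs) = b ∷ takePad ℓ cs

takePad-drop : ∀ ℓ cs → ℓ ≤ length cs → cs ≡ toList (takePad ℓ cs) ++ List.drop ℓ cs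
takePad-drop zero    cs       le       = refl
takePad-drop (suc ℓ) (b ∷ cs) (s≤s le) = cong (b ∷_) (takePad-drop ℓ cs le)

takePad-++ : ∀ {ℓ} (C : Vec Bool ℓ) cs → takePad ℓ (toList C ++ cs) ≡ C
takePad-++ []      cs = refl
takePad-++ (b ∷ C) cs = cong (b ∷_) (takePad-++ C cs)

dotStep-row : ∀ {ℓ} (C row : Vec Bool ℓ) cs o →
  List.foldl dotStep (toList C ++ cs , o) (toList row) ≡ (cs , dot row C xor o)
dotStep-row []      []        cs o = refl
dotStep-row (c ∷ C) (a ∷ row) cs o =
  trans (dotStep-row C row cs ((a ∧ c) xor o)) (cong (cs ,_) (shuffle (a ∧ c) (dot row C) o))
  where
  shuffle : ∀ a d o → d xor (a xor o) ≡ (a xor d) xor o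
  shuffle false d     o = refl
  shuffle true  false o = refl
  shuffle true  true  true  = refl
  shuffle true  true  false = refl

module _ {ℓ : ℕ} (C : Vec Bool ℓ) (cs : List Bool) where

  hashes-fold : ∀ {n} (coins : Vec (Vec Bool (suc ℓ)) n) hs →
    List.foldl (hashStep (toList C ++ cs)) (hs , cs) (toList coins) ≡ (map (pass₁ C) (toList coins) List.ʳ++ hs , cs)
  hashes-fold []            hs = refl
  hashes-fold (row ∷ coins) hs rewrite dotStep-row (true ∷ C) row cs false | xor-identityʳ (pass₁ C row) =
    hashes-fold coins (pass₁ C row ∷ hs)

  hashes-pass : ∀ {n} (coins : Vec (Vec Bool (suc ℓ)) (suc n)) →
    hashes coins (toList C ++ cs) ≡ (List.reverse (map (pass₁ C) (toList coins)) , cs)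
  hashes-pass (row ∷ coins) rewrite dotStep-row (true ∷ C) row cs false | xor-identityʳ (pass₁ C row) =
    hashes-fold coins (pass₁ C row ∷ [])

cmp-sound : ∀ vs hs ok → length vs ≡ length hs → proj₂ (List.foldl cmpStep (vs , ok) hs) ≡ true → ok ≡ true × vs ≡ hs
cmp-sound []       []       ok len e = e , refl
cmp-sound (b ∷ vs) (h ∷ hs) ok len e with cmp-sound vs hs (ok ∧ same b h) (suc-injective len) e
... | both , eq with ∧-true both
... | ok′ , b≡h = ok′ , cong₂ _∷_ (same-sound b h b≡h) eq

cmp-complete : ∀ hs → proj₂ (List.foldl cmpStep (hs , true) hs) ≡ true
cmp-complete []       = refl
cmp-complete (h ∷ hs) rewrite same-refl h = cmp-complete hs

passes-prefix : ∀ {ℓ n} j (C : Vec Bool ℓ) (coins : Vec (Vec Bool (suc ℓ)) n) → j ≤ n → passes j C coins ≡ true →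
  ∃ λ rest → map (pass₁ C) (toList coins) ≡ List.replicate j true ++ rest
passes-prefix zero    C coins         le       e = _ , refl
passes-prefix (suc j) C (row ∷ coins) (s≤s le) e with ∧-true e
... | p , ps with passes-prefix j C coins le ps
... | rest , eq = rest , cong₂ _∷_ p eq

prefix-passes : ∀ {ℓ n} j (C : Vec Bool ℓ) (coins : Vec (Vec Bool (suc ℓ)) n) rest →
  map (pass₁ C) (toList coins) ≡ List.replicate j true ++ rest → passes j C coins ≡ true
prefix-passes zero    C coins         rest e = refl
prefix-passes (suc j) C []            rest e = refl
prefix-passes (suc j) C (row ∷ coins) rest e =
  cong₂ _∧_ (∷-injectiveˡ e) (prefix-passes j C coins rest (∷-injectiveʳ e))

reverse-replicate : ∀ j → List.reverse (List.replicate j true) ≡ List.replicate j true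
reverse-replicate zero    = refl
reverse-replicate (suc j) = trans (unfold-reverse true (List.replicate j true))
  (trans (cong (List._∷ʳ true) (reverse-replicate j))
    (trans (sym (trues j [])) (cong (true ∷_) (++-identityʳ _))))

module Choosing (clk : Tree) (limit k r : ℕ) (limit≤ : limit ≤ spine clk)
  (k+r≤ : k + r ≤ spine clk) (room : hypLength r k + suc (hypLength r k) ≤ spine clk) where

  ℓ : ℕ
  ℓ = hypLength r k

  ev : Vec Bool ℓ → Vec Bool k → Bool
  ev C z = hyp r (toList z) (toList C)

  agreesWith : List (Labelled k) → Vec Bool ℓ → Bool
  agreesWith = agrees ev

  -- With ℓ + 1 rows there are enough for every scale, and at least one, so that `hashes` returns
  -- the bits after the hypothesis.
  choice : List (Labelled k) → Vec (Vec Bool (suc ℓ)) (suc ℓ) → List Bool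
  choice S coins = find clk (choosing r S coins) (ℓ + suc ℓ) []

  pick : List (Labelled k) → Vec (Vec Bool (suc ℓ)) (suc ℓ) → Vec Bool ℓ
  pick S coins = takePad ℓ (choice S coins)

  length-choice : ∀ S coins → length (choice S coins) ≡ ℓ + suc ℓ
  length-choice S coins with find-suffix clk (choosing r S coins) (ℓ + suc ℓ) []
  ... | u , len , eq = trans (cong length (trans eq (++-identityʳ u))) len

  choice-split : ∀ S coins → choice S coins ≡ toList (pick S coins) ++ List.drop ℓ (choice S coins)
  choice-split S coins = takePad-drop ℓ (choice S coins) (≤-trans (m≤m+n ℓ (suc ℓ)) (≤-reflexive (sym (length-choice S coins))))

  ev-prefix : ∀ (C : Vec Bool ℓ) cs z → hyp r (toList z) (toList C ++ cs) ≡ ev C z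
  ev-prefix C cs z = hyp-++ r (toList z) (toList C) cs
    (trans (length-toList C) (cong (hypLength r) (sym (length-toList z))))

  ev-choice : ∀ S coins z → hyp r (toList z) (choice S coins) ≡ ev (pick S coins) z
  ev-choice S coins z = trans (cong (hyp r (toList z)) (choice-split S coins)) (ev-prefix (pick S coins) _ z)

  fits-agrees : ∀ S C cs → fits r S (toList C ++ cs) ≡ agreesWith S C
  fits-agrees S C cs = go S true
    where
    shuffle : ∀ a b c → (a ∧ b) ∧ c ≡ a ∧ (c ∧ b)
    shuffle false b     c     = refl
    shuffle true  true  true  = refl
    shuffle true  true  false = refl
    shuffle true  false true  = refl
    shuffle true  false false = refl
    go : ∀ S a → List.foldl (fitStep r (toList C ++ cs)) a S ≡ a ∧ agreesWith S C
    go []            a = sym (∧-identityʳ a)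
    go ((z , v) ∷ S) a = trans (go S _) (trans (shuffle a _ _)
      (cong (λ u → a ∧ (agreesWith S C ∧ same u v)) (ev-prefix C cs z)))

  accepting : ∀ S coins rb → length S ≤ limit → chosen r S coins rb ≡ true → Accepting clk (choosing r S coins) rb
  accepting S coins rb short ok = cong isNode (trans (coreP-choosing clk r S coins rb (≤-trans short limit≤) k+r≤ λ≤ λ≤) (cong bit ok))
    where
    λ≤ : suc ℓ ≤ spine clk
    λ≤ = ≤-trans (m≤n+m (suc ℓ) ℓ) room

  accepted : ∀ S coins rb → length S ≤ limit → Accepting clk (choosing r S coins) rb → chosen r S coins rb ≡ true
  accepted S coins rb short acc = node (trans (cong isNode (sym (coreP-choosing clk r S coins rb (≤-trans short limit≤) k+r≤ λ≤ λ≤))) acc)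
    where
    λ≤ : suc ℓ ≤ spine clk
    λ≤ = ≤-trans (m≤n+m (suc ℓ) ℓ) room
    node : ∀ {b} → isNode (bit b) ≡ true → b ≡ true
    node {true} _ = refl

  chosen-complete : ∀ S (coins : Vec (Vec Bool (suc ℓ)) (suc ℓ)) C → agreesWith S C ≡ true →
    chosen r S coins (toList C ++ List.reverse (map (pass₁ C) (toList coins))) ≡ true
  chosen-complete S coins C ok
    rewrite fits-agrees S C (List.reverse (map (pass₁ C) (toList coins))) | ok
          | hashes-pass C (List.reverse (map (pass₁ C) (toList coins))) coins
    = cmp-complete (List.reverse (map (pass₁ C) (toList coins)))

  chosen-sound : ∀ S (coins : Vec (Vec Bool (suc ℓ)) (suc ℓ)) C cs → length cs ≡ suc ℓ → chosen r S coins (toList C ++ cs) ≡ true →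
    agreesWith S C ≡ true × cs ≡ List.reverse (map (pass₁ C) (toList coins))
  chosen-sound S coins C cs len e =
    trans (sym (fits-agrees S C cs)) (proj₁ both) ,
    proj₂ (cmp-sound cs _ true (trans len (sym (trans (length-reverse (map (pass₁ C) (toList coins)))
      (trans (length-map (pass₁ C) (toList coins)) (length-toList coins)))))
      (subst (λ h → proj₂ (List.foldl cmpStep (proj₂ h , true) (proj₁ h)) ≡ true) (hashes-pass C cs coins) (proj₂ both)))
    where
    both : fits r S (toList C ++ cs) ≡ true ×
      proj₂ (List.foldl cmpStep (proj₂ (hashes coins (toList C ++ cs)) , true) (proj₁ (hashes coins (toList C ++ cs)))) ≡ true
    both = ∧-true e

  -- The search string of `C` ends in `j` times true, because its hash values are reversed. By
  -- `find-prefers` the string found is accepted and ends likewise, and acceptance forces its tail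
  -- to be the hash values of its own hypothesis. So the picked hypothesis is consistent and passes
  -- the same rows.
  prefers : ∀ S j coins C → length S ≤ limit → j ≤ suc ℓ → agreesWith S C ≡ true → passes j C coins ≡ true →
    agreesWith S (pick S coins) ≡ true × passes j (pick S coins) coins ≡ true
  prefers S j coins C short j≤ ok pass with passes-prefix j C coins j≤ pass
  ... | rest , eq = proj₁ sound , prefix-passes j (pick S coins) coins (List.reverse v′) prefix
    where
    open ≡-Reasoning
    body : Tree
    body = choosing r S coins
    hs : List Bool
    hs = map (pass₁ C) (toList coins)
    hs-reversed : List.reverse hs ≡ List.reverse rest ++ List.replicate j true
    hs-reversed = trans (cong List.reverse eq) (trans (reverse-++ (List.replicate j true) rest)
      (cong (List.reverse rest ++_) (reverse-replicate j)))
    u : List Bool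
    u = toList C ++ List.reverse rest
    length-rest : length rest ≡ suc ℓ ∸ j
    length-rest = sym (trans (cong (_∸ j) (sym (begin
      j + length rest ≡⟨ cong (_+ length rest) (length-replicate j) ⟨
      length (List.replicate j true) + length rest ≡⟨ length-++ (List.replicate j true) ⟨
      length (List.replicate j true ++ rest) ≡⟨ cong length eq ⟨
      length hs ≡⟨ trans (length-map (pass₁ C) (toList coins)) (length-toList coins) ⟩
      suc ℓ ∎))) (m+n∸m≡n j (length rest)))
    length-u : length u ≡ ℓ + (suc ℓ ∸ j)
    length-u = trans (length-++ (toList C)) (cong₂ _+_ (length-toList C) (trans (length-reverse rest) length-rest))
    total : j + (ℓ + (suc ℓ ∸ j)) ≡ ℓ + suc ℓ
    total = begin
      j + (ℓ + (suc ℓ ∸ j)) ≡⟨ +-assoc j ℓ _ ⟨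
      j + ℓ + (suc ℓ ∸ j)   ≡⟨ cong (_+ (suc ℓ ∸ j)) (+-comm j ℓ) ⟩
      ℓ + j + (suc ℓ ∸ j)   ≡⟨ +-assoc ℓ j _ ⟩
      ℓ + (j + (suc ℓ ∸ j)) ≡⟨ cong (ℓ +_) (m+[n∸m]≡n j≤) ⟩
      ℓ + suc ℓ ∎
    whole : toList C ++ List.reverse hs ≡ u ++ List.replicate j true ++ []
    whole = trans (cong (toList C ++_) hs-reversed)
      (trans (sym (++-assoc (toList C) (List.reverse rest) _)) (cong (u ++_) (sym (++-identityʳ _))))
    searched : Accepting clk body (find clk body (j + (ℓ + (suc ℓ ∸ j))) []) ×
      (∃ λ u′ → length u′ ≡ ℓ + (suc ℓ ∸ j) × find clk body (j + (ℓ + (suc ℓ ∸ j))) [] ≡ u′ ++ List.replicate j true ++ [])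
    searched = find-prefers clk body j (ℓ + (suc ℓ ∸ j)) [] u (≤-trans (≤-reflexive total) room) length-u
      (subst (Accepting clk body) whole (accepting S coins _ short (chosen-complete S coins C ok)))
    u′ v′ : List Bool
    u′ = proj₁ (proj₂ searched)
    v′ = List.drop ℓ u′
    ends : choice S coins ≡ u′ ++ List.replicate j true
    ends = trans (cong (λ t → find clk body t []) (sym total))
      (trans (proj₂ (proj₂ (proj₂ searched))) (cong (u′ ++_) (++-identityʳ _)))
    split′ : List.drop ℓ (choice S coins) ≡ v′ ++ List.replicate j true
    split′ = trans (cong (List.drop ℓ) ends) (drop-++ˡ ℓ u′ (≤-trans (m≤m+n ℓ _) (≤-reflexive (sym (proj₁ (proj₂ (proj₂ searched)))))))
      where
      drop-++ˡ : ∀ ℓ u → ℓ ≤ length u → List.drop ℓ (u ++ List.replicate j true) ≡ List.drop ℓ u ++ List.replicate j true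
      drop-++ˡ zero    u       le       = refl
      drop-++ˡ (suc ℓ) (b ∷ u) (s≤s le) = drop-++ˡ ℓ u le
    length-drop′ : length (List.drop ℓ (choice S coins)) ≡ suc ℓ
    length-drop′ = trans (length-drop ℓ (choice S coins)) (trans (cong (_∸ ℓ) (length-choice S coins)) (m+n∸m≡n ℓ (suc ℓ)))
    sound : agreesWith S (pick S coins) ≡ true ×
      List.drop ℓ (choice S coins) ≡ List.reverse (map (pass₁ (pick S coins)) (toList coins))
    sound = chosen-sound S coins (pick S coins) (List.drop ℓ (choice S coins)) length-drop′
      (subst (λ rb → chosen r S coins rb ≡ true) (choice-split S coins)
        (accepted S coins (choice S coins) short
          (subst (λ t → Accepting clk body (find clk body t [])) total (proj₁ searched))))
    prefix : map (pass₁ (pick S coins)) (toList coins) ≡ List.replicate j true ++ List.reverse v′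
    prefix = begin
      map (pass₁ (pick S coins)) (toList coins) ≡⟨ reverse-involutive (map (pass₁ (pick S coins)) (toList coins)) ⟨
      List.reverse (List.reverse (map (pass₁ (pick S coins)) (toList coins))) ≡⟨ cong List.reverse (trans (sym (proj₂ sound)) split′) ⟩
      List.reverse (v′ ++ List.replicate j true) ≡⟨ reverse-++ v′ (List.replicate j true) ⟩
      List.reverse (List.replicate j true) ++ List.reverse v′ ≡⟨ cong (_++ List.reverse v′) (reverse-replicate j) ⟩
      List.replicate j true ++ List.reverse v′ ∎

-- Circuits under construction grow at the end.  The wire created when there
-- are l wires is called l for good, while its de Bruijn index keeps changing.

data Pre (k : ℕ) : ℕ → Set where
  []  : Pre k k
  _▷_ : ∀ {j} → Pre k j → Gate j → Pre k (suc j)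

vals : ∀ {k j} → Pre k j → Vec Bool k → Vec Bool j
vals []      z = z
vals (p ▷ g) z = evalGate g (vals p z) ∷ vals p z

encodePre : ∀ {k j} → Pre k j → Tree
encodePre []      = leaf
encodePre (p ▷ g) = encodeGate g · encodePre p

close : ∀ {k j} → Pre k j → Circuit j → Circuit k
close []      h = h
close (p ▷ g) h = close p (gate g h)

eval-close : ∀ {k j} (p : Pre k j) h z → eval (close p h) z ≡ eval h (vals p z)
eval-close []      h z = refl
eval-close (p ▷ g) h z = eval-close p (gate g h) z

state : ∀ {k j} → Pre k j → Tree
state {j = j} p = encodeℕ j · encodePre p

Function : ℕ → Set
Function k = Vec Bool k → Bool

record Denotes {k j} (p : Pre k j) (l : ℕ) (f : Function k) : Set where
  constructor denotes
  field
    wire  : Fin j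
    level : l + suc (toℕ wire) ≡ j
    value : ∀ z → lookup (vals p z) wire ≡ f z

open Denotes

record _⊑_ {k j j′} (p : Pre k j) (p′ : Pre k j′) : Set where
  constructor kept
  field keep : ∀ {l f} → Denotes p l f → Denotes p′ l f

open _⊑_

⊑-refl : ∀ {k j} {p : Pre k j} → p ⊑ p
⊑-refl .keep d = d

⊑-trans : ∀ {k j j′ j″} {p : Pre k j} {p′ : Pre k j′} {p″ : Pre k j″} → p ⊑ p′ → p′ ⊑ p″ → p ⊑ p″
⊑-trans a b .keep d = b .keep (a .keep d)

⊑-▷ : ∀ {k j} {p : Pre k j} g → p ⊑ (p ▷ g)
⊑-▷ g .keep {l} d = denotes (suc (d .wire)) (trans (+-suc l _) (cong suc (d .level))) (d .value)

newest : ∀ {k j} (p : Pre k j) g {f} → (∀ z → evalGate g (vals p z) ≡ f z) → Denotes (p ▷ g) j f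
newest {j = j} p g e = denotes zero (+-comm j 1) e

index : ∀ {k j} {p : Pre k j} {l f} (d : Denotes p l f) → j ∸ suc l ≡ toℕ (d .wire)
index {j = j} {l = l} d = trans (cong (_∸ suc l) (trans (sym (d .level)) (+-suc l _))) (m+n∸m≡n (suc l) _)

level< : ∀ {k j} {p : Pre k j} {l f} → Denotes p l f → l < j
level< {l = l} d = ≤-trans (≤-trans (≤-reflexive (+-comm 1 l)) (+-monoʳ-≤ l (s≤s z≤n))) (≤-reflexive (d .level))

Wires : ℕ → Set
Wires k = List (ℕ × Function k)

names : ∀ {k} → Wires k → Tree
names = listOf (encodeℕ ∘ proj₁)

values : ∀ {k} → Wires k → Vec Bool k → List Bool
values ws z = map (λ w → proj₂ w z) ws

DenotesAll : ∀ {k j} → Pre k j → Wires k → Set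
DenotesAll p = All (λ w → Denotes p (proj₁ w) (proj₂ w))

keepAll : ∀ {k j j′} {p : Pre k j} {p′ : Pre k j′} {ws} → p ⊑ p′ → DenotesAll p ws → DenotesAll p′ ws
keepAll e = All.map (e .keep)

iterate-pred : ∀ l j → iterate pred (pred j) l ≡ j ∸ suc l
iterate-pred zero    zero    = refl
iterate-pred zero    (suc j) = refl
iterate-pred (suc l) zero    = trans (iterate-pred l zero) refl
iterate-pred (suc l) (suc j) = iterate-pred l j

opaque

  -- The wire named l among j wires has de Bruijn index j - 1 - l, obtained by l + 1 predecessors.
  indexP : P 2
  indexP = fold v1 (match v0 leaf v1) (match v1 leaf v1)

  indexP-spec : ∀ {N} j l → l ≤ N → sem N indexP (encodeℕ j ∷ encodeℕ l ∷ []) ≡ encodeℕ (j ∸ suc l)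
  indexP-spec {N} j l le = trans (cong (λ u → foldT N (λ _ u → onTree u leaf (λ _ r → r)) u (encodeℕ l)) (predP j))
    (trans (foldT-nat {f = λ _ u → onTree u leaf (λ _ r → r)} encodeℕ pred predP (pred j) l le) (cong encodeℕ (iterate-pred l j)))
    where
    predP : ∀ j → onTree (encodeℕ j) leaf (λ _ r → r) ≡ encodeℕ (pred j)
    predP zero    = refl
    predP (suc j) = refl

countP : ∀ {k} → P k → P k
countP s = match s leaf v0

indexIn : ∀ {k} → P k → P k → P k
indexIn s l = app₂ indexP (countP s) l

emitP : P 2
emitP = match v1 leaf ((leaf · v0) · (v2 · v1))

emit : ∀ {k} → P k → P k → P k
emit g s = app₂ emitP g s

numeral : ∀ {k} → ℕ → P k
numeral zero    = leaf
numeral (suc n) = leaf · numeral n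

record RowBuilt {k j} (N : ℕ) (p : Pre k (suc j)) (a : Function k) (ws : Wires k) (cs : List Bool) (t : Tree) : Set where
  constructor rowBuilt
  field
    {j′}  : ℕ
    p′    : Pre k (suc j′)
    cs′   : List Bool
    a′    : Function k
    eq    : t ≡ bits cs′ · state p′
    ext   : p ⊑ p′
    more  : j′ ≤ length ws + j
    acc   : ∀ z → lookup (vals p′ z) zero ≡ a′ z
    row   : ∀ z → List.foldl norStep (cs , a z) (values ws z) ≡ (cs′ , a′ z)

opaque

  rowStepP : P 2
  rowStepP = match v1 leaf (match v0 (leaf · v1)
    (v1 · ifP v0 (emit (numeral 3 · (leaf · indexIn v3 v4)) v3) v3))

  rowStepP-keep : ∀ {N} w cs s → sem N rowStepP (w ∷ bits (false ∷ cs) · s ∷ []) ≡ bits cs · s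
  rowStepP-keep w cs s = refl

  rowStepP-none : ∀ {N} w s → sem N rowStepP (w ∷ bits [] · s ∷ []) ≡ bits [] · s
  rowStepP-none w s = refl

  rowStepP-or : ∀ {N k j} {p : Pre k (suc j)} {l f} (d : Denotes p l f) cs → l ≤ N →
    sem N rowStepP (encodeℕ l ∷ bits (true ∷ cs) · state p ∷ []) ≡ bits cs · state (p ▷ or zero (d .wire))
  rowStepP-or {N} {j = j} {l = l} d cs le
    rewrite indexP-spec {N} (suc j) l le | index d = refl

-- The newest wire carries the OR of the wires selected so far, and only a set bit costs a gate. The
-- bound by `N` lets `indexP` count down every wire name.
rowGates : ∀ {N k j} M (p : Pre k (suc j)) a ws cs → (∀ z → lookup (vals p z) zero ≡ a z) → DenotesAll p ws →
  length ws ≤ M → length ws + suc j ≤ N →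
  RowBuilt N p a ws cs (foldT M (λ x u → sem N rowStepP (x ∷ u ∷ [])) (bits cs · state p) (names ws))
rowGates zero    p a []             cs acc ds len le = rowBuilt p cs a refl ⊑-refl ≤-refl acc (λ z → refl)
rowGates (suc M) p a []             cs acc ds len le = rowBuilt p cs a refl ⊑-refl ≤-refl acc (λ z → refl)
rowGates {N} (suc M) p a ((l , f) ∷ ws) [] acc (d ∷ ds) (s≤s len) le
  rewrite rowStepP-none {N} (encodeℕ l) (state p)
  with rowGates {N} M p a ws [] acc ds len (≤-trans (n≤1+n _) le)
... | rowBuilt p′ cs′ a′ eq ext more acc′ row = rowBuilt p′ cs′ a′ eq ext (m≤n⇒m≤1+n more) acc′ row
rowGates {N} (suc M) p a ((l , f) ∷ ws) (false ∷ cs) acc (d ∷ ds) (s≤s len) le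
  rewrite rowStepP-keep {N} (encodeℕ l) cs (state p)
  with rowGates {N} M p a ws cs acc ds len (≤-trans (n≤1+n _) le)
... | rowBuilt p′ cs′ a′ eq ext more acc′ row = rowBuilt p′ cs′ a′ eq ext (m≤n⇒m≤1+n more) acc′ row
rowGates {N} {j = j} (suc M) p a ((l , f) ∷ ws) (true ∷ cs) acc (d ∷ ds) (s≤s len) le
  rewrite rowStepP-or {N} d cs (≤-trans (<⇒≤ (level< d)) (≤-trans (m≤n+m (suc j) (suc (length ws))) le))
  with rowGates {N} M (p ▷ or zero (d .wire)) (λ z → f z ∨ a z) ws cs
         (λ z → trans (cong₂ _∨_ (acc z) (d .value z)) (∨-comm (a z) (f z)))
         (keepAll (⊑-▷ _) ds) len (≤-trans (≤-reflexive (+-suc _ (suc j))) le)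
... | rowBuilt p′ cs′ a′ eq ext more acc′ row =
  rowBuilt p′ cs′ a′ eq (⊑-trans (⊑-▷ _) ext) (≤-trans more (≤-reflexive (+-suc _ j))) acc′ row

record HypBuilt {k j} (p : Pre k j) (ws : Wires k) (cs : List Bool) (r extra : ℕ) (t : Tree) : Set where
  constructor hypBuilt
  field
    {j′} : ℕ
    p′   : Pre k j′
    ws′  : Wires k
    cs′  : List Bool
    eq   : t ≡ names ws′ · (bits cs′ · state p′)
    ext  : p ⊑ p′
    more : j′ ≤ extra + j
    all  : DenotesAll p′ ws′
    rows : ∀ z → iterate hypStep (values ws z , cs) r ≡ (values ws′ z , cs′)

opaque

  hypGateP : P 1
  hypGateP = match v0 leaf (match v1 leaf
    (match (fold v2 (v0 · emit (leaf · leaf) v1) (ren (#0 ∷ #1 ∷ []) rowStepP)) leaf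
      ((countP v1 · v4) · (v0 · emit (numeral 1 · leaf) v1))))

  hypGate : ∀ {N k j} (p : Pre k j) ws cs → DenotesAll p ws → length ws + suc j ≤ N →
    HypBuilt p ws cs 1 (length ws + 2) (sem N hypGateP (names ws · (bits cs · state p) ∷ []))
  hypGate {N} {j = j} p ws cs ds le
    with rowGates {N} N (p ▷ const false) (λ _ → false) ws cs (λ z → refl) (keepAll (⊑-▷ _) ds)
           (≤-trans (m≤m+n _ _) le) le
  ... | rowBuilt {j′} p′ cs′ a′ eq ext more acc row = hypBuilt (p′ ▷ neg zero) ((suc j′ , not ∘ a′) ∷ ws) cs′
    (cong (λ t → onTree t leaf (λ cs s → (onTree s leaf (λ c _ → c) · names ws) · (cs · sem N emitP ((leaf · leaf) · leaf ∷ s ∷ [])))) eq)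
    (⊑-trans (⊑-▷ _) (⊑-trans ext (⊑-▷ _)))
    (≤-trans (s≤s (s≤s more)) (≤-reflexive (lemma (length ws) j)))
    (newest p′ (neg zero) (λ z → cong not (acc z)) ∷ keepAll (⊑-trans (⊑-▷ _) (⊑-trans ext (⊑-▷ _))) ds)
    (λ z → cong (λ r → not (proj₂ r) ∷ values ws z , proj₁ r) (row z))
    where
    lemma : ∀ a b → 2 + (a + b) ≡ a + 2 + b
    lemma = solve-∀

-- `e` bounds the number of wires throughout the loop, so that each row costs at most e + 2 gates: a
-- disjunction per wire read, the initial constant and the final negation.
hypGatesLoop : ∀ {N k j} M r e (p : Pre k j) ws cs → DenotesAll p ws → r ≤ M → length ws + r ≤ e →
  r * (e + 2) + j + suc e ≤ N →
  HypBuilt p ws cs r (r * (e + 2)) (foldT M (λ _ u → sem N hypGateP (u ∷ [])) (names ws · (bits cs · state p)) (encodeℕ r))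
hypGatesLoop zero    zero    e p ws cs ds len le₁ le₂ = hypBuilt p ws cs refl ⊑-refl ≤-refl ds (λ z → refl)
hypGatesLoop (suc M) zero    e p ws cs ds len le₁ le₂ = hypBuilt p ws cs refl ⊑-refl ≤-refl ds (λ z → refl)
hypGatesLoop {N} {j = j} (suc M) (suc r) e p ws cs ds (s≤s len) le₁ le₂
  with hypGate {N} p ws cs ds (begin
         length ws + suc j ≤⟨ +-monoˡ-≤ (suc j) (≤-trans (m≤m+n _ _) le₁) ⟩
         e + suc j         ≡⟨ trans (+-suc e j) (cong suc (+-comm e j)) ⟩
         suc (j + e)       ≡⟨ +-suc j e ⟨
         j + suc e         ≤⟨ m≤n+m (j + suc e) (suc r * (e + 2)) ⟩
         suc r * (e + 2) + (j + suc e) ≡⟨ +-assoc (suc r * (e + 2)) j (suc e) ⟨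
         suc r * (e + 2) + j + suc e ≤⟨ le₂ ⟩
         N ∎)
  where open ≤-Reasoning
... | hypBuilt {j₁} p₁ ws₁ cs₁ eq₁ ext₁ more₁ all₁ rows₁ rewrite eq₁
  with hypGatesLoop {N} M r e p₁ ws₁ cs₁ all₁ len
         (≤-trans (≤-reflexive (cong (_+ r) length-ws₁)) (≤-trans (≤-reflexive (sym (+-suc _ r))) le₁))
         (≤-trans (+-monoˡ-≤ (suc e) (grown r)) le₂)
  where
  length-ws₁ : length ws₁ ≡ suc (length ws)
  length-ws₁ = trans (sym (length-map _ ws₁)) (trans (cong (length ∘ proj₁) (sym (rows₁ (Vec.replicate _ false))))
    (cong suc (length-map _ ws)))
  grown : ∀ r → r * (e + 2) + j₁ ≤ suc r * (e + 2) + j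
  grown r = ≤-trans (+-monoʳ-≤ (r * (e + 2)) (≤-trans more₁ (+-monoˡ-≤ j (+-monoˡ-≤ 2 (≤-trans (m≤m+n _ _) le₁)))))
    (≤-reflexive (+-rotate (r * (e + 2)) (e + 2) j))
... | hypBuilt p′ ws′ cs′ eq ext more all rows = hypBuilt p′ ws′ cs′ eq (⊑-trans ext₁ ext)
  (≤-trans more (≤-trans (+-monoʳ-≤ (r * (e + 2)) (≤-trans more₁ (+-monoˡ-≤ j (+-monoˡ-≤ 2 (≤-trans (m≤m+n _ _) le₁)))))
    (≤-reflexive (+-rotate (r * (e + 2)) (e + 2) j))))
  all (λ z → trans (cong (λ s → iterate hypStep s r) (rows₁ z)) (rows z))

record Built {k j} (p : Pre k j) (extra : ℕ) (f : Function k) (t : Tree) : Set where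
  constructor built
  field
    {j′} : ℕ
    p′   : Pre k j′
    name : ℕ
    eq   : t ≡ encodeℕ name · state p′
    ext  : p ⊑ p′
    more : j′ ≤ extra + j
    den  : Denotes p′ name f

-- Bounds on the gates emitted. A member adds a conjunction to the gates of its hypothesis; a group
-- adds an initial constant and a disjunction to those of its members.
hypGates memberGates groupGates : ℕ → ℕ → ℕ
hypGates r e = r * (e + r + 2)
memberGates r e = suc (hypGates r e)
groupGates b h = suc (suc (b * h))

-- Loops run at most `N` times, so `N` has to exceed every wire name and every number of wires read
-- in the course of the emission.
Room : ∀ {k} → ℕ → ℕ → ℕ → Wires k → ℕ → Set
Room N extra r ws j = extra + j + suc (length ws + r) ≤ N

room-less : ∀ {k N} a a′ r (ws : Wires k) j → Room N (a + a′) r ws j → Room N a r ws j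
room-less a a′ r ws j room = ≤-trans (+-monoˡ-≤ (suc (length ws + r)) (+-monoˡ-≤ j (m≤m+n a a′))) room

opaque

  hypGatesP : P 4
  hypGatesP = match (fold v0 (v1 · (v2 · v3)) (ren (#1 ∷ []) hypGateP)) leaf (match v0 leaf (match v3 leaf (v2 · v1)))

  hypGatesP-spec : ∀ {N k j} r (p : Pre k j) ws cs → DenotesAll p ws → suc r ≤ N → Room N (hypGates (suc r) (length ws)) (suc r) ws j →
    Built p (hypGates (suc r) (length ws)) (λ z → hyp (suc r) (values ws z) cs)
      (sem N hypGatesP (encodeℕ (suc r) ∷ names ws ∷ bits cs ∷ state p ∷ []))
  hypGatesP-spec {N} r p ws cs ds len room
    with hypGatesLoop {N} N (suc r) (length ws + suc r) p ws cs ds len ≤-refl room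
  ... | hypBuilt p′ [] cs′ eq ext more all rows = ⊥-elim (nonempty (suc r) (s≤s z≤n) (rows (Vec.replicate _ false)))
    where
    nonempty : ∀ r {s cs} → 1 ≤ r → iterate hypStep s r ≢ ([] , cs)
    nonempty (suc zero)    _ ()
    nonempty (suc (suc r)) _ = nonempty (suc r) (s≤s z≤n)
  ... | hypBuilt p′ ((l , f) ∷ ws′) cs′ eq ext more (d ∷ _) rows = built p′ l
    (cong (λ t → onTree t leaf (λ e s → onTree e leaf (λ o _ → onTree s leaf (λ _ s → o · s)))) eq)
    ext more (denotes (d .wire) (d .level) (λ z → trans (d .value z) (sym (cong (headBit ∘ proj₁) (rows z)))))

opaque

  binaryP : P 4
  binaryP = countP v1 · emit (v2 · (indexIn v1 v3 · indexIn v1 v0)) v1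

  binaryP-spec : ∀ {N k j} (p : Pre k j) (c : Tree) (g : Fin j → Fin j → Gate j) {l l′ f f′} →
    (∀ a b → encodeGate (g a b) ≡ c · (encodeFin a · encodeFin b)) →
    Denotes p l f → (d : Denotes p l′ f′) → j ≤ N → {F : Function k} →
    (∀ (d : Denotes p l f) (d′ : Denotes p l′ f′) z → evalGate (g (d .wire) (d′ .wire)) (vals p z) ≡ F z) →
    Built p 1 F (sem N binaryP (encodeℕ l′ ∷ state p ∷ c ∷ encodeℕ l ∷ []))
  binaryP-spec {N} {j = j} p c g {l} {l′} encodes d d′ le value
    rewrite indexP-spec {N} j l (≤-trans (<⇒≤ (level< d)) le) | indexP-spec {N} j l′ (≤-trans (<⇒≤ (level< d′)) le)
          | index d | index d′ | sym (encodes (d .wire) (d′ .wire))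
    = built (p ▷ g (d .wire) (d′ .wire)) j refl (⊑-▷ _) ≤-refl (newest p _ (value d d′))

opaque

  memberP : P 4
  memberP = match v1 leaf (match (ren (#4 ∷ #5 ∷ #2 ∷ #1 ∷ []) hypGatesP) leaf
    (bind (numeral 2) (ren (#1 ∷ #2 ∷ #0 ∷ #3 ∷ []) binaryP)))

  memberP-spec : ∀ {N k j} r (p : Pre k j) ws cs {l a} → DenotesAll p ws → Denotes p l a → suc r ≤ N →
    Room N (memberGates (suc r) (length ws)) (suc r) ws j →
    Built p (memberGates (suc r) (length ws)) (λ z → andStep (suc r) (values ws z) (a z) cs)
      (sem N memberP (bits cs ∷ encodeℕ l · state p ∷ encodeℕ (suc r) ∷ names ws ∷ []))
  memberP-spec {N} {j = j} r p ws cs ds d len room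
    with hypGatesP-spec {N} r p ws cs ds len (≤-trans (n≤1+n _) room)
  ... | built {j₁} p₁ o eq₁ ext₁ more₁ d₁ rewrite eq₁
    with binaryP-spec {N} p₁ (encodeℕ 2) and (λ a b → refl) (ext₁ .keep d) d₁
           (≤-trans more₁ (≤-trans (≤-trans (m≤m+n _ _) (n≤1+n _)) room))
           (λ d d′ z → cong₂ _∧_ (d .value z) (d′ .value z))
  ... | built p₂ l eq₂ ext₂ more₂ d₂ = built p₂ l eq₂ (⊑-trans ext₁ ext₂) (≤-trans more₂ (s≤s more₁)) d₂

-- Shared by the AND within a group and the OR over groups: the accumulator is a wire, and each
-- entry replaces it by a newer one.
chained : ∀ {N k A} r (ws : Wires k) (e : A → Tree) (size : ℕ) (step : Vec Bool k → Bool → A → Bool) (body : Tree → Tree → Tree) →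
  (∀ {j} (p : Pre k j) a {l f} → DenotesAll p ws → Denotes p l f → Room N size r ws j →
    Built p size (λ z → step z (f z) a) (body (e a) (encodeℕ l · state p))) →
  ∀ {j} M (p : Pre k j) as {l f} → DenotesAll p ws → Denotes p l f → length as ≤ M → Room N (length as * size) r ws j →
  Built p (length as * size) (λ z → List.foldl (step z) (f z) as) (foldT M body (encodeℕ l · state p) (listOf e as))
chained r ws e size step body each zero    p []       ds d len room = built p _ refl ⊑-refl ≤-refl d
chained r ws e size step body each (suc M) p []       ds d len room = built p _ refl ⊑-refl ≤-refl d
chained r ws e size step body each {j} (suc M) p (a ∷ as) ds d (s≤s len) room
  with each p a ds d (room-less size (length as * size) r ws j room)
... | built {j₁} p₁ o eq₁ ext₁ more₁ d₁ rewrite eq₁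
  with chained r ws e size step body each M p₁ as (keepAll ext₁ ds) d₁ len (≤-trans (+-monoˡ-≤ _ (grown more₁)) room)
  where
  grown : j₁ ≤ size + j → length as * size + j₁ ≤ suc (length as) * size + j
  grown more = ≤-trans (+-monoʳ-≤ (length as * size) more) (≤-reflexive (+-rotate (length as * size) size j))
... | built p₂ l eq₂ ext₂ more₂ d₂ = built p₂ l eq₂ (⊑-trans ext₁ ext₂)
  (≤-trans more₂ (≤-trans (+-monoʳ-≤ (length as * size) more₁) (≤-reflexive (+-rotate (length as * size) size j)))) d₂

opaque

  groupP : P 4
  groupP = match v1 leaf (match (fold v2 (countP v1 · emit (leaf · trueP) v1) (ren (#0 ∷ #1 ∷ #6 ∷ #7 ∷ []) memberP)) leaf
    (bind (numeral 3) (ren (#1 ∷ #2 ∷ #0 ∷ #3 ∷ []) binaryP)))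

  groupP-spec : ∀ {N k j b} r (p : Pre k j) ws (g : Vec (List Bool) b) {l o} → DenotesAll p ws → Denotes p l o → suc r ≤ N → b ≤ N →
    Room N (groupGates b (memberGates (suc r) (length ws))) (suc r) ws j →
    Built p (groupGates b (memberGates (suc r) (length ws))) (λ z → orStep (suc r) (values ws z) (o z) g)
      (sem N groupP (listOf bits (toList g) ∷ encodeℕ l · state p ∷ encodeℕ (suc r) ∷ names ws ∷ []))
  groupP-spec {N} {j = j} {b} r p ws g ds d le leb room
    with chained {N} (suc r) ws bits (memberGates (suc r) (length ws)) (λ z → andStep (suc r) (values ws z))
           (λ x u → sem N memberP (x ∷ u ∷ encodeℕ (suc r) ∷ names ws ∷ [])) (λ p cs ds d → memberP-spec r p ws cs ds d le)
           N (p ▷ const true) (toList g) {j} {λ _ → true} (keepAll (⊑-▷ _) ds) (newest p (const true) (λ z → refl))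
           (≤-trans (≤-reflexive (length-toList g)) leb)
           (≤-trans (≤-reflexive (cong (_+ suc (length ws + suc r)) (trans (+-suc _ j) (cong (λ b → suc (b * _ + j)) (length-toList g)))))
             (≤-trans (n≤1+n _) room))
  ... | built {j₁} p₁ a eq₁ ext₁ more₁ d₁ rewrite eq₁
    with binaryP-spec {N} p₁ (encodeℕ 3) or (λ a b → refl) (ext₁ .keep (⊑-▷ (const true) .keep d)) d₁
           (≤-trans bound (≤-trans (≤-trans (m≤m+n _ _) (n≤1+n _)) room))
           (λ d d′ z → cong₂ _∨_ (d .value z) (d′ .value z))
    where
    bound : j₁ ≤ suc (b * memberGates (suc r) (length ws) + j)
    bound = ≤-trans more₁ (≤-reflexive (trans (+-suc _ j) (cong (λ b → suc (b * memberGates (suc r) (length ws) + j)) (length-toList g))))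
  ... | built p₂ l eq₂ ext₂ more₂ d₂ = built p₂ l eq₂ (⊑-trans (⊑-▷ _) (⊑-trans ext₁ ext₂))
    (≤-trans more₂ (s≤s (≤-trans more₁ (≤-reflexive (trans (+-suc _ j) (cong (λ b → suc (b * memberGates (suc r) (length ws) + j)) (length-toList g))))))) d₂

-- The inputs are named as if they had been created one by one, the last one first. This gives wire
-- `a` of k inputs the name k - 1 - a, in agreement with `level` in `Denotes`.
inputs : ∀ k → Wires k
inputs k = List.tabulate λ a → k ∸ suc (toℕ a) , λ z → lookup z a

names-inputs : ∀ k {k′} (f : Fin k → Function k′) →
  names (List.tabulate λ a → k ∸ suc (toℕ a) , f a) ≡ listOf encodeℕ (List.downFrom k)
names-inputs zero    f = refl
names-inputs (suc k) f = cong (encodeℕ k ·_) (names-inputs k (f ∘ suc))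

values-inputs : ∀ {k} (z : Vec Bool k) → values (inputs k) z ≡ toList z
values-inputs {k} z = trans (map-tabulate _ _) (go z)
  where
  go : ∀ {k} (z : Vec Bool k) → List.tabulate (lookup z) ≡ toList z
  go []      = refl
  go (b ∷ z) = cong (b ∷_) (go z)

denotes-inputs : ∀ k → DenotesAll [] (inputs k)
denotes-inputs k = tabulate⁺ λ a → denotes a (m∸n+n≡m (toℕ<n a)) (λ z → refl)

nameStep : ℕ × List ℕ → ℕ × List ℕ
nameStep (c , ls) = suc c , c ∷ ls

iterate-nameStep : ∀ k c → iterate nameStep (c , List.downFrom c) k ≡ (k + c , List.downFrom (k + c))
iterate-nameStep zero    c = refl
iterate-nameStep (suc k) c = trans (iterate-nameStep k (suc c)) (cong (λ u → u , List.downFrom u) (+-suc k c))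

opaque

  namesP : P 1
  namesP = match (fold v0 (leaf · leaf) (match v1 leaf ((leaf · v0) · (v0 · v1)))) leaf v1

  namesP-spec : ∀ {N} k → k ≤ N → sem N namesP (encodeℕ k ∷ []) ≡ names (inputs k)
  namesP-spec {N} k le
    rewrite foldT-nat {f = λ _ u → onTree u leaf (λ c ls → (leaf · c) · (c · ls))} (pair encodeℕ (listOf encodeℕ)) nameStep
              (λ _ → refl) {N} (0 , []) k le
          | iterate-nameStep k 0 | +-identityʳ k = sym (names-inputs k (λ a z → lookup z a))

gates-close : ∀ {k j} (p : Pre k j) (h : Circuit j) → gates (close p h) ≤ j + gates h
gates-close {j = j} []      h = m≤n+m (gates h) j
gates-close {j = suc j} (p ▷ g) h = ≤-trans (gates-close p (gate g h)) (≤-reflexive (+-suc j (gates h)))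

-- Emission keeps the newest gate in front, whereas a circuit starts with the oldest. Folding the
-- gates onto the output reverses them.
encode-close : ∀ {k j} M (p : Pre k j) (h : Circuit j) → j ≤ M →
  foldT M (λ x u → x · u) (encodeCircuit h) (encodePre p) ≡ encodeCircuit (close p h)
encode-close zero    []      h le       = refl
encode-close (suc M) []      h le       = refl
encode-close (suc M) (p ▷ g) h (s≤s le) = encode-close M p (gate g h) le

gates-within : ∀ k {a b} r (Ms : Ballots a b) {c} →
  length (toList Ms) * groupGates b (memberGates (suc r) (length (inputs k))) + suc k + suc (length (inputs k) + c) ≡
  a * groupGates b (memberGates (suc r) k) + suc k + suc (k + c)
gates-within k {b = b} r Ms {c} = cong₂ (λ u w → u * groupGates b (memberGates (suc r) w) + suc k + suc (w + c))
  (length-toList Ms) (length-tabulate λ (a : Fin k) → k ∸ suc (toℕ a) , λ (z : Vec Bool k) → lookup z a)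

within : ∀ {N k a b j} r (Ms : Ballots a b) →
  a * groupGates b (memberGates (suc r) k) + suc k + suc (k + suc r) ≤ N →
  j ≤ length (toList Ms) * groupGates b (memberGates (suc r) (length (inputs k))) + suc k → j ≤ N
within {k = k} r Ms room le = ≤-trans (≤-trans le (m≤m+n _ _)) (≤-trans (≤-reflexive (gates-within k r Ms)) room)

opaque

  circuitP : P 3
  circuitP = bind (ren (#1 ∷ []) namesP)
    (match (fold v3 (v2 · ((leaf · v2) · ((leaf · leaf) · leaf))) (ren (#0 ∷ #1 ∷ #3 ∷ #2 ∷ []) groupP)) leaf
      (match v1 leaf (fold v1 (leaf · app₂ indexP v0 v2) (v0 · v1))))

  circuitP-spec : ∀ {N k a b} r (Ms : Ballots a b) → suc r ≤ N → a ≤ N → b ≤ N →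
    a * groupGates b (memberGates (suc r) k) + suc k + suc (k + suc r) ≤ N →
    ∃ λ (h : Circuit k) → sem N circuitP (encodeℕ (suc r) ∷ encodeℕ k ∷ ballots Ms ∷ []) ≡ encodeCircuit h ×
      (∀ z → eval h z ≡ poll (suc r) (toList z) Ms) × gates h ≤ N
  circuitP-spec {N} {k} {a} {b} r Ms ler lea leb room
    rewrite namesP-spec {N} k (≤-trans (≤-trans (n≤1+n k) (≤-trans (m≤n+m (suc k) (a * groupGates b (memberGates (suc r) k))) (m≤m+n _ _))) room)
    with chained {N} (suc r) (inputs k) (listOf bits ∘ toList) (groupGates b (memberGates (suc r) (length (inputs k))))
           (λ z → orStep (suc r) (values (inputs k) z)) (λ x u → sem N groupP (x ∷ u ∷ encodeℕ (suc r) ∷ names (inputs k) ∷ []))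
           (λ p g ds d → groupP-spec r p (inputs k) g ds d ler leb)
           N ([] ▷ const false) (toList Ms) {k} {λ _ → false}
           (keepAll (⊑-▷ _) (denotes-inputs k)) (newest [] (const false) (λ z → refl))
           (≤-trans (≤-reflexive (length-toList Ms)) lea)
           (≤-trans (≤-reflexive (gates-within k r Ms)) room)
  ... | built {j′} p′ l eq ext more d rewrite eq
    | indexP-spec {N} j′ l (≤-trans (<⇒≤ (level< d)) (within {N} {k} r Ms room more))
    | index d = close p′ (output (d .wire)) ,
      encode-close N p′ (output (d .wire)) (within {N} {k} r Ms room more) ,
      (λ z → trans (eval-close p′ _ z) (trans (d .value z)
        (trans (cong (λ ws → List.foldl (orStep (suc r) ws) false (toList Ms)) (values-inputs z))
          (foldl-orStep (suc r) (toList z) false Ms)))) ,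
      ≤-trans (gates-close p′ (output (d .wire))) (≤-trans (≤-reflexive (+-identityʳ j′)) (within {N} {k} r Ms room more))

-- One level: votes, refutations and the resulting circuit

splits-at : ∀ {m} (i : Fin m) (y : Vec Bool m) → ∃ λ rest → toList y ≡ toList (before i y) ++ lookup y i ∷ rest
splits-at zero    (b ∷ y) = toList y , refl
splits-at (suc i) (b ∷ y) with splits-at i y
... | rest , eq = rest , cong (b ∷_) eq

orAnd-map : ∀ {A B : Set} {a b} (f : A → B) (p : B → Bool) (q : A → Bool) → (∀ x → p (f x) ≡ q x) →
  (c : Vec (Vec A b) a) → orAnd p (Vec.map (Vec.map f) c) ≡ orAnd q c
orAnd-map f p q e []      = refl
orAnd-map f p q e (g ∷ c) = cong₂ _∨_ (go g) (orAnd-map f p q e c)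
  where
  go : ∀ {b} (g : Vec _ b) → allV p (Vec.map f g) ≡ allV q g
  go []      = refl
  go (x ∷ g) = cong₂ _∧_ (e x) (go g)

xor-false⇒≡ : ∀ {a b} → a xor b ≡ false → a ≡ b
xor-false⇒≡ {true}  {true}  _ = refl
xor-false⇒≡ {false} {false} _ = refl

-- Hypotheses have suc r rows, as the last row computes the output.
module Level (clk : Tree) {n m} (F : Formula n m) (i : Fin m) (limit r B : ℕ)
  (limit≤ : limit ≤ spine clk) (wires≤ : n + toℕ i + suc r ≤ spine clk)
  (search≤ : hypLength (suc r) (n + toℕ i) + suc (hypLength (suc r) (n + toℕ i)) ≤ spine clk)
  (variables≤ : n + m ≤ spine clk) (B≤ : B ≤ spine clk)
  (gates≤ : B * groupGates B (memberGates (suc r) (n + toℕ i)) + suc (n + toℕ i) + suc (n + toℕ i + suc r) ≤ spine clk) where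

  k : ℕ
  k = n + toℕ i

  open Choosing clk limit k (suc r) limit≤ wires≤ search≤ public

  Coins : Set
  Coins = Vec (Vec (Vec (Vec Bool (suc ℓ)) (suc ℓ)) B) B

  ballot : List (Labelled k) → Coins → Ballots B B
  ballot S c = Vec.map (Vec.map (choice S)) c

  refutation : List (Labelled k) → Coins → Tree
  refutation S c = refuting k F (suc r) (ballot S c)

  counterexample : List (Labelled k) → Coins → List Bool
  counterexample S c = find clk (refutation S c) (n + m) []

  example : List Bool → Labelled k
  example cs = takePad k cs , headBit (List.drop k cs)

  challenged : List (Labelled k) → Coins → Bool
  challenged S c = oracle (query clk (refutation S c) (n + m) [])

  step : List (Labelled k) → Coins → Maybe (Labelled k)
  step S c = if challenged S c then just (example (counterexample S c)) else nothing

  module Abstract (d : ℕ) = Learning {d = d} limit ev pick step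

  poll-vote : ∀ S c z → poll (suc r) (toList z) (ballot S c) ≡ orAnd (λ ω → ev (pick S ω) z) c
  poll-vote S c z = orAnd-map (choice S) (hyp (suc r) (toList z)) (λ ω → ev (pick S ω) z) (λ ω → ev-choice S ω z) c

  n≤ : n ≤ spine clk
  n≤ = ≤-trans (m≤m+n n m) variables≤

  m≤ : m ≤ spine clk
  m≤ = ≤-trans (m≤n+m m n) variables≤

  inputOf : Vec Bool n → Vec Bool m → Vec Bool k
  inputOf x y = x Vec.++ before i y

  layout : ∀ x y → ∃ λ rest → toList x ++ toList y ≡ toList (inputOf x y) ++ lookup y i ∷ rest
  layout x y with splits-at i y
  ... | rest , eq = rest , trans (cong (toList x ++_) eq)
    (trans (sym (++-assoc (toList x) (toList (before i y)) _))
      (cong (_++ lookup y i ∷ rest) (sym (toList-++ x (before i y)))))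

  verdict-on : ∀ S c x y → sem (spine clk) coreP (clk ∷ refutation S c ∷ bits (toList x ++ toList y) ∷ []) ≡
    bit (refuted (outcome (final x y F (spine clk))) (poll (suc r) (toList (inputOf x y)) (ballot S c) xor lookup y i))
  verdict-on S c x y with layout x y
  ... | rest , eq = coreP-refuting clk F (suc r) (ballot S c) (toList x ++ toList y) (inputOf x y) (lookup y i ∷ rest) eq
    n≤ m≤ wires≤ B≤ B≤

  outcome-value : ∀ x y {v} → outcome (final x y F (spine clk)) ≡ (true , v) → v ≡ ⟦ F ⟧ x y
  outcome-value x y {v} = go (final x y F (spine clk)) refl
    where
    go : ∀ s → final x y F (spine clk) ≡ s → outcome s ≡ (true , v) → v ≡ ⟦ F ⟧ x y
    go ([] , vs) e refl = final-value x y F (spine clk) vs e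

  -- An unfinished evaluation would have counted as a refutation. So when the oracle reports none,
  -- all evaluations of F have finished, with the right values by `outcome-value`, and the vote is
  -- right wherever F holds. The length of the clock does not enter.
  unchallenged : ∀ S c → challenged S c ≡ false → ∀ x y → ⟦ F ⟧ x y ≡ true →
    poll (suc r) (toList (inputOf x y)) (ballot S c) ≡ lookup y i
  unchallenged S c none x y sat = xor-false⇒≡ (cleared (outcome (final x y F (spine clk))) refl (rejected _ refl))
    where
    wrong : Bool
    wrong = poll (suc r) (toList (inputOf x y)) (ballot S c) xor lookup y i
    verdict : Bool
    verdict = refuted (outcome (final x y F (spine clk))) wrong
    clash : false ≢ true
    clash ()
    rejected : ∀ b → verdict ≡ b → verdict ≡ false
    rejected false e = e
    rejected true  e = ⊥-elim (clash (trans (sym none) (query-complete clk (refutation S c) (n + m) [] (toList x ++ toList y) variables≤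
      (trans (length-++ (toList x)) (cong₂ _+_ (length-toList x) (length-toList y)))
      (trans (cong (λ rb → isNode (sem (spine clk) coreP (clk ∷ refutation S c ∷ bits rb ∷ []))) (++-identityʳ (toList x ++ toList y)))
        (cong isNode (trans (verdict-on S c x y) (cong bit e)))))))
    cleared : ∀ o → outcome (final x y F (spine clk)) ≡ o → refuted (outcome (final x y F (spine clk))) wrong ≡ false → wrong ≡ false
    cleared (false , v) e rej rewrite e = ⊥-elim (clash (sym rej))
    cleared (true , v)  e rej rewrite e | trans (outcome-value x y e) sat = rej

  module _ (enough : 2 * nodes F ≤ spine clk) where

    evaluated : ∀ x y → outcome (final x y F (spine clk)) ≡ (true , ⟦ F ⟧ x y)
    evaluated x y = cong outcome (final-after x y F (spine clk) (≤-trans (duration≤ F) enough))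

    record Genuine (S : List (Labelled k)) (c : Coins) : Set where
      constructor genuine
      field
        x     : Vec Bool n
        y     : Vec Bool m
        sat   : ⟦ F ⟧ x y ≡ true
        shape : example (counterexample S c) ≡ (inputOf x y , lookup y i)
        wrong : poll (suc r) (toList (inputOf x y)) (ballot S c) xor lookup y i ≡ true

    -- With a clock long enough for F, evaluations do finish, so a refutation is a satisfying
    -- assignment on which the vote is wrong. The example cut out of it therefore agrees with every
    -- circuit that computes `Y i` on F.
    counterexample-genuine : ∀ S c → challenged S c ≡ true → Genuine S c
    counterexample-genuine S c asserted with query-sound clk (refutation S c) (n + m) [] variables≤ asserted
    ... | u , len , acc with find-sound clk (refutation S c) (n + m) [] u variables≤ len acc
      | find-suffix clk (refutation S c) (n + m) []
    ... | acc′ | u′ , len′ , eq = genuine x y (proj₁ both) shape (proj₂ both)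
      where
      rb : List Bool
      rb = counterexample S c
      length-rb : length rb ≡ n + m
      length-rb = trans (cong length (trans eq (++-identityʳ u′))) len′
      x : Vec Bool n
      x = takePad n rb
      y : Vec Bool m
      y = takePad m (List.drop n rb)
      rb-split : rb ≡ toList x ++ toList y
      rb-split = trans (takePad-drop n rb (≤-trans (m≤m+n n m) (≤-reflexive (sym length-rb))))
        (cong (toList x ++_) (trans (takePad-drop m (List.drop n rb) (≤-reflexive (sym length-rest)))
          (trans (cong (toList y ++_) (drop-all m (List.drop n rb) (≤-reflexive length-rest))) (++-identityʳ (toList y)))))
        where
        length-rest : length (List.drop n rb) ≡ m
        length-rest = trans (length-drop n rb) (trans (cong (_∸ n) length-rb) (m+n∸m≡n n m))
      rest : List Bool
      rest = proj₁ (layout x y)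
      rb-layout : rb ≡ toList (inputOf x y) ++ lookup y i ∷ rest
      rb-layout = trans rb-split (proj₂ (layout x y))
      shape : example rb ≡ (inputOf x y , lookup y i)
      shape = trans (cong example rb-layout) (cong₂ _,_ (takePad-++ (inputOf x y) _)
        (cong headBit (drop-toList (inputOf x y) (lookup y i ∷ rest))))
        where
        drop-toList : ∀ {k} (z : Vec Bool k) cs → List.drop k (toList z ++ cs) ≡ cs
        drop-toList []      cs = refl
        drop-toList (b ∷ z) cs = drop-toList z cs
      both : ⟦ F ⟧ x y ≡ true × poll (suc r) (toList (inputOf x y)) (ballot S c) xor lookup y i ≡ true
      both = ∧-true (node (trans (cong isNode (sym (trans
        (trans (cong (λ rb → sem (spine clk) coreP (clk ∷ refutation S c ∷ bits rb ∷ [])) rb-split) (verdict-on S c x y))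
        (cong (λ o → bit (refuted o (poll (suc r) (toList (inputOf x y)) (ballot S c) xor lookup y i))) (evaluated x y))))) acc′))
        where
        node : ∀ {b} → isNode (bit b) ≡ true → b ≡ true
        node {true} _ = refl

    refutes : (C₀ : Vec Bool ℓ) → (∀ x y → ⟦ F ⟧ x y ≡ true → ev C₀ (inputOf x y) ≡ lookup y i) → ∀ S c z v →
      step S c ≡ just (z , v) → orAnd (λ ω → ev (pick S ω) z) c xor v ≡ true × ev C₀ z ≡ v
    refutes C₀ target S c z v e with challenged S c in asserted
    refutes C₀ target S c z v refl | true with counterexample-genuine S c asserted
    ... | genuine x y sat shape wrong = subst
      (λ e → orAnd (λ ω → ev (pick S ω) (proj₁ e)) c xor proj₂ e ≡ true × ev C₀ (proj₁ e) ≡ proj₂ e) (sym shape)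
      (trans (cong (_xor lookup y i) (sym (poll-vote S c (inputOf x y)))) wrong , target x y sat)

  module _ (h : CircuitFor n i) (computes : Computes F i h) (size≤ : gates h * 3 + 2 ≤ suc r) where

    private
      realised : Realised h id (suc r)
      realised = realise h id (suc r) size≤

    -- The promised circuit as a hypothesis. It remains consistent because genuine examples come
    -- from satisfying assignments.
    target : Vec Bool ℓ
    target = takePad ℓ (proj₁ realised)

    target-correct : ∀ x y → ⟦ F ⟧ x y ≡ true → ev target (inputOf x y) ≡ lookup y i
    target-correct x y sat = begin
      hyp (suc r) (toList (inputOf x y)) (toList target) ≡⟨ cong (hyp (suc r) (toList (inputOf x y))) padded ⟩
      hyp (suc r) (toList (inputOf x y)) (proj₁ realised) ≡⟨ proj₂ (proj₂ realised) (inputOf x y) ⟩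
      eval h (Vec.tabulate (lookup (inputOf x y)))        ≡⟨ cong (eval h) (tabulate∘lookup (inputOf x y)) ⟩
      eval h (inputOf x y)                                ≡⟨ computes x y sat ⟩
      lookup y i ∎
      where
      open ≡-Reasoning
      padded : toList target ≡ proj₁ realised
      padded = sym (trans (takePad-drop ℓ (proj₁ realised) (≤-reflexive (sym (proj₁ (proj₂ realised)))))
        (trans (cong (toList target ++_) (drop-all ℓ (proj₁ realised) (≤-reflexive (proj₁ (proj₂ realised))))) (++-identityʳ _)))

  learned : ∀ S c → ∃ λ (h : CircuitFor n i) →
    sem (spine clk) circuitP (encodeℕ (suc r) ∷ encodeℕ k ∷ ballots (ballot S c) ∷ []) ≡ encodeCircuit h ×
    (∀ z → eval h z ≡ poll (suc r) (toList z) (ballot S c)) × gates h ≤ spine clk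
  learned S c = circuitP-spec r (ballot S c) (≤-trans (m≤n+m (suc r) (n + toℕ i)) wires≤) B≤ B≤ gates≤

  learned-skolem : ∀ S c → challenged S c ≡ false → IsSkolemFunction F i (proj₁ (learned S c))
  learned-skolem S c none x y sat = trans (proj₁ (proj₂ (proj₂ (learned S c))) (inputOf x y)) (unchallenged S c none x y sat)

-- Arithmetic on numerals and randomized loops

opaque

  addP : P 2
  addP = fold v0 v1 (leaf · v1)

  addP-spec : ∀ {N} a b → a ≤ N → sem N addP (encodeℕ a ∷ encodeℕ b ∷ []) ≡ encodeℕ (a + b)
  addP-spec a b le = trans (foldT-nat encodeℕ suc (λ _ → refl) b a le) (cong encodeℕ (adds a b))
    where
    adds : ∀ a b → iterate suc b a ≡ a + b
    adds zero    b = refl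
    adds (suc a) b = trans (adds a (suc b)) (+-suc a b)

opaque

  lengthStepP : P 1
  lengthStepP = match v0 leaf ((leaf · v0) · ren (#0 ∷ #1 ∷ []) addP)

  lengthStepP-spec : ∀ {N} e t → e ≤ N →
    sem N lengthStepP (encodeℕ e · encodeℕ t ∷ []) ≡ encodeℕ (suc e) · encodeℕ (e + t)
  lengthStepP-spec e t le = cong (encodeℕ (suc e) ·_) (addP-spec e t le)

opaque

  lengthP : P 2
  lengthP = match (fold v0 (v1 · (leaf · leaf)) (ren (#1 ∷ []) lengthStepP)) leaf v1

  lengthP-spec : ∀ {N} r k → k + r ≤ N →
    sem N lengthP (encodeℕ r ∷ encodeℕ k ∷ []) ≡ encodeℕ (suc (hypLength r k))
  lengthP-spec {N} r k le = trans (cong (λ u → onTree u leaf (λ _ t → t)) (loop N r k 1 le (≤-trans (m≤n+m r k) le)))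
    (cong encodeℕ (+-comm (hypLength r k) 1))
    where
    loop : ∀ M r e t → e + r ≤ N → r ≤ M →
      foldT M (λ _ u → sem N lengthStepP (u ∷ [])) (encodeℕ e · encodeℕ t) (encodeℕ r) ≡
        encodeℕ (e + r) · encodeℕ (hypLength r e + t)
    loop zero    zero    e t le len = cong (λ u → encodeℕ u · encodeℕ t) (sym (+-identityʳ e))
    loop (suc M) zero    e t le len = cong (λ u → encodeℕ u · encodeℕ t) (sym (+-identityʳ e))
    loop (suc M) (suc r) e t le (s≤s len) = trans
      (cong (λ u → foldT M (λ _ u → sem N lengthStepP (u ∷ [])) u (encodeℕ r)) (lengthStepP-spec e t (≤-trans (m≤m+n e (suc r)) le)))
      (trans (loop M r (suc e) (e + t) (≤-trans (≤-reflexive (sym (+-suc e r))) le) len)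
        (cong₂ (λ u w → encodeℕ u · encodeℕ w) (sym (+-suc e r)) (+-rotate (hypLength r (suc e)) e t)))

-- One nested loop per degree, with an accumulator in place of multiplication: x rounds that each
-- add the next lower power.
powerP : ℕ → P 2
powerP zero    = leaf · v1
powerP (suc d) = fold v0 v1 (ren (#2 ∷ #1 ∷ []) (powerP d))

powerP-spec : ∀ {N} d x a → x ≤ N → sem N (powerP d) (encodeℕ x ∷ encodeℕ a ∷ []) ≡ encodeℕ (x ^ d + a)
powerP-spec zero    x a le = refl
powerP-spec (suc d) x a le = trans
  (foldT-nat encodeℕ (x ^ d +_) (λ a → powerP-spec d x a le) a x le) (cong encodeℕ (times (x ^ d) a x))
  where
  times : ∀ p a j → iterate (p +_) a j ≡ j * p + a
  times p a zero    = refl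
  times p a (suc j) = trans (times p (p + a) j) (lemma (j * p) p a)
    where
    lemma : ∀ u p a → u + (p + a) ≡ p + u + a
    lemma = solve-∀

opaque

  powP : ℕ → P 1
  powP d = bind leaf (ren (#1 ∷ #0 ∷ []) (powerP d))

  powP-spec : ∀ {N} d x → x ≤ N → sem N (powP d) (encodeℕ x ∷ []) ≡ encodeℕ (x ^ d)
  powP-spec d x le = trans (powerP-spec d x 0 le) (cong encodeℕ (+-identityʳ (x ^ d)))

flat : ∀ {A : Set} {n} → (A → List Bool) → Vec A n → List Bool
flat f []       = []
flat f (a ∷ as) = f a ++ flat f as

collect : ∀ {k} → P k → E k → E k
collect t b = bind (fold t leaf (bind (ren wk₂ b) (pure (v0 · v2)))) (pure (app₁ reverseP v0))

replicate-encodeℕ : ∀ n → encodeℕ n ≡ List.foldr _·_ leaf (List.replicate n leaf)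
replicate-encodeℕ zero    = refl
replicate-encodeℕ (suc n) = cong (leaf ·_) (replicate-encodeℕ n)

module _ {O : Oracle} {N Q k : ℕ} {ρ : Vec Tree k} where

  do-wk₂ : ∀ {x u b ω v ω′} → RunsE {O} {N} {Q} ρ b ω v ω′ → RunsE {O} {N} {Q} (x ∷ u ∷ ρ) (ren wk₂ b) ω v ω′
  do-wk₂ {x} {u} {b} {ω} {v} {ω′} run =
    do-ren (subst (λ ρ → RunsE ρ b ω v ω′) (sym weakened) run)
    where
    weakened : Vec.map (lookup (x ∷ u ∷ ρ)) wk₂ ≡ ρ
    weakened = trans (sym (tabulate-∘ (lookup (x ∷ u ∷ ρ)) (2 Fin.↑ʳ_))) (tabulate∘lookup ρ)

  -- `fl` records the coins that produce an entry. Entries are consed in the order of their coins,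
  -- hence the reversal at the end.
  do-collect : ∀ {A : Set} {n} (e : A → Tree) (fl : A → List Bool) {t b} → sem N t ρ ≡ encodeℕ n → n ≤ N →
    (∀ c ω → RunsE {O} {N} {Q} ρ b (fl c ++ ω) (e c) ω) → (cs : Vec A n) → ∀ ω →
    RunsE {O} {N} {Q} ρ (collect t b) (flat fl cs ++ ω) (listOf e (toList cs)) ω
  do-collect {A} {n} e fl {t} {b} eqt le run cs ω = do-bind
    (do-fold (trans eqt (replicate-encodeℕ n)) (≤-trans (≤-reflexive (length-replicate n)) le) refl (chain cs []))
    (do-pure (trans (reverseP-spec e (toList cs List.ʳ++ []) (≤-trans (≤-reflexive
        (trans (length-reverse (toList cs)) (length-toList cs))) le))
      (cong (listOf e) (reverse-involutive (toList cs)))))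
    where
    chain : ∀ {n} (cs : Vec A n) done → Chain {O} {N} {Q} {ρ = ρ} (bind (ren wk₂ b) (pure (v0 · v2))) (List.replicate n leaf)
      (listOf e done) (flat fl cs ++ ω) (listOf e (toList cs List.ʳ++ done)) ω
    chain []       done = []
    chain (c ∷ cs) done = subst (λ ω′ → Chain _ _ _ ω′ _ ω) (sym (++-assoc (fl c) (flat fl cs) ω))
      (do-bind (do-wk₂ (run c (flat fl cs ++ ω))) (do-pure refl) ∷ chain cs (c ∷ done))

findStepE : E 5
findStepE = match v1 (pure leaf)
  (bind (ask (v4 · (v5 · (match v0 leaf v1 · (trueP · v1))))) (pure (match v1 leaf v1 · (v0 · v2))))

findE : E 3
findE = bind (fold v2 (v2 · leaf) findStepE) (pure (match v0 leaf v1))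

query-size : ∀ clk body r p → size (query clk body r p) ≤ size clk + size body + 4 * (length p + r) + 8
query-size clk body r p = begin
  1 + (size clk + (1 + (size body + (1 + (size (encodeℕ r) + size (bits p))))))
    ≤⟨ +-monoʳ-≤ 1 (+-monoʳ-≤ (size clk) (+-monoʳ-≤ 1 (+-monoʳ-≤ (size body) (+-monoʳ-≤ 1
         (+-mono-≤ (≤-reflexive (size-encodeℕ r)) (size-bits p)))))) ⟩
  1 + (size clk + (1 + (size body + (1 + (2 * r + 1 + (4 * length p + 1))))))
    ≤⟨ m≤m+n _ (2 * r + 3) ⟩
  1 + (size clk + (1 + (size body + (1 + (2 * r + 1 + (4 * length p + 1)))))) + (2 * r + 3)
    ≡⟨ lemma (size clk) (size body) r (length p) ⟩
  size clk + size body + 4 * (length p + r) + 8 ∎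
  where
  open ≤-Reasoning
  lemma : ∀ a b r p → 1 + (a + (1 + (b + (1 + (2 * r + 1 + (4 * p + 1)))))) + (2 * r + 3) ≡ a + b + 4 * (p + r) + 8
  lemma = solve-∀

do-find : ∀ {Q} clk body t → t ≤ spine clk → size clk + size body + 4 * t + 8 ≤ Q → ∀ ω →
  RunsE {oracle} {spine clk} {Q} (clk ∷ body ∷ encodeℕ t ∷ []) findE ω (bits (find clk body t [])) ω
do-find {Q} clk body t le small ω = do-bind
  (do-fold (replicate-encodeℕ t) (≤-trans (≤-reflexive (length-replicate t)) le) refl (chain t [] ≤-refl))
  (do-pure refl)
  where
  chain : ∀ r p → length p + r ≤ t → Chain {oracle} {spine clk} {Q} {ρ = clk ∷ body ∷ encodeℕ t ∷ []} findStepE (List.replicate r leaf) (encodeℕ r · bits p) ω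
    (leaf · bits (find clk body r p)) ω
  chain zero    p le = []
  chain (suc r) p le = do-node refl (do-bind (do-ask refl (≤-trans (query-size clk body r (true ∷ p))
      (≤-trans (+-monoˡ-≤ 8 (+-monoʳ-≤ (size clk + size body) (*-monoʳ-≤ 4 le′))) small))) (do-pure refl))
    ∷ chain r _ le′
    where
    le′ : suc (length p) + r ≤ t
    le′ = ≤-trans (≤-reflexive (sym (+-suc (length p) r))) le

pickE : E 5
pickE = bind (collect v3 (collect v3 flip)) (bind (pure (leaf · (v2 · (v3 · v0)))) (ren (#2 ∷ #0 ∷ #6 ∷ []) findE))

-- The loop entry and the state, a result paired with the examples, lie on top of eleven level
-- parameters. Whether a refutation exists is asked before one is searched for: the denial is the
-- certificate, and only then is the circuit of the vote emitted.
iterE : E 13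
iterE = bind (pure (match v1 leaf v1))
  (bind (collect v3 (collect v3 (ren (#8 ∷ #9 ∷ #0 ∷ #6 ∷ #5 ∷ []) pickE)))
  (bind (pure ((leaf · leaf) · (var #11 · (v8 · (var #14 · (v10 · v0))))))
  (bind (ask (v10 · (v0 · (v6 · leaf))))
  (match v0 (pure (ren (#12 ∷ #10 ∷ #2 ∷ []) circuitP · v3))
    (bind (ren (#13 ∷ #3 ∷ #9 ∷ []) findE)
      (pure (match v8 leaf v0 · (ren (#13 ∷ #0 ∷ []) sliceP · v6))))))))

levelE : E 6
levelE = bind (pure (ren (#2 ∷ #4 ∷ []) addP))
  (bind (pure (ren (#2 ∷ #0 ∷ []) lengthP))
  (bind (pure (app₂ addP (match v0 leaf v1) v0))
  (bind (pure (ren (#5 ∷ #6 ∷ []) addP))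
  (bind (pure (ren (#5 ∷ []) (powP 2)))
  (bind (fold (ren (#6 ∷ []) (powP 8)) (leaf · leaf) iterE)
  (pure (match v0 leaf v0)))))))

-- Runs of a level and the coins they consume

flatRow : ∀ {a} → Vec Bool a → List Bool
flatRow = flat (_∷ [])

flatCoins : ∀ {a b c d} → Vec (Vec (Vec (Vec Bool a) b) c) d → List Bool
flatCoins = flat (flat (flat flatRow))

module Running (clk : Tree) {n m} (F : Formula n m) (i : Fin m) (r Q R B : ℕ)
  (R≡ : R ≡ suc r ^ 8) (B≡ : B ≡ suc r ^ 2)
  (limit≤ : R ≤ spine clk) (wires≤ : n + toℕ i + suc r ≤ spine clk)
  (search≤ : hypLength (suc r) (n + toℕ i) + suc (hypLength (suc r) (n + toℕ i)) ≤ spine clk)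
  (variables≤ : n + m ≤ spine clk) (B≤ : B ≤ spine clk)
  (gates≤ : B * groupGates B (memberGates (suc r) (n + toℕ i)) + suc (n + toℕ i) + suc (n + toℕ i + suc r) ≤ spine clk) where

  open Level clk F i R r B limit≤ wires≤ search≤ variables≤ B≤ gates≤ public

  ballots-list : ∀ S (c : Coins) →
    listOf (λ g → listOf (bits ∘ choice S) (toList g)) (toList c) ≡ ballots (ballot S c)
  ballots-list S = go
    where
    inner : ∀ {b} (g : Vec (Vec (Vec Bool (suc ℓ)) (suc ℓ)) b) →
      listOf (bits ∘ choice S) (toList g) ≡ listOf bits (toList (Vec.map (choice S) g))
    inner []      = refl
    inner (ω ∷ g) = cong (bits (choice S ω) ·_) (inner g)
    go : ∀ {a b} (c : Vec (Vec (Vec (Vec Bool (suc ℓ)) (suc ℓ)) b) a) →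
      listOf (λ g → listOf (bits ∘ choice S) (toList g)) (toList c) ≡ ballots (Vec.map (Vec.map (choice S)) c)
    go []      = refl
    go (g ∷ c) = cong₂ _·_ (inner g) (go c)

  module Sized
    (choosing-small : ∀ (S : List (Labelled k)) (coins : Vec (Vec Bool (suc ℓ)) (suc ℓ)) → length S ≤ R → size clk + size (choosing (suc r) S coins) + 4 * (ℓ + suc ℓ) + 8 ≤ Q)
    (refuting-small : ∀ (S : List (Labelled k)) (c : Coins) → size clk + size (refutation S c) + 4 * (n + m) + 8 ≤ Q) where

    Run : ∀ {k} → Vec Tree k → E k → List Bool → Tree → List Bool → Set
    Run = RunsE {oracle} {spine clk} {Q}

    x≤ : suc r ≤ spine clk
    x≤ = ≤-trans (m≤n+m (suc r) k) wires≤

    λ≤ : suc ℓ ≤ spine clk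
    λ≤ = ≤-trans (m≤n+m (suc ℓ) ℓ) search≤

    k≤n+m : k ≤ n + m
    k≤n+m = +-monoʳ-≤ n (<⇒≤ (toℕ<n i))

    pick-runs : ∀ S c ω → length S ≤ R →
      Run (clk ∷ encodeℕ (suc r) ∷ listOf labelled S ∷ encodeℕ (suc ℓ) ∷ encodeℕ (ℓ + suc ℓ) ∷ [])
        pickE (flat flatRow c ++ ω) (bits (choice S c)) ω
    pick-runs S c ω short = do-bind
      (do-collect (bits ∘ toList) flatRow refl λ≤
        (λ row ω → do-collect bit (_∷ []) refl λ≤ (λ b ω → do-flip) row ω) c ω)
      (do-bind (do-pure refl) (do-ren (do-find clk (choosing (suc r) S c) (ℓ + suc ℓ) search≤ (choosing-small S c short) ω)))

    params : Vec Tree 11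
    params = encodeℕ B ∷ encodeℕ (n + m) ∷ encodeℕ (ℓ + suc ℓ) ∷ encodeℕ (suc ℓ) ∷ encodeℕ k ∷ clk ∷
      encodeℕ (suc r) ∷ encodeℕ n ∷ encodeℕ m ∷ encodeFin i ∷ encodeFormula F ∷ []

    Iterations : List Tree → Tree → List Bool → Tree → List Bool → Set
    Iterations = Chain {oracle} {spine clk} {Q} {ρ = params} iterE

    after : Tree → List (Labelled k) → Coins → Tree × List (Labelled k)
    after res S c = if challenged S c then (res , example (counterexample S c) ∷ S)
      else (encodeCircuit (proj₁ (learned S c)) , S)

    after-true : ∀ res S c → challenged S c ≡ true → after res S c ≡ (res , example (counterexample S c) ∷ S)
    after-true res S c = cong λ b → if b then (res , example (counterexample S c) ∷ S)
      else (encodeCircuit (proj₁ (learned S c)) , S)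

    after-false : ∀ res S c → challenged S c ≡ false → after res S c ≡ (encodeCircuit (proj₁ (learned S c)) , S)
    after-false res S c = cong λ b → if b then (res , example (counterexample S c) ∷ S)
      else (encodeCircuit (proj₁ (learned S c)) , S)

    step-true : ∀ S c → challenged S c ≡ true → step S c ≡ just (example (counterexample S c))
    step-true S c = cong λ b → if b then just (example (counterexample S c)) else nothing

    iter-runs : ∀ y res S c ω → length S ≤ R →
      Run (y ∷ (res · listOf labelled S) ∷ params) iterE (flatCoins c ++ ω)
        (pair id (listOf labelled) (after res S c)) ω
    iter-runs y res S c ω short = do-bind (do-pure refl) (do-bind votes (do-bind (do-pure refl)
      (do-bind (do-ask refl (≤-trans (query-size clk (refutation S c) (n + m) []) (refuting-small S c))) decide)))
      where
      votes : Run (listOf labelled S ∷ y ∷ (res · listOf labelled S) ∷ params) _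
        (flatCoins c ++ ω) (ballots (ballot S c)) ω
      votes = subst (λ v → RunsE (listOf labelled S ∷ y ∷ (res · listOf labelled S) ∷ params) _ (flatCoins c ++ ω) v ω)
        (ballots-list S c)
        (do-collect (λ g → listOf (bits ∘ choice S) (toList g)) (flat (flat flatRow)) refl B≤
          (λ g ω → do-collect (bits ∘ choice S) (flat flatRow) refl B≤
            (λ ω₁ ω → do-ren (pick-runs S ω₁ ω short)) g ω) c ω)
      decide : Run (bit (challenged S c) ∷ refutation S c ∷ ballots (ballot S c) ∷ listOf labelled S ∷ y ∷
        (res · listOf labelled S) ∷ params) _ ω (pair id (listOf labelled) (after res S c)) ω
      decide with challenged S c
      ... | false = do-leaf refl (do-pure (cong (_· listOf labelled S) (proj₁ (proj₂ (learned S c)))))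
      ... | true  = do-node refl (do-bind (do-ren (do-find clk (refutation S c) (n + m) variables≤ (refuting-small S c) ω))
        (do-pure (cong (λ e → res · (e · listOf labelled S))
          (trans (cong (λ rb → sem (spine clk) sliceP (encodeℕ k ∷ bits rb ∷ [])) split)
            (sliceP-spec (takePad k rb) (List.drop k rb) (≤-trans k≤n+m variables≤))))))
        where
        rb : List Bool
        rb = counterexample S c
        split : rb ≡ toList (takePad k rb) ++ List.drop k rb
        split with find-suffix clk (refutation S c) (n + m) []
        ... | u , len , eq = takePad-drop k rb (≤-trans k≤n+m
          (≤-reflexive (sym (trans (cong length (trans eq (++-identityʳ u))) len))))

    Skolem : Tree → Set
    Skolem res = ∃ λ (h : CircuitFor n i) → IsSkolemFunction F i h × res ≡ encodeCircuit h × gates h ≤ spine clk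

    module _ (d : ℕ) where

      open Abstract d using (found; found-just)

      -- The result is at all times a leaf or a certified circuit. A later round can replace a
      -- certified circuit only by another one, so a single round without refutation settles the
      -- level.
      iterations : ∀ {r′} (cs : Vec Coins r′) res S ω → length S + r′ ≤ R → res ≡ leaf ⊎ Skolem res →
        ∃ λ res′ → ∃ λ (S′ : List (Labelled k)) →
          Iterations (List.replicate r′ leaf) (res · listOf labelled S) (flat flatCoins cs ++ ω)
            (res′ · listOf labelled S′) ω ×
          (res′ ≡ leaf ⊎ Skolem res′) × (Skolem res ⊎ found S cs ≡ true → Skolem res′)
      iterations []       res S ω short sk = res , S , [] , sk , λ { (inj₁ s) → s }
      iterations {suc r′} (c ∷ cs) res S ω short sk = branch (challenged S c) refl
        where
        Result : Set
        Result = ∃ λ res′ → ∃ λ (S′ : List (Labelled k)) →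
          Iterations (List.replicate (suc r′) leaf) (res · listOf labelled S)
            (flat flatCoins (c ∷ cs) ++ ω) (res′ · listOf labelled S′) ω ×
          (res′ ≡ leaf ⊎ Skolem res′) × (Skolem res ⊎ found S (c ∷ cs) ≡ true → Skolem res′)
        prepend : ∀ {res₁} {S₁ : List (Labelled k)} {v} → after res S c ≡ (res₁ , S₁) →
          Iterations (List.replicate r′ leaf) (res₁ · listOf labelled S₁) (flat flatCoins cs ++ ω) v ω →
          Iterations (List.replicate (suc r′) leaf) (res · listOf labelled S) (flat flatCoins (c ∷ cs) ++ ω) v ω
        prepend {v = v} eq chain =
          subst (λ ω′ → Iterations (List.replicate (suc r′) leaf) (res · listOf labelled S) ω′ v ω)
            (sym (++-assoc (flatCoins c) (flat flatCoins cs) ω))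
            (subst (λ s → RunsE (leaf ∷ (res · listOf labelled S) ∷ params) iterE (flatCoins c ++ flat flatCoins cs ++ ω)
                (pair id (listOf labelled) s) (flat flatCoins cs ++ ω)) eq
              (iter-runs leaf res S c (flat flatCoins cs ++ ω) (≤-trans (m≤m+n _ _) short)) ∷ chain)
        branch : ∀ b → challenged S c ≡ b → Result
        branch true asked with iterations cs res (example (counterexample S c) ∷ S) ω (≤-trans (≤-reflexive (sym (+-suc _ r′))) short) sk
        ... | res′ , S′ , chain , sk′ , success = res′ , S′ ,
          prepend (after-true res S c asked) chain , sk′ ,
          λ { (inj₁ s) → success (inj₁ s)
            ; (inj₂ f) → success (inj₂ (trans (sym (found-just S c cs (step-true S c asked))) f)) }
        branch false asked
          with iterations cs (encodeCircuit (proj₁ (learned S c))) S ω (≤-trans (+-monoʳ-≤ (length S) (n≤1+n r′)) short)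
            (inj₂ (proj₁ (learned S c) , learned-skolem S c asked , refl , proj₂ (proj₂ (proj₂ (learned S c)))))
        ... | res′ , S′ , chain , sk′ , success = res′ , S′ ,
          prepend (after-false res S c asked) chain , sk′ ,
          λ _ → success (inj₁ (proj₁ (learned S c) , learned-skolem S c asked , refl , proj₂ (proj₂ (proj₂ (learned S c)))))

      level-runs : ∀ (cs : Vec Coins (R)) ω → ∃ λ res →
        Run (clk ∷ encodeℕ (suc r) ∷ encodeℕ n ∷ encodeℕ m ∷ encodeFin i ∷ encodeFormula F ∷ []) levelE
          (flat flatCoins cs ++ ω) res ω ×
        (res ≡ leaf ⊎ Skolem res) × (found [] cs ≡ true → Skolem res)
      level-runs cs ω with iterations cs leaf [] ω ≤-refl (inj₁ refl)
      ... | res , S , chain , sk , success = res ,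
        do-bind (do-pure (addP-spec n (toℕ i) n≤))
        (do-bind (do-pure (lengthP-spec (suc r) k wires≤))
        (do-bind (do-pure (addP-spec ℓ (suc ℓ) (≤-trans (n≤1+n ℓ) λ≤)))
        (do-bind (do-pure (addP-spec n m n≤))
        (do-bind (do-pure (trans (powP-spec 2 (suc r) x≤) (cong encodeℕ (sym B≡))))
        (do-bind (do-fold (trans (powP-spec 8 (suc r) x≤) (trans (cong encodeℕ (sym R≡)) (replicate-encodeℕ R)))
            (≤-trans (≤-reflexive (length-replicate (R))) limit≤) refl chain)
        (do-pure refl)))))) , sk , success ∘ inj₂

-- Size estimates by degrees

-- Only exponents are tracked: a product adds them, a sum costs one more since 2 ≤ x, and constants
-- up to 40 count as degree one. The same threshold 40 absorbs the constant 32 of the error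
-- analysis.
record Deg (x i a : ℕ) : Set where
  constructor deg
  field bound : a ≤ x ^ i

open Deg

module Degrees (x : ℕ) (x≥40 : 40 ≤ x) where

  instance
    x≢0 : NonZero x
    x≢0 = >-nonZero (≤-trans (s≤s z≤n) x≥40)

  2≤x : 2 ≤ x
  2≤x = ≤-trans (m≤m+n 2 38) x≥40

  deg-const : ∀ c → {T (c ≤ᵇ 40)} → Deg x 1 c
  deg-const c {c≤} .bound = ≤-trans (≤-trans (≤ᵇ⇒≤ c 40 c≤) x≥40) (≤-reflexive (sym (*-identityʳ x)))

  deg-var : ∀ {a} → a ≤ x → Deg x 1 a
  deg-var le .bound = ≤-trans le (≤-reflexive (sym (*-identityʳ x)))

  deg-less : ∀ {a b i} → a ≤ b → Deg x i b → Deg x i a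
  deg-less le d .bound = ≤-trans le (d .bound)

  deg-power : ∀ {a} → a ≤ x → ∀ i → Deg x i (a ^ i)
  deg-power le i .bound = ^-monoˡ-≤ i le

  deg-up : ∀ {i a} j → {T (i ≤ᵇ j)} → Deg x i a → Deg x j a
  deg-up {i} j {i≤j} d .bound = ≤-trans (d .bound) (^-monoʳ-≤ x (≤ᵇ⇒≤ i j i≤j))

  infixl 6 _⊞_
  infixl 7 _⊠_

  _⊞_ : ∀ {i j a b} → Deg x i a → Deg x j b → Deg x (suc (i ⊔ j)) (a + b)
  _⊞_ {i} {j} {a} {b} d e .bound = begin
    a + b                             ≤⟨ +-mono-≤ (≤-trans (d .bound) (^-monoʳ-≤ x (m≤m⊔n i j))) (≤-trans (e .bound) (^-monoʳ-≤ x (m≤n⊔m i j))) ⟩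
    x ^ (i ⊔ j) + x ^ (i ⊔ j)         ≡⟨ cong (x ^ (i ⊔ j) +_) (+-identityʳ _) ⟨
    2 * x ^ (i ⊔ j)                   ≤⟨ *-monoˡ-≤ (x ^ (i ⊔ j)) 2≤x ⟩
    x ^ suc (i ⊔ j) ∎
    where open ≤-Reasoning

  _⊠_ : ∀ {i j a b} → Deg x i a → Deg x j b → Deg x (i + j) (a * b)
  _⊠_ {i} {j} d e .bound = ≤-trans (*-mono-≤ (d .bound) (e .bound)) (≤-reflexive (sym (^-distribˡ-+-* x i j)))

hypLength≤ : ∀ r e → hypLength r e ≤ r * (e + r)
hypLength≤ zero    e = z≤n
hypLength≤ (suc r) e = begin
  e + hypLength r (suc e) ≤⟨ +-mono-≤ (m≤m+n e (suc r)) (hypLength≤ r (suc e)) ⟩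
  e + suc r + r * (suc e + r) ≡⟨ cong (λ u → e + suc r + r * u) (+-suc e r) ⟨
  suc r * (e + suc r) ∎
  where open ≤-Reasoning

spine-encodeℕ : ∀ n → spine (encodeℕ n) ≡ n
spine-encodeℕ zero    = refl
spine-encodeℕ (suc n) = cong suc (spine-encodeℕ n)

size-encodeFin : ∀ {k} (a : Fin k) → size (encodeFin a) ≤ 2 * k + 1
size-encodeFin {k} a = ≤-trans (≤-reflexive (size-encodeℕ (toℕ a))) (+-monoˡ-≤ 1 (*-monoʳ-≤ 2 (<⇒≤ (toℕ<n a))))

size-bit : ∀ b → size (bit b) ≤ 3
size-bit false = s≤s z≤n
size-bit true  = ≤-refl

size-encodeGate : ∀ {k} (g : Gate k) → size (encodeGate g) ≤ 4 * k + 12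
size-encodeGate {k} (const b) = ≤-trans (s≤s (s≤s (size-bit b))) (≤-trans (m≤m+n 5 7) (m≤n+m 12 (4 * k)))
size-encodeGate {k} (neg a)   = ≤-trans (s≤s (+-monoʳ-≤ 3 (size-encodeFin a))) (≤-trans (m≤m+n _ (2 * k + 7)) (≤-reflexive (lemma k)))
  where
  lemma : ∀ k → 4 + (2 * k + 1) + (2 * k + 7) ≡ 4 * k + 12
  lemma = solve-∀
size-encodeGate {k} (and a b) = ≤-trans (s≤s (+-monoʳ-≤ 5 (s≤s (+-mono-≤ (size-encodeFin a) (size-encodeFin b))))) (≤-trans (m≤m+n _ 3) (≤-reflexive (lemma k)))
  where
  lemma : ∀ k → 6 + (1 + (2 * k + 1 + (2 * k + 1))) + 3 ≡ 4 * k + 12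
  lemma = solve-∀
size-encodeGate {k} (or a b)  = ≤-trans (s≤s (+-monoʳ-≤ 7 (s≤s (+-mono-≤ (size-encodeFin a) (size-encodeFin b))))) (≤-trans (m≤m+n _ 1) (≤-reflexive (lemma k)))
  where
  lemma : ∀ k → 8 + (1 + (2 * k + 1 + (2 * k + 1))) + 1 ≡ 4 * k + 12
  lemma = solve-∀

size-encodeCircuit : ∀ {k} (h : Circuit k) → size (encodeCircuit h) ≤ suc (gates h) * (4 * (k + gates h) + 13)
size-encodeCircuit {k} (output a) = ≤-trans (s≤s (s≤s (size-encodeFin a)))
  (≤-trans (m≤m+n _ (2 * k + 10)) (≤-reflexive (lemma k)))
  where
  lemma : ∀ k → 2 + (2 * k + 1) + (2 * k + 10) ≡ 1 * (4 * (k + 0) + 13)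
  lemma = solve-∀
size-encodeCircuit {k} (gate g h) = begin
  1 + (size (encodeGate g) + size (encodeCircuit h))
    ≤⟨ s≤s (+-mono-≤ (size-encodeGate g) (size-encodeCircuit h)) ⟩
  1 + (4 * k + 12 + suc (gates h) * (4 * (suc k + gates h) + 13))
    ≤⟨ m≤m+n _ (4 * suc (gates h)) ⟩
  1 + (4 * k + 12 + suc (gates h) * (4 * (suc k + gates h) + 13)) + 4 * suc (gates h)
    ≡⟨ lemma k (gates h) ⟩
  suc (suc (gates h)) * (4 * (k + suc (gates h)) + 13) ∎
  where
  open ≤-Reasoning
  lemma : ∀ k g → 1 + (4 * k + 12 + (1 + g) * (4 * (1 + k + g) + 13)) + 4 * (1 + g) ≡ (2 + g) * (4 * (k + (1 + g)) + 13)
  lemma = solve-∀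

size-encodeFormula : ∀ {n m} (F : Formula n m) → size (encodeFormula F) ≤ nodes F * (2 * (n + m) + 16)
size-encodeFormula {n} {m} (X j) = ≤-trans (s≤s (s≤s (size-encodeFin j))) (≤-trans (m≤m+n _ (2 * m + 13)) (≤-reflexive (lemma n m)))
  where
  lemma : ∀ n m → 2 + (2 * n + 1) + (2 * m + 13) ≡ 1 * (2 * (n + m) + 16)
  lemma = solve-∀
size-encodeFormula {n} {m} (Y j) = ≤-trans (s≤s (+-monoʳ-≤ 3 (size-encodeFin j))) (≤-trans (m≤m+n _ (2 * n + 11)) (≤-reflexive (lemma n m)))
  where
  lemma : ∀ n m → 4 + (2 * m + 1) + (2 * n + 11) ≡ 1 * (2 * (n + m) + 16)
  lemma = solve-∀
size-encodeFormula {n} {m} (const b) = ≤-trans (s≤s (+-monoʳ-≤ 5 (size-bit b))) (≤-trans (m≤m+n 9 (2 * (n + m) + 7)) (≤-reflexive (lemma (n + m))))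
  where
  lemma : ∀ n → 9 + (2 * n + 7) ≡ 1 * (2 * n + 16)
  lemma = solve-∀
size-encodeFormula {n} {m} (neg F) = ≤-trans (s≤s (+-monoʳ-≤ 7 (size-encodeFormula F)))
  (+-monoˡ-≤ _ (≤-trans (m≤m+n 8 8) (m≤n+m 16 (2 * (n + m)))))
size-encodeFormula {n} {m} (and F G) = ≤-trans (s≤s (+-monoʳ-≤ 9 (s≤s (+-mono-≤ (size-encodeFormula F) (size-encodeFormula G)))))
  (≤-trans (+-monoˡ-≤ (nodes F * (2 * (n + m) + 16) + nodes G * (2 * (n + m) + 16)) (≤-trans (m≤m+n 11 5) (m≤n+m 16 (2 * (n + m)))))
    (≤-reflexive (cong (2 * (n + m) + 16 +_) (sym (*-distribʳ-+ (2 * (n + m) + 16) (nodes F) (nodes G))))))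
size-encodeFormula {n} {m} (or F G) = ≤-trans (s≤s (+-monoʳ-≤ 11 (s≤s (+-mono-≤ (size-encodeFormula F) (size-encodeFormula G)))))
  (≤-trans (+-monoˡ-≤ (nodes F * (2 * (n + m) + 16) + nodes G * (2 * (n + m) + 16)) (≤-trans (m≤m+n 13 3) (m≤n+m 16 (2 * (n + m)))))
    (≤-reflexive (cong (2 * (n + m) + 16 +_) (sym (*-distribʳ-+ (2 * (n + m) + 16) (nodes F) (nodes G))))))

-- Cutting a sequence of coin tosses into the pieces that a level consumes.

parse : ∀ {A : Set} {a} → (Vec Bool a → A) → ∀ n → Vec Bool (n * a) → Vec A n
parse         p zero    ω = []
parse {a = a} p (suc n) ω = p (Vec.take a ω) ∷ parse p n (Vec.drop a ω)

take-++ : ∀ {A : Set} a {b} (u : Vec A a) (v : Vec A b) → Vec.take a (u Vec.++ v) ≡ u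
take-++ zero    []      v = refl
take-++ (suc a) (x ∷ u) v = cong (x ∷_) (take-++ a u v)

drop-++ : ∀ {A : Set} a {b} (u : Vec A a) (v : Vec A b) → Vec.drop a (u Vec.++ v) ≡ v
drop-++ zero    []      v = refl
drop-++ (suc a) (x ∷ u) v = drop-++ a u v

flat-parse : ∀ {A : Set} {a} {p : Vec Bool a → A} {fl : A → List Bool} → (∀ u → fl (p u) ≡ toList u) →
  ∀ n ω → flat fl (parse p n ω) ≡ toList ω
flat-parse         e zero    [] = refl
flat-parse {a = a} e (suc n) ω  = trans (cong₂ _++_ (e (Vec.take a ω)) (flat-parse e n (Vec.drop a ω)))
  (trans (sym (toList-++ (Vec.take a ω) (Vec.drop a ω))) (cong toList (take++drop≡id a ω)))

∑-cube-++ : ∀ a b (f : Vec Bool (a + b) → ℕ) →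
  ∑ (cube (a + b)) f ≡ ∑ (cube a) (λ u → ∑ (cube b) (λ v → f (u Vec.++ v)))
∑-cube-++ zero    b f = sym (+-identityʳ _)
∑-cube-++ (suc a) b f = trans (∑-vecs bools (a + b) f)
  (trans (∑-cong bools λ c → ∑-cube-++ a b (λ w → f (c ∷ w))) (sym (∑-vecs bools a _)))

-- Blocks cut from independent bits are independent. This transfers counts over coin sequences to
-- the nested sample spaces of the analysis.
∑-parse : ∀ {A : Set} {as : List A} {a} {p : Vec Bool a → A} → (∀ f → ∑ (cube a) (f ∘ p) ≡ ∑ as f) →
  ∀ n f → ∑ (cube (n * a)) (f ∘ parse p n) ≡ ∑ (vecs as n) f
∑-parse                  e zero    f = refl
∑-parse {as = as} {a} {p} e (suc n) f = begin
  ∑ (cube (a + n * a)) (f ∘ parse p (suc n)) ≡⟨ ∑-cube-++ a (n * a) _ ⟩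
  ∑ (cube a) (λ u → ∑ (cube (n * a)) (λ v → f (p (Vec.take a (u Vec.++ v)) ∷ parse p n (Vec.drop a (u Vec.++ v)))))
    ≡⟨ ∑-cong (cube a) (λ u → ∑-cong (cube (n * a)) λ v →
         cong₂ (λ u v → f (p u ∷ parse p n v)) (take-++ a u v) (drop-++ a u v)) ⟩
  ∑ (cube a) (λ u → ∑ (cube (n * a)) (λ v → f (p u ∷ parse p n v)))
    ≡⟨ ∑-cong (cube a) (λ u → ∑-parse {as = as} e n (λ v → f (p u ∷ v))) ⟩
  ∑ (cube a) (λ u → ∑ (vecs as n) (λ v → f (p u ∷ v))) ≡⟨ e (λ b → ∑ (vecs as n) (λ v → f (b ∷ v))) ⟩
  ∑ as (λ b → ∑ (vecs as n) (λ v → f (b ∷ v))) ≡⟨ ∑-vecs as n f ⟨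
  ∑ (vecs as (suc n)) f ∎
  where open ≡-Reasoning

-- The coins before and after the block that the event looks at only multiply its count.
∑-middle : ∀ a b c (f : Vec Bool b → ℕ) →
  ∑ (cube (a + (b + c))) (λ ω → f (Vec.take b (Vec.drop a ω))) ≡ 2 ^ a * (2 ^ c * ∑ (cube b) f)
∑-middle a b c f = begin
  ∑ (cube (a + (b + c))) (λ ω → f (Vec.take b (Vec.drop a ω))) ≡⟨ ∑-cube-++ a (b + c) _ ⟩
  ∑ (cube a) (λ u → ∑ (cube (b + c)) (λ v → f (Vec.take b (Vec.drop a (u Vec.++ v)))))
    ≡⟨ ∑-cong (cube a) (λ u → trans (∑-cong (cube (b + c)) λ v → cong (f ∘ Vec.take b) (drop-++ a u v)) (∑-cube-++ b c _)) ⟩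
  ∑ (cube a) (λ _ → ∑ (cube b) (λ v → ∑ (cube c) (λ w → f (Vec.take b (v Vec.++ w)))))
    ≡⟨ trans (∑-const (cube a) _) (cong (_* _) (length-cube a)) ⟩
  2 ^ a * ∑ (cube b) (λ v → ∑ (cube c) (λ w → f (Vec.take b (v Vec.++ w))))
    ≡⟨ cong (2 ^ a *_) (trans (∑-cong (cube b) λ v → trans (∑-cong (cube c) λ w → cong f (take-++ b v w))
         (trans (∑-const (cube c) (f v)) (cong (_* f v) (length-cube c)))) (∑-*ˡ (cube b) (2 ^ c) f)) ⟩
  2 ^ a * (2 ^ c * ∑ (cube b) f) ∎
  where open ≡-Reasoning

opaque

  -- A level runs all its R rounds, also after a success, so the number of coins that it consumes
  -- does not depend on outcomes. Coin sequences can thus be cut in advance.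
  coinsAt : ℕ → ℕ → ℕ → ℕ
  coinsAt R B ℓ = R * (B * (B * (suc ℓ * suc ℓ)))

  parseCoins : ∀ R B ℓ → Vec Bool (coinsAt R B ℓ) → Vec (Vec (Vec (Vec (Vec Bool (suc ℓ)) (suc ℓ)) B) B) R
  parseCoins R B ℓ = parse (parse (parse (parse id (suc ℓ)) B) B) R

  flat-parseCoins : ∀ R B ℓ u → flat flatCoins (parseCoins R B ℓ u) ≡ toList u
  flat-parseCoins R B ℓ = flat-parse {fl = flatCoins} (flat-parse {fl = flat (flat flatRow)}
    (flat-parse {fl = flat flatRow} (flat-parse {fl = flatRow} flatRow-id (suc ℓ)) B) B) R
    where
    flatRow-id : ∀ {a} (u : Vec Bool a) → flatRow u ≡ toList u
    flatRow-id []      = refl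
    flatRow-id (b ∷ u) = cong (b ∷_) (flatRow-id u)

  ∑-parseCoins : ∀ R B ℓ f → ∑ (cube (coinsAt R B ℓ)) (f ∘ parseCoins R B ℓ) ≡
    ∑ (vecs (vecs (vecs (vecs (cube (suc ℓ)) (suc ℓ)) B) B) R) f
  ∑-parseCoins R B ℓ = ∑-parse {as = vecs (vecs (vecs rows (suc ℓ)) B) B} {p = parse (parse (parse id (suc ℓ)) B) B}
    (∑-parse {as = vecs (vecs rows (suc ℓ)) B} {p = parse (parse id (suc ℓ)) B}
    (∑-parse {as = vecs rows (suc ℓ)} {p = parse id (suc ℓ)}
    (∑-parse {as = rows} {p = id} (λ f → refl) (suc ℓ)) B) B) R
    where
    rows : List (Vec Bool (suc ℓ))
    rows = cube (suc ℓ)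

  coinsAt≤ : ∀ {w} → 40 ≤ w → ∀ R B ℓ → Deg w 8 R → Deg w 2 B → Deg w 3 (suc ℓ) → coinsAt R B ℓ ≤ w ^ 18
  coinsAt≤ {w} 40≤w R B ℓ dR dB dℓ = (dR ⊠ (dB ⊠ (dB ⊠ (dℓ ⊠ dℓ)))) .bound
    where open Degrees w 40≤w

-- X is the last level.  The number suc x of rows is called y because normal
-- forms of powers of a successor are exponentially large.
module AtLevel {n m} (F : Formula n m) (i : Fin m) (X y x : ℕ) (y≡ : y ≡ suc x) (40≤y : 40 ≤ y) (y≤X : y ≤ X)
  (vars≤y : n + m ≤ y) (nodes≤ : nodes F ≤ X) (N R B Q : ℕ)
  (Q≡ : Q ≡ X ^ 40) (N≡ : N ≡ y ^ 24) (R≡ : R ≡ y ^ 8) (B≡ : B ≡ y ^ 2) where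

  -- The exponents are generous: 24 exceeds the degree of every number that a level has to count to,
  -- and 40 that of every query, to which the clock itself contributes degree 25.
  clk : Tree
  clk = encodeℕ N

  private
    module D = Degrees y 40≤y

  40≤X : 40 ≤ X
  40≤X = ≤-trans 40≤y y≤X

  in-clock : ∀ {i a} → {T (i ≤ᵇ 24)} → Deg y i a → a ≤ spine clk
  in-clock {i} {a} {le} d = ≤-trans (D.deg-up 24 {le} d .bound) (≤-reflexive (sym (trans (spine-encodeℕ N) N≡)))

  k≤y : n + toℕ i ≤ y
  k≤y = ≤-trans (+-monoʳ-≤ n (<⇒≤ (toℕ<n i))) vars≤y

  module _ {w} (le : y ≤ w) (40≤w : 40 ≤ w) where
    open Degrees w 40≤w

    deg-k : Deg w 1 (n + toℕ i)
    deg-k = deg-var (≤-trans k≤y le)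

    deg-R : Deg w 8 R
    deg-R = deg-less (≤-reflexive R≡) (deg-power le 8)

    deg-B : Deg w 2 B
    deg-B = deg-less (≤-reflexive B≡) (deg-power le 2)

    deg-λ : Deg w 3 (suc (hypLength (suc x) (n + toℕ i)))
    deg-λ .bound = begin
      suc (hypLength (suc x) (n + toℕ i)) ≤⟨ s≤s (hypLength≤ (suc x) (n + toℕ i)) ⟩
      suc (suc x * (n + toℕ i + suc x))   ≤⟨ s≤s (*-mono-≤ x≤w (+-mono-≤ (≤-trans k≤y le) x≤w)) ⟩
      suc (w * (w + w))                   ≤⟨ s≤s (≤-reflexive (lemma₁ w)) ⟩
      1 + 2 * (w * w)                     ≤⟨ +-monoˡ-≤ (2 * (w * w)) (*-mono-≤ 1≤w 1≤w) ⟩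
      w * w + 2 * (w * w)                 ≤⟨ *-monoˡ-≤ (w * w) (≤-trans (m≤m+n 3 37) 40≤w) ⟩
      w * (w * w)                         ≡⟨ lemma₂ w ⟩
      w ^ 3 ∎
      where
      open ≤-Reasoning
      x≤w : suc x ≤ w
      x≤w = ≤-trans (≤-reflexive (sym y≡)) le
      1≤w : 1 ≤ w
      1≤w = ≤-trans (s≤s z≤n) 40≤w
      lemma₁ : ∀ w → w * (w + w) ≡ 2 * (w * w)
      lemma₁ = solve-∀
      lemma₂ : ∀ w → w * (w * w) ≡ w * (w * (w * 1))
      lemma₂ = solve-∀

    deg-ℓ : Deg w 3 (hypLength (suc x) (n + toℕ i))
    deg-ℓ = deg-less (n≤1+n _) deg-λ

    deg-search : Deg w 4 (hypLength (suc x) (n + toℕ i) + suc (hypLength (suc x) (n + toℕ i)))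
    deg-search = deg-ℓ ⊞ deg-λ

    deg-N : Deg w 24 N
    deg-N = deg-less (≤-reflexive N≡) (deg-power le 24)

    deg-nat : ∀ {i a} → Deg w i a → Deg w (suc i) (size (encodeℕ a))
    deg-nat {i} {a} d .bound = begin
      size (encodeℕ a)  ≡⟨ size-encodeℕ a ⟩
      2 * a + 1         ≤⟨ +-mono-≤ (*-monoʳ-≤ 2 (d .bound)) (m^n>0 w i) ⟩
      2 * w ^ i + w ^ i ≡⟨ +-comm (2 * w ^ i) (w ^ i) ⟩
      3 * w ^ i         ≤⟨ *-monoˡ-≤ (w ^ i) (≤-trans (m≤m+n 3 37) 40≤w) ⟩
      w ^ suc i ∎
      where open ≤-Reasoning

  opaque

    R≤ : R ≤ spine clk
    R≤ = in-clock (deg-R ≤-refl 40≤y)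

    wires≤ : n + toℕ i + suc x ≤ spine clk
    wires≤ = in-clock (deg-k ≤-refl 40≤y D.⊞ D.deg-var (≤-reflexive (sym y≡)))

    search≤ : hypLength (suc x) (n + toℕ i) + suc (hypLength (suc x) (n + toℕ i)) ≤ spine clk
    search≤ = in-clock (deg-search ≤-refl 40≤y)

    vars≤ : n + m ≤ spine clk
    vars≤ = in-clock (D.deg-var vars≤y)

    B≤ : B ≤ spine clk
    B≤ = in-clock (deg-B ≤-refl 40≤y)

    gates≤ : B * groupGates B (memberGates (suc x) (n + toℕ i)) + suc (n + toℕ i) + suc (n + toℕ i + suc x) ≤ spine clk
    gates≤ = in-clock (deg-B ≤-refl 40≤y D.⊠ (D.deg-const 2 D.⊞ deg-B ≤-refl 40≤y D.⊠ (D.deg-const 1 D.⊞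
        D.deg-var (≤-reflexive (sym y≡)) D.⊠ (deg-k ≤-refl 40≤y D.⊞ D.deg-var (≤-reflexive (sym y≡)) D.⊞ D.deg-const 2)))
      D.⊞ (D.deg-const 1 D.⊞ deg-k ≤-refl 40≤y) D.⊞ (D.deg-const 1 D.⊞ (deg-k ≤-refl 40≤y D.⊞ D.deg-var (≤-reflexive (sym y≡)))))

  open Running clk F i x Q R B (trans R≡ (cong (_^ 8) y≡)) (trans B≡ (cong (_^ 2) y≡)) R≤ wires≤ search≤ vars≤ B≤ gates≤ public

  private
    open Degrees X 40≤X

    d-clk : Deg X 25 (size clk)
    d-clk = deg-nat y≤X 40≤X (deg-N y≤X 40≤X)

    d-x : Deg X 1 (suc x)
    d-x = deg-var (≤-trans (≤-reflexive (sym y≡)) y≤X)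

    d-n+m : Deg X 1 (n + m)
    d-n+m = deg-var (≤-trans vars≤y y≤X)

    d-n : Deg X 1 n
    d-n = deg-less (m≤m+n n m) d-n+m

    size-labelled : ∀ (e : Labelled k) → size (labelled e) ≤ 4 * k + 5
    size-labelled (z , v) = begin
      1 + (size (bits (toList z)) + size (bit v)) ≤⟨ s≤s (+-mono-≤ (size-bits (toList z)) (size-bit v)) ⟩
      1 + (4 * length (toList z) + 1 + 3)         ≡⟨ cong (λ l → 1 + (4 * l + 1 + 3)) (length-toList z) ⟩
      1 + (4 * k + 1 + 3)                         ≡⟨ lemma k ⟩
      4 * k + 5 ∎
      where
      open ≤-Reasoning
      lemma : ∀ k → 1 + (4 * k + 1 + 3) ≡ 4 * k + 5
      lemma = solve-∀

    size-row : ∀ {a} (row : Vec Bool a) → size (bits (toList row)) ≤ 4 * a + 1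
    size-row {a} row = ≤-trans (size-bits (toList row)) (≤-reflexive (cong (λ l → 4 * l + 1) (length-toList row)))

    d-listOf : ∀ {A : Set} (e : A → Tree) {w i j} → (∀ a → size (e a) ≤ w) → Deg X i w → ∀ as → Deg X j (length as) →
      Deg X (suc (suc (j + suc (1 ⊔ i)) ⊔ 1)) (size (listOf e as))
    d-listOf e {w} {i} {j} le d as d′ = deg-less (size-listOf e w le as) (deg-more (d′ ⊠ (deg-const 1 ⊞ d)) ⊞ deg-const 1)
      where
      deg-more : ∀ {i a} → Deg X i a → Deg X (suc i) a
      deg-more {i} d .bound = ≤-trans (d .bound) (^-monoʳ-≤ X (n≤1+n i))

    d-examples : ∀ S → length S ≤ R → Deg X 15 (size (listOf labelled S))
    d-examples S short = deg-up 15 (d-listOf labelled size-labelled (deg-const 4 ⊠ deg-k y≤X 40≤X ⊞ deg-const 5) S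
      (deg-less short (deg-R y≤X 40≤X)))

    d-matrix : ∀ (c : Vec (Vec Bool (suc ℓ)) (suc ℓ)) → Deg X 12 (size (matrix c))
    d-matrix c = deg-up 12 (d-listOf (bits ∘ toList) size-row (deg-const 4 ⊠ deg-λ y≤X 40≤X ⊞ deg-const 1) (toList c)
      (deg-less (≤-reflexive (length-toList c)) (deg-λ y≤X 40≤X)))

    d-ballots : ∀ S (c : Coins) → Deg X 16 (size (ballots (ballot S c)))
    d-ballots S c = subst (λ t → Deg X 16 (size t)) (ballots-list S c)
      (deg-up 16 (d-listOf (λ g → listOf (bits ∘ choice S) (toList g))
        (λ g → ≤-trans (size-listOf (bits ∘ choice S) (4 * (ℓ + suc ℓ) + 1) size-choice (toList g))
          (≤-reflexive (cong (λ l → l * suc (4 * (ℓ + suc ℓ) + 1) + 1) (length-toList g))))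
        (deg-B y≤X 40≤X ⊠ (deg-const 1 ⊞ (deg-const 4 ⊠ deg-search y≤X 40≤X ⊞ deg-const 1)) ⊞ deg-const 1)
        (toList c) (deg-less (≤-reflexive (length-toList c)) (deg-B y≤X 40≤X))))
      where
      size-choice : ∀ ω → size (bits (choice S ω)) ≤ 4 * (ℓ + suc ℓ) + 1
      size-choice ω = ≤-trans (size-bits (choice S ω)) (≤-reflexive (cong (λ l → 4 * l + 1) (length-choice S ω)))

    d-formula : Deg X 4 (size (encodeFormula F))
    d-formula = deg-less (size-encodeFormula F) (deg-var nodes≤ ⊠ (deg-const 2 ⊠ d-n+m ⊞ deg-const 16))

    in-Q : ∀ {a} → Deg X 40 a → a ≤ Q
    in-Q d = ≤-trans (d .bound) (≤-reflexive (sym Q≡))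

    choosing-small : ∀ S coins → length S ≤ R →
      size clk + size (choosing (suc x) S coins) + 4 * (ℓ + suc ℓ) + 8 ≤ Q
    choosing-small S coins short = in-Q (deg-up 40 (d-clk
      ⊞ (deg-const 1 ⊞ (deg-const 1 ⊞ (deg-const 1 ⊞ (deg-nat y≤X 40≤X d-x ⊞ (deg-const 1 ⊞ (d-examples S short ⊞ d-matrix coins))))))
      ⊞ deg-const 4 ⊠ deg-search y≤X 40≤X ⊞ deg-const 8))

    refuting-small : ∀ S c → size clk + size (refutation S c) + 4 * (n + m) + 8 ≤ Q
    refuting-small S c = in-Q (deg-up 40 (d-clk
      ⊞ (deg-const 1 ⊞ (deg-const 3 ⊞ (deg-const 1 ⊞ (deg-nat y≤X 40≤X d-n ⊞ (deg-const 1 ⊞ (deg-nat y≤X 40≤X (deg-k y≤X 40≤X) ⊞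
          (deg-const 1 ⊞ (d-formula ⊞ (deg-const 1 ⊞ (deg-nat y≤X 40≤X d-x ⊞ d-ballots S c))))))))))
      ⊞ deg-const 4 ⊠ d-n+m ⊞ deg-const 8))

  open Sized choosing-small refuting-small public

  Level-outcome : Tree → Set
  Level-outcome res = ∃ λ (h : CircuitFor n i) → IsSkolemFunction F i h × res ≡ encodeCircuit h × gates h ≤ X ^ 24

  skolem-outcome : ∀ {res} → Skolem res → Level-outcome res
  skolem-outcome (h , sk , eq , small) = h , sk , eq ,
    ≤-trans small (≤-trans (≤-reflexive (trans (spine-encodeℕ N) N≡)) (^-monoˡ-≤ 24 y≤X))

  coins≤ : coinsAt R B ℓ ≤ X ^ 18
  coins≤ = coinsAt≤ 40≤X R B ℓ (deg-R y≤X 40≤X) (deg-B y≤X 40≤X) (deg-λ y≤X 40≤X)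

  level-input : Vec Tree 6
  level-input = clk ∷ encodeℕ (suc x) ∷ encodeℕ n ∷ encodeℕ m ∷ encodeFin i ∷ encodeFormula F ∷ []

  LevelSuccess : List Bool → List Bool → Tree → Set
  LevelSuccess ω ω′ res = Run level-input levelE ω res ω′ × Level-outcome res

  parsed-runs : ∀ (u : Vec Bool (coinsAt R B ℓ)) {ω res} →
    Run level-input levelE (flat flatCoins (parseCoins R B ℓ u) ++ ω) res ω →
    Run level-input levelE (toList u ++ ω) res ω
  parsed-runs u {ω} {res} =
    subst (λ ω₀ → Run level-input levelE (ω₀ ++ ω) res ω) (flat-parseCoins R B ℓ u)

  -- For arbitrary coins a level may fail, but then it yields a leaf; a circuit is yielded only with
  -- a certificate. This is all that the levels before the last one have to provide.
  any-run : ∀ (u : Vec Bool (coinsAt R B ℓ)) ω → ∃ λ res →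
    Run level-input levelE (toList u ++ ω) res ω × (res ≡ leaf ⊎ Level-outcome res)
  any-run u ω = conclude (level-runs 0 (parseCoins R B ℓ u) ω)
    where
    weaken : ∀ {res} → res ≡ leaf ⊎ Skolem res → res ≡ leaf ⊎ Level-outcome res
    weaken (inj₁ e) = inj₁ e
    weaken (inj₂ s) = inj₂ (skolem-outcome s)
    conclude : _ → _
    conclude (res , run , sk , _) = res , parsed-runs u run , weaken sk

  module Target (c : ℕ) (c≤ : c + 10 ≤ y) (enough : nodes F ≤ y) (d : ℕ) (d≡ : suc d ≡ y ^ 5)
    (h : CircuitFor n i) (computes : Computes F i h) (s≤ : gates h * 3 + 2 ≤ suc x) where

    open Abstract d

    B-positive : 1 ≤ B
    B-positive = subst (1 ≤_) (sym B≡) (m^n>0 y ⦃ >-nonZero (≤-trans (s≤s z≤n) 40≤y) ⦄ 2)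

    D-large : 32 * (B * B) ≤ suc d
    D-large = begin
      32 * (B * B)                   ≡⟨ cong (λ b → 32 * (b * b)) B≡ ⟩
      32 * (y ^ 2 * y ^ 2)   ≡⟨ cong (32 *_) (^-distribˡ-+-* y 2 2) ⟨
      32 * y ^ 4                 ≤⟨ *-monoˡ-≤ (y ^ 4) (≤-trans (m≤m+n 32 8) 40≤y) ⟩
      y ^ 5                      ≡⟨ d≡ ⟨
      suc d ∎
      where open ≤-Reasoning

    d-positive : 1 ≤ d
    d-positive = ≤-pred (≤-trans (≤-trans (m≤m+n 2 30) (≤-trans (≤-reflexive (sym (*-identityʳ 32))) (*-monoʳ-≤ 32 (*-mono-≤ B-positive B-positive)))) D-large)

    -- Starting from 2^ℓ hypotheses, (d+1)(ℓ+1) shrinkings cannot all take place. With d + 1 = y⁵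
    -- and ℓ + 1 ≤ y³ this fixes the number y⁸ of rounds.
    always-finds : ∀ cs → trouble next bad [] cs ≡ false → found [] cs ≡ true
    always-finds cs fine = finds (target h computes s≤)
      (refutes (subst (2 * nodes F ≤_) (sym (trans (spine-encodeℕ N) N≡))
        (≤-trans (*-mono-≤ (≤-trans (m≤m+n 2 38) 40≤y) enough)
          (≤-trans (≤-reflexive (cong (y *_) (sym (*-identityʳ y)))) (^-monoʳ-≤ y ⦃ >-nonZero (≤-trans (s≤s z≤n) 40≤y) ⦄ (m≤m+n 2 22)))))
        (target h computes s≤) (target-correct h computes s≤))
      cs [] ≤-refl refl fine
      (≤-<-trans (*-monoˡ-≤ (d ^ R) (≤-trans (∑-mono (cube ℓ) (λ C → χ≤1 (agreesWith [] C))) (≤-reflexive (trans (∑-one (cube ℓ)) (length-cube ℓ)))))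
        (decay d ℓ d-positive (begin
          suc d * suc ℓ           ≤⟨ *-mono-≤ (≤-reflexive d≡) (deg-λ ≤-refl 40≤y .bound) ⟩
          y ^ 5 * y ^ 3   ≡⟨ ^-distribˡ-+-* y 5 3 ⟨
          y ^ 8               ≡⟨ R≡ ⟨
          R ∎)))
      where open ≤-Reasoning

    -- Each factor is bounded by a power of two with exponent linear in y: 8y for the rounds, y + 1
    -- ≤ 2y for the labelled inputs and cy for the error demanded. Their sum y(c + 10) is at most B
    -- = y² once c + 10 ≤ y.
    union-small : ∀ f → f ≤ y ^ c → R * 2 ^ suc k * f ≤ 2 ^ B
    union-small f f≤ = begin
      R * 2 ^ suc k * f
        ≤⟨ *-mono-≤ (*-mono-≤ (≤-trans (≤-reflexive R≡) (powers 8)) (^-monoʳ-≤ 2 (s≤s k≤y))) (≤-trans f≤ (powers c)) ⟩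
      2 ^ (y * 8) * 2 ^ suc y * 2 ^ (y * c) ≡⟨ cong (_* 2 ^ (y * c)) (^-distribˡ-+-* 2 (y * 8) (suc y)) ⟨
      2 ^ (y * 8 + suc y) * 2 ^ (y * c)     ≡⟨ ^-distribˡ-+-* 2 (y * 8 + suc y) (y * c) ⟨
      2 ^ (y * 8 + suc y + y * c)           ≤⟨ ^-monoʳ-≤ 2 exponent ⟩
      2 ^ B ∎
      where
      open ≤-Reasoning
      powers : ∀ j → y ^ j ≤ 2 ^ (y * j)
      powers j = ≤-trans (^-monoˡ-≤ j (n≤2^n y)) (≤-reflexive (^-*-assoc 2 y j))
      lemma : ∀ y c → y * 8 + (y + y) + y * c ≡ y * (c + 10)
      lemma = solve-∀
      exponent : y * 8 + suc y + y * c ≤ B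
      exponent = begin
        y * 8 + suc y + y * c   ≤⟨ +-monoˡ-≤ (y * c) (+-monoʳ-≤ (y * 8) (+-monoˡ-≤ y (≤-trans (s≤s z≤n) 40≤y))) ⟩
        y * 8 + (y + y) + y * c ≡⟨ lemma y c ⟩
        y * (c + 10)            ≤⟨ *-monoʳ-≤ y c≤ ⟩
        y * y                   ≡⟨ cong (y *_) (sym (*-identityʳ y)) ⟩
        y ^ 2                   ≡⟨ B≡ ⟨
        B ∎

    rarely : ∀ f → f ≤ y ^ c →
      ∑ (vecs choices R) (χ ∘ trouble next bad []) * f ≤ length (vecs choices R)
    rarely f f≤ = *-cancelʳ-≤ _ _ (2 ^ B) ⦃ m^n≢0 2 B ⦄ (begin
      U * f * 2 ^ B             ≡⟨ *-exchange U f (2 ^ B) ⟩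
      U * 2 ^ B * f             ≤⟨ *-monoˡ-≤ f (rarely-trouble prefers B-positive (n≤1+n ℓ) D-large R []) ⟩
      R * 2 ^ suc k * L * f     ≡⟨ *-exchange (R * 2 ^ suc k) L f ⟩
      R * 2 ^ suc k * f * L     ≤⟨ *-monoˡ-≤ L (union-small f f≤) ⟩
      2 ^ B * L                 ≡⟨ *-comm (2 ^ B) L ⟩
      L * 2 ^ B ∎)
      where
      open ≤-Reasoning
      U L : ℕ
      U = ∑ (vecs choices R) (χ ∘ trouble next bad [])
      L = length (vecs choices R)

    event : Vec Bool (coinsAt R B ℓ) → Bool
    event u = trouble next bad [] (parseCoins R B ℓ u)

    event-rare : ∀ f → f ≤ y ^ c → ∑ (cube (coinsAt R B ℓ)) (χ ∘ event) * f ≤ 2 ^ coinsAt R B ℓ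
    event-rare f f≤ = begin
      ∑ (cube (coinsAt R B ℓ)) (χ ∘ event) * f        ≡⟨ cong (_* f) (∑-parseCoins R B ℓ (χ ∘ trouble next bad [])) ⟩
      ∑ (vecs choices R) (χ ∘ trouble next bad []) * f ≤⟨ rarely f f≤ ⟩
      length (vecs choices R)                          ≡⟨ ∑-one (vecs choices R) ⟨
      ∑ (vecs choices R) (λ _ → 1)                     ≡⟨ ∑-parseCoins R B ℓ (λ _ → 1) ⟨
      ∑ (cube (coinsAt R B ℓ)) (λ _ → 1)               ≡⟨ trans (∑-one (cube (coinsAt R B ℓ))) (length-cube (coinsAt R B ℓ)) ⟩
      2 ^ coinsAt R B ℓ ∎
      where open ≤-Reasoning

    event-runs : ∀ u → event u ≡ false → ∀ ω → ∃ λ res → LevelSuccess (toList u ++ ω) ω res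
    event-runs u fine ω = conclude (level-runs d (parseCoins R B ℓ u) ω)
      where
      conclude : _ → _
      conclude (res , run , _ , success) = res , parsed-runs u run , skolem-outcome (success (always-finds (parseCoins R B ℓ u) fine))

opaque

  levelCallsPoly : Poly 1
  levelCallsPoly = callsᴱ levelE

  levelCostPoly : Poly 2
  levelCostPoly = costᴱ levelE

  levelE-calls : ∀ {v} → callsᴱ levelE ⟨ v ⟩ ≡ levelCallsPoly ⟨ v ⟩
  levelE-calls = refl

  levelE-cost : ∀ {v} → costᴱ levelE ⟨ v ⟩ ≡ levelCostPoly ⟨ v ⟩
  levelE-cost = refl

-- Climbing through the levels

padP : ℕ → P 1
padP c = app₂ addP v0 (numeral c)

numeral-spec : ∀ {N k} c {ρ : Vec Tree k} → sem N (numeral c) ρ ≡ encodeℕ c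
numeral-spec zero    = refl
numeral-spec (suc c) = cong (leaf ·_) (numeral-spec c)

-- An encoded circuit is always a node, so a leaf as the result means that no level has succeeded
-- yet.
levelCond : Prog 7
levelCond = match (var #0) leaf (match (var #1) (leaf · leaf) leaf)

opaque

  levelBody : Prog 7
  levelBody = match (var #0) leaf (bind (leaf · var #0) (bind (compile #0 (lookup (#0 ∷ [])) (powP 24))
    (bind (compileᴱ #0 (lookup (#0 ∷ #1 ∷ #7 ∷ #8 ∷ #9 ∷ #10 ∷ [])) levelE) (var #2 · var #0))))

-- Starting at n + m + c + 50 makes the estimates for large y hold at every level: the 50 lies above
-- the threshold 40 of the degree estimates, and c + 50 leaves room for the error exponent.
learner : ℕ → Prog 4
learner c = bind (compile #1 (lookup (#1 ∷ [])) (padP (c + 50)))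
  (bind (compile #1 (lookup (#1 ∷ #0 ∷ [])) addP)
  (bind (bind (var #0 · leaf) (while levelCond levelBody)) (match (var #0) leaf (var #1))))

module Climbing {n m} (F : Formula n m) (i : Fin m) (X Q : ℕ) (Q≡ : Q ≡ X ^ 40) (nodes≤ : nodes F ≤ X) where

  k : ℕ
  k = n + toℕ i

  Outcome : Tree → Set
  Outcome res = ∃ λ (h : CircuitFor n i) → IsSkolemFunction F i h × res ≡ encodeCircuit h × gates h ≤ X ^ 24

  levelCalls levelTime : ℕ
  levelCalls = levelCallsPoly ⟨ X ^ 24 ∷ [] ⟩
  levelTime = cost (powP 24) ⟨ X ∷ [] ⟩ + levelCostPoly ⟨ X ^ 24 ∷ Q ∷ [] ⟩

  record LevelRun (x : ℕ) (ω : List Bool) (res : Tree) (ω′ : List Bool) : Set where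
    constructor levelRun
    field
      {y N} : ℕ
      y≡    : y ≡ suc x
      N≡    : N ≡ y ^ 24
      run   : RunsE {oracle} {spine (encodeℕ N)} {Q}
        (encodeℕ N ∷ encodeℕ (suc x) ∷ encodeℕ n ∷ encodeℕ m ∷ encodeFin i ∷ encodeFormula F ∷ []) levelE ω res ω′

  opaque

    coins : ℕ → ℕ
    coins x = coinsAt (suc x ^ 8) (suc x ^ 2) (hypLength (suc x) k)

  Ready : ℕ → Set
  Ready x = n + m + 50 ≤ x

  opaque
   unfolding coins

   any-level : ∀ x → Ready x → suc x ≤ X → (u : Vec Bool (coins x)) → ∀ ω → ∃ λ res →
     LevelRun x (toList u ++ ω) res ω × (res ≡ leaf ⊎ Outcome res)
   any-level x ready x≤X = go (suc x) _ _ _ refl refl refl refl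
     where
     go : ∀ y N R B → y ≡ suc x → N ≡ y ^ 24 → R ≡ y ^ 8 → B ≡ y ^ 2 → (u : Vec Bool (coinsAt R B (hypLength (suc x) k))) → ∀ ω → ∃ λ res →
       LevelRun x (toList u ++ ω) res ω × (res ≡ leaf ⊎ Outcome res)
     go y N R B y≡ N≡ R≡ B≡ u ω = conclude (AtLevel.any-run F i X y x y≡
         (≤-trans (≤-trans (m≤m+n 40 10) (≤-trans (m≤n+m 50 (n + m)) ready)) x≤y)
         (≤-trans (≤-reflexive y≡) x≤X) (≤-trans (≤-trans (m≤m+n (n + m) 50) ready) x≤y) nodes≤
         N R B Q Q≡ N≡ R≡ B≡ u ω)
       where
       x≤y : x ≤ y
       x≤y = ≤-trans (n≤1+n x) (≤-reflexive (sym y≡))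
       conclude : (∃ λ res → RunsE {oracle} {spine (encodeℕ N)} {Q}
           (encodeℕ N ∷ encodeℕ (suc x) ∷ encodeℕ n ∷ encodeℕ m ∷ encodeFin i ∷ encodeFormula F ∷ []) levelE (toList u ++ ω) res ω × (res ≡ leaf ⊎ Outcome res)) →
         ∃ λ res → LevelRun x (toList u ++ ω) res ω × (res ≡ leaf ⊎ Outcome res)
       conclude (res , run , sk) = res , levelRun y≡ N≡ run , sk

  -- The coins set aside for the levels before the last one. A run that stops early leaves some of
  -- them untouched.
  skipped : ℕ → ℕ → ℕ
  skipped zero    x = 0
  skipped (suc d) x = coins x + skipped d (suc x)

  opaque
   unfolding coins

   coins≤ : ∀ x → Ready x → suc x ≤ X → coins x ≤ X ^ 18
   coins≤ x ready x≤X = go (suc x) _ _ _ refl refl refl refl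
     where
     go : ∀ y N R B → y ≡ suc x → N ≡ y ^ 24 → R ≡ y ^ 8 → B ≡ y ^ 2 → coinsAt R B (hypLength (suc x) k) ≤ X ^ 18
     go y N R B y≡ N≡ R≡ B≡ = AtLevel.coins≤ F i X y x y≡
         (≤-trans (≤-trans (m≤m+n 40 10) (≤-trans (m≤n+m 50 (n + m)) ready)) x≤y)
         (≤-trans (≤-reflexive y≡) x≤X) (≤-trans (≤-trans (m≤m+n (n + m) 50) ready) x≤y) nodes≤ N R B Q Q≡ N≡ R≡ B≡
       where
       x≤y : x ≤ y
       x≤y = ≤-trans (n≤1+n x) (≤-reflexive (sym y≡))

   -- Probability enters only here. At level X the rows suffice for the promised circuit and the
   -- clock for evaluating F, so the search can fail only on coins in `fails`.
   sure-level : ∀ x → Ready x → X ≡ suc x → ∀ c f → c + 10 ≤ X → f ≤ X ^ c →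
     (h : CircuitFor n i) → Computes F i h → gates h * 3 + 2 ≤ suc x →
     Σ (Vec Bool (coins x) → Bool) λ fails → ∑ (cube (coins x)) (χ ∘ fails) * f ≤ 2 ^ coins x ×
       (∀ u → fails u ≡ false → ∀ ω → ∃ λ res → LevelRun x (toList u ++ ω) res ω × Outcome res)
   sure-level x ready X≡ c f c≤ f≤ h computes small = go (suc x) _ _ _ (sym X≡) refl refl refl refl
     where
     go : ∀ y N R B → y ≡ X → y ≡ suc x → N ≡ y ^ 24 → R ≡ y ^ 8 → B ≡ y ^ 2 →
       Σ (Vec Bool (coinsAt R B (hypLength (suc x) k)) → Bool) λ fails →
         ∑ (cube (coinsAt R B (hypLength (suc x) k))) (χ ∘ fails) * f ≤ 2 ^ coinsAt R B (hypLength (suc x) k) ×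
         (∀ u → fails u ≡ false → ∀ ω → ∃ λ res → LevelRun x (toList u ++ ω) res ω × Outcome res)
     go y N R B refl y≡ N≡ R≡ B≡ = L.event , L.event-rare f f≤ , λ u fine ω → conclude {u} (L.event-runs u fine ω)
       where
       x≤y : x ≤ y
       x≤y = ≤-trans (n≤1+n x) (≤-reflexive (sym y≡))
       40≤y : 40 ≤ y
       40≤y = ≤-trans (≤-trans (m≤m+n 40 10) (≤-trans (m≤n+m 50 (n + m)) ready)) x≤y
       vars≤y : n + m ≤ y
       vars≤y = ≤-trans (≤-trans (m≤m+n (n + m) 50) ready) x≤y
       d≡ : suc (pred (y ^ 5)) ≡ y ^ 5
       d≡ = suc-pred (y ^ 5) ⦃ m^n≢0 y 5 ⦃ >-nonZero (≤-trans (s≤s z≤n) 40≤y) ⦄ ⦄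
       module L = AtLevel.Target F i X y x y≡ 40≤y ≤-refl vars≤y nodes≤ N R B Q Q≡ N≡ R≡ B≡
         c c≤ nodes≤ (pred (y ^ 5)) d≡ h computes small
       conclude : ∀ {u : Vec Bool (coinsAt R B (hypLength (suc x) k))} {ω} → (∃ λ res → AtLevel.LevelSuccess F i X y x y≡ 40≤y ≤-refl vars≤y nodes≤ N R B Q Q≡ N≡ R≡ B≡ (toList u ++ ω) ω res) →
         ∃ λ res → LevelRun x (toList u ++ ω) res ω × Outcome res
       conclude (res , run , out) = res , levelRun y≡ N≡ run , out

  skipped≤ : ∀ d x → suc (x + d) ≤ X → Ready x → skipped d x + coins (x + d) ≤ suc d * X ^ 18
  skipped≤ zero    x x≤X ready = ≤-trans (coins≤ (x + 0) (≤-trans ready (m≤m+n x 0)) x≤X) (≤-reflexive (sym (+-identityʳ (X ^ 18))))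
  skipped≤ (suc d) x x≤X ready = ≤-trans (≤-reflexive (trans (+-assoc (coins x) (skipped d (suc x)) _)
      (cong (λ j → coins x + (skipped d (suc x) + coins j)) (+-suc x d))))
    (+-mono-≤ (coins≤ x ready (≤-trans (s≤s (m≤m+n x (suc d))) x≤X))
      (skipped≤ d (suc x) (≤-trans (≤-reflexive (cong suc (sym (+-suc x d)))) x≤X) (m≤n⇒m≤1+n ready)))

  module _ (start pad : Tree) where

    ρ : Vec Tree 6
    ρ = start ∷ pad ∷ encodeℕ n ∷ encodeℕ m ∷ encodeFin i ∷ encodeFormula F ∷ []

    opaque
     unfolding levelBody

     body-runs : ∀ {x ω res ω′} → suc x ≤ X → LevelRun x ω res ω′ →
       Runs oracle (encodeℕ x · leaf ∷ ρ) levelBody ω (encodeℕ (suc x) · res) ω′ levelCalls (levelTime + 11)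
     body-runs {x} x≤X (levelRun {y} {N} y≡ N≡ run) = runs-weaken calls≤ time≤
       (runs-node (runs-var refl) (runs-bind (runs-· (ran leaf ≤-refl ≤-refl) (runs-var refl))
         (runs-bind (runs-compile-≡ {oracle} {suc x} {V = []} (powP 24) clock (agree λ { #0 → refl }) (spine-encodeℕ (suc x)))
         (runs-bind (run .RunsE.run (agree λ { #0 → refl ; #1 → refl ; #2 → refl ; #3 → refl ; #4 → refl ; #5 → refl }) refl)
           (runs-· (runs-var refl) (runs-var refl))))))
       where
       clock : sem (suc x) (powP 24) (encodeℕ (suc x) ∷ []) ≡ encodeℕ N
       clock = trans (cong (λ z → sem (suc x) (powP 24) (encodeℕ z ∷ [])) (sym y≡))
         (trans (powP-spec 24 y (≤-reflexive y≡)) (cong encodeℕ (sym N≡)))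
       N≤ : spine (encodeℕ N) ≤ X ^ 24
       N≤ = ≤-trans (≤-reflexive (trans (spine-encodeℕ N) N≡)) (^-monoˡ-≤ 24 (≤-trans (≤-reflexive y≡) x≤X))
       calls≤ : callsᴱ levelE ⟨ spine (encodeℕ N) ∷ [] ⟩ + 0 ≤ levelCalls
       calls≤ = ≤-trans (≤-reflexive (trans (+-identityʳ _) levelE-calls)) (poly-mono₁ levelCallsPoly N≤)
       time≤ : 1 + (1 + (1 + (3 + (1 + (cost (powP 24) ⟨ suc x ∷ [] ⟩ + (1 + (costᴱ levelE ⟨ spine (encodeℕ N) ∷ Q ∷ [] ⟩ + 3))))))) ≤ levelTime + 11
       time≤ = ≤-trans (≤-reflexive (lemma (cost (powP 24) ⟨ suc x ∷ [] ⟩) (costᴱ levelE ⟨ spine (encodeℕ N) ∷ Q ∷ [] ⟩)))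
         (+-monoˡ-≤ 11 (+-mono-≤ (poly-mono₁ (cost (powP 24)) x≤X)
           (≤-trans (≤-reflexive levelE-cost) (poly-mono levelCostPoly λ { #0 → N≤ ; #1 → ≤-refl }))))
         where
         lemma : ∀ a b → 1 + (1 + (1 + (3 + (1 + (a + (1 + (b + 3))))))) ≡ a + b + 11
         lemma = solve-∀

    finished : ∀ {x} {h : CircuitFor n i} {ω} → Runs oracle (x · encodeCircuit h ∷ ρ) (while levelCond levelBody) ω (x · encodeCircuit h) ω 0 6
    finished {h = output j} = ran (while-stop (match-node var (match-node var leaf))) z≤n ≤-refl
    finished {h = gate g h} = ran (while-stop (match-node var (match-node var leaf))) z≤n ≤-refl

    Loops : ℕ → List Bool → Tree → List Bool → ℕ → ℕ → Set
    Loops x = Runs oracle (encodeℕ x · leaf ∷ ρ) (while levelCond levelBody)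

    -- The search ends at level suc (x + d) if not before.
    climb : ∀ d x → suc (x + d) ≤ X → Ready x → (pre : Vec Bool (skipped d x)) → ∀ {ω ω′} →
      (∃ λ res → LevelRun (x + d) ω res ω′ × Outcome res) → ∃ λ t → ∃ λ res → ∃ λ ω″ →
      Loops x (toList pre ++ ω) (t · res) ω″
        (suc d * levelCalls) (suc d * (levelTime + 20) + 6) × Outcome res
    step-in : ∀ {x ω ω₁ res t v ω₂ C T} → suc x ≤ X → LevelRun x ω res ω₁ →
      Runs oracle (encodeℕ (suc x) · res ∷ ρ) (while levelCond levelBody) ω₁ (t · v) ω₂ C T →
      Loops x ω (t · v) ω₂ (levelCalls + C) (levelTime + 20 + T)
    step-in {x} {ω} {ω₁} {res} {t} {v} {ω₂} {C} {T} x≤X level (ran d c s) = combine (body-runs x≤X level)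
      where
      lemma : ∀ a b → 8 + (a + 11 + b) ≡ a + 19 + b
      lemma = solve-∀
      combine : Runs oracle (encodeℕ x · leaf ∷ ρ) levelBody ω (encodeℕ (suc x) · res) ω₁ levelCalls (levelTime + 11) →
        Loops x ω (t · v) ω₂ (levelCalls + C) (levelTime + 20 + T)
      combine (ran d′ c′ s′) = ran (while-step (match-node var (match-leaf var (leaf · leaf))) d′ d) (+-mono-≤ c′ c)
        (≤-trans (s≤s (+-monoʳ-≤ 7 (+-mono-≤ s′ s))) (≤-trans (≤-reflexive (lemma levelTime T)) (+-monoˡ-≤ T (+-monoʳ-≤ levelTime (m≤m+n 19 1)))))
    climb zero x x≤X ready [] {ω} {ω′} final = stop (subst (λ j → ∃ λ res → LevelRun j ω res ω′ × Outcome res) (+-identityʳ x) final)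
      where
      stop : (∃ λ res → LevelRun x ω res ω′ × Outcome res) → ∃ λ t → ∃ λ res → ∃ λ ω″ →
        Loops x ω (t · res) ω″ (1 * levelCalls) (1 * (levelTime + 20) + 6) × Outcome res
      stop (res , level , h , sk , refl , small) = encodeℕ (suc x) , res , ω′ ,
        runs-weaken (≤-reflexive refl) (+-monoˡ-≤ 6 (≤-reflexive (sym (+-identityʳ (levelTime + 20)))))
          (step-in (≤-trans (s≤s (m≤m+n x 0)) x≤X) level (finished {h = h})) , h , sk , refl , small
    climb (suc d) x x≤X ready pre {ω} {ω′} final = branch (any-level x ready below (Vec.take (coins x) pre) rest)
      where
      Result : Set
      Result = ∃ λ t → ∃ λ res → ∃ λ ω″ →
        Loops x (toList pre ++ ω) (t · res) ω″
          (suc (suc d) * levelCalls) (suc (suc d) * (levelTime + 20) + 6) × Outcome res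
      rest : List Bool
      rest = toList (Vec.drop (coins x) pre) ++ ω
      below : suc x ≤ X
      below = ≤-trans (s≤s (m≤m+n x (suc d))) x≤X
      pieces : toList (Vec.take (coins x) pre) ++ rest ≡ toList pre ++ ω
      pieces = trans (sym (++-assoc (toList (Vec.take (coins x) pre)) _ ω))
        (cong (_++ ω) (trans (sym (toList-++ (Vec.take (coins x) pre) (Vec.drop (coins x) pre))) (cong toList (take++drop≡id (coins x) pre))))
      joined : ∀ {t ω″ C T} → Loops x (toList (Vec.take (coins x) pre) ++ rest) t ω″ C T →
        Loops x (toList pre ++ ω) t ω″ C T
      joined {t} {ω″} {C} {T} = subst (λ ω₀ → Loops x ω₀ t ω″ C T) pieces
      later : ∀ {res} → LevelRun x (toList (Vec.take (coins x) pre) ++ rest) res rest → res ≡ leaf →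
        (∃ λ t → ∃ λ res → ∃ λ ω″ →
          Loops (suc x) rest (t · res) ω″
            (suc d * levelCalls) (suc d * (levelTime + 20) + 6) × Outcome res) → Result
      later level refl (t , res , ω″ , runs , out) = t , res , ω″ ,
        joined (runs-weaken ≤-refl (≤-reflexive (sym (+-assoc (levelTime + 20) _ 6))) (step-in below level runs)) , out
      branch : (∃ λ res → LevelRun x (toList (Vec.take (coins x) pre) ++ rest) res rest × (res ≡ leaf ⊎ Outcome res)) → Result
      branch (res , level , inj₂ (h , sk , refl , small)) = encodeℕ (suc x) , res , rest ,
        joined (runs-weaken (+-monoʳ-≤ levelCalls z≤n)
          (≤-trans (+-monoʳ-≤ (levelTime + 20) (m≤n+m 6 (suc d * (levelTime + 20)))) (≤-reflexive (sym (+-assoc (levelTime + 20) _ 6))))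
          (step-in below level (finished {h = h}))) ,
        h , sk , refl , small
      branch (res , level , inj₁ eq) = later level eq
        (climb d (suc x) (≤-trans (≤-reflexive (cong suc (sym (+-suc x d)))) x≤X) (m≤n⇒m≤1+n ready) (Vec.drop (coins x) pre)
          (subst (λ j → ∃ λ res → LevelRun j ω res ω′ × Outcome res) (+-suc x d) final))

-- Polynomial bounds and the final estimate

compose : ∀ {j k} → Poly j → Vec (Poly k) j → Poly k
compose (con a) qs = con a
compose (var j) qs = lookup qs j
compose (p ⊕ q) qs = compose p qs ⊕ compose q qs
compose (p ⊗ q) qs = compose p qs ⊗ compose q qs

compose-⟨⟩ : ∀ {j k} (p : Poly j) (qs : Vec (Poly k) j) v → compose p qs ⟨ v ⟩ ≡ p ⟨ Vec.map (_⟨ v ⟩) qs ⟩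
compose-⟨⟩ (con a) qs v = refl
compose-⟨⟩ (var j) qs v = sym (lookup-map j (_⟨ v ⟩) qs)
compose-⟨⟩ (p ⊕ q) qs v = cong₂ _+_ (compose-⟨⟩ p qs v) (compose-⟨⟩ q qs v)
compose-⟨⟩ (p ⊗ q) qs v = cong₂ _*_ (compose-⟨⟩ p qs v) (compose-⟨⟩ q qs v)

power : ∀ {k} → Poly k → ℕ → Poly k
power p zero    = con 1
power p (suc j) = p ⊗ power p j

power-⟨⟩ : ∀ {k} (p : Poly k) j v → power p j ⟨ v ⟩ ≡ p ⟨ v ⟩ ^ j
power-⟨⟩ p zero    v = refl
power-⟨⟩ p (suc j) v = cong (p ⟨ v ⟩ *_) (power-⟨⟩ p j v)

opaque

  startPoly : ℕ → Poly 1
  startPoly c = cost (padP (c + 50)) ⊕ cost addP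

  startPoly-⟨⟩ : ∀ {c v} → startPoly c ⟨ v ⟩ ≡ cost (padP (c + 50)) ⟨ v ⟩ + cost addP ⟨ v ⟩
  startPoly-⟨⟩ = refl

  powCost : Poly 1
  powCost = cost (powP 24)

  powCost-⟨⟩ : ∀ {v} → powCost ⟨ v ⟩ ≡ cost (powP 24) ⟨ v ⟩
  powCost-⟨⟩ = refl

  -- The starting level lies n + m + c + 50 high. It is raised by the nodes of F, which makes the
  -- clock sufficient for evaluating F, and by three rows for each of the s gates; the two rows for
  -- the output are covered by the 50.
  lastLevel : ℕ → Poly 2
  lastLevel c = con 1 ⊕ (var #0 ⊕ (con (c + 50) ⊕ (var #1 ⊗ con 3)))

  lastLevel-⟨⟩ : ∀ c a s → lastLevel c ⟨ a ∷ s ∷ [] ⟩ ≡ suc (a + (c + 50 + s * 3))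
  lastLevel-⟨⟩ c a s = refl

-- The variable stands for the last level.
callsBy timeBy : ℕ → Poly 1
callsBy c = var #0 ⊗ compose levelCallsPoly (power (var #0) 24 ∷ [])
timeBy c = (var #0 ⊗ power (var #0) 18) ⊕ (startPoly c ⊕ (((var #0 ⊗ ((powCost ⊕
    compose levelCostPoly (power (var #0) 24 ∷ power (var #0) 40 ∷ [])) ⊕ con 20)) ⊕ con 20) ⊕
  ((con 1 ⊕ power (var #0) 24) ⊗ ((con 4 ⊗ (var #0 ⊕ power (var #0) 24)) ⊕ con 13))))

callBound timeBound : ℕ → Poly 2
callBound c = compose (callsBy c) (lastLevel c ∷ [])
timeBound c = compose (timeBy c) (lastLevel c ∷ [])

callsBy-⟨⟩ : ∀ c x → callsBy c ⟨ x ∷ [] ⟩ ≡ x * levelCallsPoly ⟨ x ^ 24 ∷ [] ⟩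
callsBy-⟨⟩ c x = cong (x *_) (trans (compose-⟨⟩ levelCallsPoly (power (var #0) 24 ∷ []) (x ∷ []))
  (cong (λ u → levelCallsPoly ⟨ u ∷ [] ⟩) (power-⟨⟩ (var #0) 24 (x ∷ []))))

runTime : ℕ → ℕ → ℕ
runTime c x = x * x ^ 18 + (startPoly c ⟨ x ∷ [] ⟩ + (x * (cost (powP 24) ⟨ x ∷ [] ⟩ + levelCostPoly ⟨ x ^ 24 ∷ x ^ 40 ∷ [] ⟩ + 20) + 20 +
  suc (x ^ 24) * (4 * (x + x ^ 24) + 13)))

timeBy-⟨⟩ : ∀ c x → timeBy c ⟨ x ∷ [] ⟩ ≡ runTime c x
timeBy-⟨⟩ c x = cong₂ _+_ (cong (x *_) (p 18)) (cong (startPoly c ⟨ x ∷ [] ⟩ +_)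
  (cong₂ _+_ (cong (λ u → x * (u + 20) + 20) (cong₂ _+_ (powCost-⟨⟩ {x ∷ []})
      (trans (compose-⟨⟩ levelCostPoly (power (var #0) 24 ∷ power (var #0) 40 ∷ []) (x ∷ []))
        (cong₂ (λ u w → levelCostPoly ⟨ u ∷ w ∷ [] ⟩) (p 24) (p 40)))))
    (cong (λ u → suc u * (4 * (x + u) + 13)) (p 24))))
  where
  p : ∀ j → power (var #0) j ⟨ x ∷ [] ⟩ ≡ x ^ j
  p j = power-⟨⟩ (var #0) j (x ∷ [])

module Learned {n m} (F : Formula n m) (i : Fin m) (c s X Q : ℕ) (Q≡ : Q ≡ X ^ 40)
  (X≡ : X ≡ suc (n + (m + (c + 50)) + (nodes F + s * 3)))
  (h : CircuitFor n i) (size≡ : gates h ≡ s) (computes : Computes F i h) where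

  x₀ d : ℕ
  x₀ = n + (m + (c + 50))
  d = nodes F + s * 3

  nodes≤X : nodes F ≤ X
  nodes≤X = ≤-trans (≤-trans (m≤m+n (nodes F) (s * 3)) (≤-trans (m≤n+m d x₀) (n≤1+n _))) (≤-reflexive (sym X≡))

  open Climbing F i X Q Q≡ nodes≤X

  ready : Ready x₀
  ready = ≤-trans (m≤n+m (n + m + 50) c) (≤-reflexive (lemma n m c))
    where
    lemma : ∀ n m c → c + (n + m + 50) ≡ n + (m + (c + 50))
    lemma = solve-∀

  last≤X : suc (x₀ + d) ≤ X
  last≤X = ≤-reflexive (sym X≡)

  x₀≤X : x₀ ≤ X
  x₀≤X = ≤-trans (≤-trans (m≤m+n x₀ d) (n≤1+n _)) last≤X

  c+50≤X : c + 50 ≤ X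
  c+50≤X = ≤-trans (≤-trans (m≤n+m (c + 50) m) (m≤n+m _ n)) x₀≤X

  small : gates h * 3 + 2 ≤ suc (x₀ + d)
  small = begin
    gates h * 3 + 2   ≡⟨ cong (λ g → g * 3 + 2) size≡ ⟩
    s * 3 + 2         ≤⟨ +-mono-≤ (m≤n+m (s * 3) (nodes F)) (≤-trans (m≤m+n 2 48) (≤-trans (m≤n+m 50 c) (≤-trans (m≤n+m (c + 50) m) (m≤n+m _ n)))) ⟩
    d + x₀            ≡⟨ +-comm d x₀ ⟩
    x₀ + d            ≤⟨ n≤1+n _ ⟩
    suc (x₀ + d) ∎
    where open ≤-Reasoning

  k≤X : n + toℕ i ≤ X
  k≤X = ≤-trans (+-monoʳ-≤ n (≤-trans (<⇒≤ (toℕ<n i)) (m≤m+n m (c + 50)))) x₀≤X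

  padP-spec : sem m (padP (c + 50)) (encodeℕ m ∷ []) ≡ encodeℕ (m + (c + 50))
  padP-spec = trans (cong (λ t → sem m addP (encodeℕ m ∷ t ∷ [])) (numeral-spec (c + 50))) (addP-spec m (c + 50) ≤-refl)

  runs : ∀ {ω₁ ω₂} → (pre : Vec Bool (skipped d x₀)) → (∃ λ res → LevelRun (x₀ + d) ω₁ res ω₂ × Outcome res) →
    ∃ λ res → ∃ λ ω″ → Runs oracle (input F i) (learner c) (toList pre ++ ω₁) res ω″ (suc d * levelCalls)
      (startPoly c ⟨ X ∷ [] ⟩ + (suc d * (levelTime + 20) + 20)) × Outcome res
  runs {ω₁} pre final = conclude (climb (encodeℕ x₀) (encodeℕ (m + (c + 50))) d x₀ last≤X ready pre final)
    where
    time≤ : 1 + (cost (padP (c + 50)) ⟨ m ∷ [] ⟩ + (1 + (cost addP ⟨ n ∷ [] ⟩ + (1 + (1 + (3 + (suc d * (levelTime + 20) + 6)) + 3)))))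
      ≤ startPoly c ⟨ X ∷ [] ⟩ + (suc d * (levelTime + 20) + 20)
    time≤ = begin
      1 + (cost (padP (c + 50)) ⟨ m ∷ [] ⟩ + (1 + (cost addP ⟨ n ∷ [] ⟩ + (1 + (1 + (3 + (suc d * (levelTime + 20) + 6)) + 3)))))
        ≡⟨ lemma (cost (padP (c + 50)) ⟨ m ∷ [] ⟩) (cost addP ⟨ n ∷ [] ⟩) (suc d * (levelTime + 20)) ⟩
      cost (padP (c + 50)) ⟨ m ∷ [] ⟩ + cost addP ⟨ n ∷ [] ⟩ + (suc d * (levelTime + 20) + 16)
        ≤⟨ +-mono-≤ (+-mono-≤ (poly-mono₁ (cost (padP (c + 50))) (≤-trans (≤-trans (m≤m+n m _) (m≤n+m _ n)) x₀≤X))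
             (poly-mono₁ (cost addP) (≤-trans (m≤m+n n _) x₀≤X))) (+-monoʳ-≤ (suc d * (levelTime + 20)) (m≤m+n 16 4)) ⟩
      cost (padP (c + 50)) ⟨ X ∷ [] ⟩ + cost addP ⟨ X ∷ [] ⟩ + (suc d * (levelTime + 20) + 20)
        ≡⟨ cong (_+ (suc d * (levelTime + 20) + 20)) (startPoly-⟨⟩ {c} {X ∷ []}) ⟨
      startPoly c ⟨ X ∷ [] ⟩ + (suc d * (levelTime + 20) + 20) ∎
      where
      open ≤-Reasoning
      lemma : ∀ a b u → 1 + (a + (1 + (b + (1 + (1 + (3 + (u + 6)) + 3))))) ≡ a + b + (u + 16)
      lemma = solve-∀
    conclude : (∃ λ t → ∃ λ res → ∃ λ ω″ →
        Loops (encodeℕ x₀) (encodeℕ (m + (c + 50))) x₀ (toList pre ++ ω₁) (t · res) ω″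
          (suc d * levelCalls) (suc d * (levelTime + 20) + 6) × Outcome res) →
      ∃ λ res → ∃ λ ω″ → Runs oracle (input F i) (learner c) (toList pre ++ ω₁) res ω″ (suc d * levelCalls)
        (startPoly c ⟨ X ∷ [] ⟩ + (suc d * (levelTime + 20) + 20)) × Outcome res
    conclude (t , res , ω″ , loop , out) = res , ω″ ,
      runs-weaken (≤-reflexive (+-identityʳ (suc d * levelCalls))) time≤
        (runs-bind (runs-compile-≡ {oracle} {m} {V = []} (padP (c + 50)) {ρ = encodeℕ m ∷ []} padP-spec (agree λ { #0 → refl }) (spine-encodeℕ m))
        (runs-bind (runs-compile-≡ {oracle} {n} {V = []} addP (addP-spec n (m + (c + 50)) ≤-refl) (agree λ { #0 → refl ; #1 → refl }) (spine-encodeℕ n))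
        (runs-bind (runs-bind (runs-· (runs-var refl) (ran leaf ≤-refl ≤-refl)) loop) (ran (match-node var var) z≤n ≤-refl)))) , out

  suc-d≤X : suc d ≤ X
  suc-d≤X = ≤-trans (s≤s (m≤n+m d x₀)) last≤X

  succeeds : ∀ {C T ω₁ ω₂} → X * levelCalls ≤ C → runTime c X ≤ T → (pre : Vec Bool (skipped d x₀)) →
    (∃ λ res → LevelRun (x₀ + d) ω₁ res ω₂ × Outcome res) → Succeeds oracle (learner c) F i C T (toList pre ++ ω₁)
  succeeds {C} {T} {ω₁} C≤ T≤ pre final = conclude (runs pre final)
    where
    conclude : (∃ λ res → ∃ λ ω″ → Runs oracle (input F i) (learner c) (toList pre ++ ω₁) res ω″ (suc d * levelCalls)
      (startPoly c ⟨ X ∷ [] ⟩ + (suc d * (levelTime + 20) + 20)) × Outcome res) → Succeeds oracle (learner c) F i C T (toList pre ++ ω₁)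
    conclude (_ , ω″ , ran run calls≤ steps≤ , h′ , skolem , refl , gates≤) = h′ , skolem , ω″ , run ,
      ≤-trans calls≤ (≤-trans (*-monoˡ-≤ levelCalls suc-d≤X) C≤) ,
      (begin
        steps run + size (encodeCircuit h′) ≤⟨ +-mono-≤ steps≤ (≤-trans (size-encodeCircuit h′) (*-mono-≤ (s≤s gates≤)
             (+-monoˡ-≤ 13 (*-monoʳ-≤ 4 (+-mono-≤ k≤X gates≤))))) ⟩
        startPoly c ⟨ X ∷ [] ⟩ + (suc d * (levelTime + 20) + 20) + output-size
          ≤⟨ +-monoˡ-≤ output-size (+-monoʳ-≤ (startPoly c ⟨ X ∷ [] ⟩) (+-monoˡ-≤ 20 (*-monoˡ-≤ (levelTime + 20) suc-d≤X))) ⟩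
        startPoly c ⟨ X ∷ [] ⟩ + (X * (levelTime + 20) + 20) + output-size ≡⟨ +-assoc (startPoly c ⟨ X ∷ [] ⟩) _ output-size ⟩
        startPoly c ⟨ X ∷ [] ⟩ + (X * (levelTime + 20) + 20 + output-size)
          ≡⟨ cong (λ q → startPoly c ⟨ X ∷ [] ⟩ + (X * (cost (powP 24) ⟨ X ∷ [] ⟩ + levelCostPoly ⟨ X ^ 24 ∷ q ∷ [] ⟩ + 20) + 20 + output-size)) Q≡ ⟩
        startPoly c ⟨ X ∷ [] ⟩ + (X * (cost (powP 24) ⟨ X ∷ [] ⟩ + levelCostPoly ⟨ X ^ 24 ∷ X ^ 40 ∷ [] ⟩ + 20) + 20 + output-size)
          ≤⟨ m≤n+m _ (X * X ^ 18) ⟩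
        runTime c X ≤⟨ T≤ ⟩
        T ∎)
      where
      open ≤-Reasoning
      output-size : ℕ
      output-size = suc (X ^ 24) * (4 * (X + X ^ 24) + 13)

  -- The event speaks only of the coins set aside for the last level. A run may end earlier, but
  -- only with a certified circuit, so on this event it succeeds no matter how far it climbs.
  learns : ∀ {C T} f → f ≤ X ^ c → X * levelCalls ≤ C → runTime c X ≤ T → LearnsSkolemFunction oracle (learner c) F i f C T
  learns {C} {T} f f≤ C≤ T≤ = conclude rest (sym total) (sure-level (x₀ + d) (≤-trans ready (m≤m+n x₀ d)) X≡ c f
      (≤-trans (+-monoʳ-≤ c (m≤m+n 10 40)) c+50≤X) f≤ h computes small)
    where
    a b rest : ℕ
    a = skipped d x₀
    b = coins (x₀ + d)
    rest = T ∸ (a + b)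
    -- The time bound contains X times X^18, which covers the coins of all levels, so the cut fits
    -- into a sequence of length `T`.
    total : a + (b + rest) ≡ T
    total = trans (sym (+-assoc a b rest)) (m+[n∸m]≡n (≤-trans (skipped≤ d x₀ last≤X ready)
      (≤-trans (*-monoˡ-≤ (X ^ 18) suc-d≤X) (≤-trans (m≤m+n (X * X ^ 18) _) T≤))))
    conclude : ∀ r → T ≡ a + (b + r) →
      (Σ (Vec Bool b → Bool) λ fails → ∑ (cube b) (χ ∘ fails) * f ≤ 2 ^ b ×
        (∀ u → fails u ≡ false → ∀ ω → ∃ λ res → LevelRun (x₀ + d) (toList u ++ ω) res ω × Outcome res)) →
      LearnsSkolemFunction oracle (learner c) F i f C T
    conclude r T≡ (fails , rare , runs) = subst (λ T′ → HoldsWithError1/ f {T′} λ ω → Succeeds oracle (learner c) F i C T (toList ω)) (sym T≡)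
      ((not ∘ fails ∘ middle) , success , probability)
      where
      middle : Vec Bool (a + (b + r)) → Vec Bool b
      middle ω = Vec.take b (Vec.drop a ω)
      not-true : ∀ {b} → not b ≡ true → b ≡ false
      not-true {false} _ = refl
      not-not : ∀ b → not (not b) ≡ b
      not-not true  = refl
      not-not false = refl
      success : ∀ ω → not (fails (middle ω)) ≡ true → Succeeds oracle (learner c) F i C T (toList ω)
      success ω fine = subst (Succeeds oracle (learner c) F i C T) pieces
        (succeeds C≤ T≤ (Vec.take a ω) (runs (middle ω) (not-true fine) (toList (Vec.drop b (Vec.drop a ω)))))
        where
        pieces : toList (Vec.take a ω) ++ toList (middle ω) ++ toList (Vec.drop b (Vec.drop a ω)) ≡ toList ω
        pieces = trans (cong (toList (Vec.take a ω) ++_) (trans (sym (toList-++ (middle ω) (Vec.drop b (Vec.drop a ω))))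
            (cong toList (take++drop≡id b (Vec.drop a ω)))))
          (trans (sym (toList-++ (Vec.take a ω) (Vec.drop a ω))) (cong toList (take++drop≡id a ω)))
      probability : count (not ∘ not ∘ fails ∘ middle) * f ≤ 2 ^ (a + (b + r))
      probability = begin
        count (not ∘ not ∘ fails ∘ middle) * f
          ≡⟨ cong (_* f) (trans (count-cube (not ∘ not ∘ fails ∘ middle)) (trans (∑-cong (cube (a + (b + r))) λ ω → cong χ (not-not (fails (middle ω))))
               (∑-middle a b r (χ ∘ fails)))) ⟩
        2 ^ a * (2 ^ r * ∑ (cube b) (χ ∘ fails)) * f   ≡⟨ lemma (2 ^ a) (2 ^ r) _ f ⟩
        2 ^ a * (2 ^ r * (∑ (cube b) (χ ∘ fails) * f)) ≤⟨ *-monoʳ-≤ (2 ^ a) (*-monoʳ-≤ (2 ^ r) rare) ⟩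
        2 ^ a * (2 ^ r * 2 ^ b)   ≡⟨ cong (2 ^ a *_) (trans (*-comm (2 ^ r) (2 ^ b)) (sym (^-distribˡ-+-* 2 b r))) ⟩
        2 ^ a * 2 ^ (b + r)       ≡⟨ ^-distribˡ-+-* 2 a (b + r) ⟨
        2 ^ (a + (b + r)) ∎
        where
        open ≤-Reasoning
        lemma : ∀ a r s f → a * (r * s) * f ≡ a * (r * (s * f))
        lemma = solve-∀

-- The oracle is fixed before the error exponent c, and the learner before the specification. As s
-- is not among its inputs, s enters only through the level at which a successful run ends at the
-- latest.
theorem7 : Σ Oracle λ O → InNP O ×
    ((c : ℕ) →
    Σ (Prog 4) λ L → Σ (Poly 2) λ callBound → Σ (Poly 2) λ timeBound →
    ∀ {n m} (F : Formula n m) (i : Fin m) (s : ℕ) →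
    UniquelyDefinedByCircuitOfSize F i s →
    LearnsSkolemFunction O L F i (∣ F ∣ ^ c)
    (callBound ⟨ ∣ F ∣ ∷ s ∷ [] ⟩) (timeBound ⟨ ∣ F ∣ ∷ s ∷ [] ⟩))
theorem7 = oracle , oracle-NP , λ c → learner c , callBound c , timeBound c , λ F i s (h , size≡ , computes) →
  bounded c F i s h size≡ computes (lastLevel c ⟨ ∣ F ∣ ∷ s ∷ [] ⟩) (lastLevel-⟨⟩ c ∣ F ∣ s)
    (compose-⟨⟩ (callsBy c) (lastLevel c ∷ []) (∣ F ∣ ∷ s ∷ [])) (compose-⟨⟩ (timeBy c) (lastLevel c ∷ []) (∣ F ∣ ∷ s ∷ []))
  where
  bounded : ∀ c {n m} (F : Formula n m) (i : Fin m) s (h : CircuitFor n i) → gates h ≡ s → Computes F i h →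
    ∀ X → X ≡ suc (∣ F ∣ + (c + 50 + s * 3)) → ∀ {C T} → C ≡ callsBy c ⟨ X ∷ [] ⟩ → T ≡ timeBy c ⟨ X ∷ [] ⟩ →
    LearnsSkolemFunction oracle (learner c) F i (∣ F ∣ ^ c) C T
  bounded c {n} {m} F i s h size≡ computes top X≡ C≡ T≡ =
    Learned.learns F i c s top (top ^ 40) refl (trans X≡ (cong suc (lemma n m (nodes F) c s))) h size≡ computes
      (∣ F ∣ ^ c) (^-monoˡ-≤ c (≤-trans (≤-trans (m≤m+n ∣ F ∣ (c + 50 + s * 3)) (n≤1+n _)) (≤-reflexive (sym X≡))))
      (≤-reflexive (sym (trans C≡ (callsBy-⟨⟩ c top)))) (≤-reflexive (sym (trans T≡ (timeBy-⟨⟩ c top))))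
    where
    lemma : ∀ n m f c s → n + m + f + (c + 50 + s * 3) ≡ n + (m + (c + 50)) + (f + s * 3)
    lemma = solve-∀
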